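{- In each part below, $a_n$ denotes the $n$-th coefficient of the stated power series expansion $\sum_{n\ge0}a_nq^n$. (1) Let $p\ge3$ be prime and $\frac{(q^2;q^2)_\infty^2}{(q;q)_\infty(q^p;q^p)_\infty}=\sum a_nq^n$. Let $N=\max\big(\bigcup_{s=0}^{p-1}\min\{\frac{r(r+1)}{2}: \frac{r(r+1)}{2}\equiv s\pmod p,\ 0\le r\le p-1\}\big)-p$ (union over those $s$ for which the set is nonempty). Then for $n>N$, $a_n>0$ if $n\equiv \frac{r(r+1)}{2}\pmod p$ for some $r\in\mathbb{Z}/p\mathbb{Z}$, and $a_n=0$ otherwise. (2) Let $p=1$ or $p$ an odd prime, and $\frac{(q;q)_\infty^2}{(q^2;q^2)_\infty(q^{4p};q^{4p})_\infty}=\sum a_nq^n$. Let $N=\max\big(\bigcup_{s=0}^{4p-1}\min\{r^2: r^2\equiv s\pmod{4p},\ 0\le r\le 4p-1\}\big)-4p$ (union over those $s$ for which the set is nonempty). Then for $n>N$: $a_n<0$ if $n\equiv 4t^2+4t+1\pmod{4p}$ for some $t\in\mathbb{Z}/p\mathbb{Z}$; $a_n>0$ if $n\equiv 4t^2\pmod{4p}$ for some $t\in\mathbb{Z}/p\mathbb{Z}$; and $a_n=0$ otherwise, i.e. when $n\equiv 2,3\pmod 4$ or $\left(\frac{n}{p}\right)=-1$. (3) If $\frac{(q;q)_\infty^3}{(q^3;q^3)_\infty^2}=\sum a_nq^n$, then $a_n>0$ if $n\equiv0\pmod3$, $a_n<0$ if $n\equiv1\pmod3$, and $a_n=0$ otherwise.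 (4) If $\frac{(q;q)_\infty^2}{(q^2;q^2)_\infty(q^3;q^3)_\infty^2}=\sum a_nq^n$, then $a_n>0$ if $n\equiv0\pmod3$, $a_n<0$ if $n\equiv1\pmod3$, and $a_n=0$ otherwise. (5) If $\frac{(q;q)_\infty^4}{(q^2;q^2)_\infty^2(q^4;q^4)_\infty}=\sum a_nq^n$, then $a_n>0$ if $n\equiv0,2\pmod4$, $a_n<0$ if $n\equiv1\pmod4$, and $a_n=0$ otherwise. (6) If $\frac{(q^2;q^2)_\infty^{10}}{(q;q)_\infty^4(q^4;q^4)_\infty^5}=\sum a_nq^n$, then $a_n>0$ if $n\equiv0,1,2\pmod4$, and $a_n=0$ otherwise. (7) If $\frac{(q;q)_\infty^2}{(q^5;q^5)_\infty^3}=\sum a_nq^n$, then $a_n>0$ if $n\equiv0,3,4\pmod5$, and $a_n<0$ otherwise. (8) If $\frac{(q;q)_\infty^9}{(q^3;q^3)_\infty^9}=\sum a_nq^n$, then $a_n>0$ if $n\equiv0,2,5,8\pmod9$, $a_n<0$ if $n\equiv1,3,4,7\pmod9$, and $a_n=0$ otherwise. (9) Let $i\ge11$ be an integer and $\frac{(q;q)_\infty^9}{(q^3;q^3)_\infty^i}=\sum a_nq^n$. (a) If $i=11$: $a_n>0$ if $n\equiv0,2,5,8\pmod9$, and $a_n<0$ otherwise. (b) If $i=12$: $a_n>0$ if $n\equiv0,2,5,8\pmod9$, $a_n<0$ if $n\equiv1,4,7\pmod9$, and $a_n=0$ otherwise. (c) If $i>12$: $a_n>0$ if $n\equiv0,2\pmod3$,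 and $a_n<0$ otherwise.
   Context: For $|q|<1$ and integer $k\ge1$, $(q^k;q^k)_\infty=\prod_{m\ge1}(1-q^{km})$. $\left(\frac{n}{p}\right)$ is the Legendre symbol. All coefficients are integers of formal power series in $q$. -}

module Defs where

open import Data.Bool using (Bool; true; false; if_then_else_)
open import Data.Nat as ℕ using (ℕ; zero; suc; _⊔_; _⊓_; _<_; ∣_-_∣; _∸_)
open import Data.Nat.Divisibility using (_∣_; _∣?_)
open import Data.Nat.DivMod using (_/_)
open import Data.Integer as ℤ using (ℤ; +_; 0ℤ; 1ℤ)
open import Data.List using (List; []; _∷_; foldr; map; upTo; filter; mapMaybe)
open import Data.Maybe using (Maybe; just; nothing)
open import Data.Product using (∃-syntax; _×_)
open import Relation.Nullary.Decidable using (⌊_⌋)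
open import Relation.Binary.PropositionalEquality using (_≡_)

-- Formal power series over ℤ, given by their coefficient sequences:
-- f n is the coefficient of q^n.
PS : Set
PS = ℕ → ℤ

sumTo : ℕ → (ℕ → ℤ) → ℤ
sumTo zero    h = h 0
sumTo (suc n) h = sumTo n h ℤ.+ h (suc n)

_⊛_ : PS → PS → PS
(f ⊛ g) n = sumTo n (λ i → f i ℤ.* g (n ∸ i))

onePS : PS
onePS zero    = 1ℤ
onePS (suc _) = 0ℤ

δ : ℕ → ℕ → ℤ
δ a b = if ⌊ a ℕ.≟ b ⌋ then 1ℤ else 0ℤ

oneMinus : ℕ → PS
oneMinus j n = δ 0 n ℤ.- δ j n

-- The geometric series 1/(1 - q^j) = Σ_{t≥0} q^{jt}  (used with j ≥ 1).
geom : ℕ → PS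
geom j n = if ⌊ j ∣? n ⌋ then 1ℤ else 0ℤ

prodUpTo : (ℕ → PS) → ℕ → PS
prodUpTo F zero    = onePS
prodUpTo F (suc m) = prodUpTo F m ⊛ F (suc m)

-- (q^k;q^k)_∞ = ∏_{m≥1} (1 - q^{km}) for k ≥ 1.  Its n-th coefficient only
-- depends on the factors with m ≤ n (the others are ≡ 1 mod q^{n+1}).
qpoch : ℕ → PS
qpoch k n = prodUpTo (λ m → oneMinus (k ℕ.* m)) n n

-- 1/(q^k;q^k)_∞ = ∏_{m≥1} 1/(1 - q^{km}) for k ≥ 1, same truncation remark.
qpochInv : ℕ → PS
qpochInv k n = prodUpTo (λ m → geom (k ℕ.* m)) n n

powPS : PS → ℕ → PS
powPS f zero    = onePS
powPS f (suc e) = powPS f e ⊛ f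

open import Data.Product using (_,_)
etaQ : List (ℕ × ℕ) → List (ℕ × ℕ) → PS
etaQ num den =
  foldr (λ { (k , e) acc → powPS (qpoch k) e ⊛ acc }) onePS num
  ⊛ foldr (λ { (k , e) acc → powPS (qpochInv k) e ⊛ acc }) onePS den

_≡_[mod_] : ℕ → ℕ → ℕ → Set
a ≡ b [mod m ] = m ∣ ∣ a - b ∣

tri : ℕ → ℕ
tri r = r ℕ.* (r ℕ.+ 1) / 2

minMaybe : List ℕ → Maybe ℕ
minMaybe []       = nothing
minMaybe (x ∷ xs) = just (foldr _⊓_ x xs)

minRep : (ℕ → ℕ) → ℕ → ℕ → ℕ → Maybe ℕ
minRep f m R s = minMaybe (filter (λ v → m ∣? ∣ v - s ∣) (map f (upTo R)))

-- max of the union over s = 0..m-1 of the (nonempty) sets minRep f m R s.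
-- (All values are ≥ 0 and the union is nonempty whenever f 0 is in range,
--  so folding with base 0 gives exactly the maximum.)
maxMinRep : (ℕ → ℕ) → ℕ → ℕ → ℕ
maxMinRep f m R = foldr _⊔_ 0 (mapMaybe (minRep f m R) (upTo m))

Pos Neg Zero : ℤ → Set
Pos x  = 0ℤ ℤ.< x
Neg x  = x ℤ.< 0ℤ
Zero x = x ≡ 0ℤ

{-# OPTIONS --safe #-}
module Submission where

-- Every numerator is expressed by theta series and dissected into residue classes of exponents; the denominators in q^k only multiply
-- each class by a series in q^k.  After q^k ↦ q, each class times 1/(q;q)_∞^j is either zero or, up to sign, visibly positive: either
-- a theta series with nonnegative coefficients, or a product whose factors cancel against those of 1/(q;q)_∞.  Theta series are
-- turned into products by the Jacobi triple product, obtained as a limit of its finite q-binomial form; working over the dual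
-- numbers, with z = 1 + ε, also gives the weighted sums needed for (q;q)_∞^3.  Two classes need algebraic identities: in (7) the
-- product of the two outer classes of (q;q)_∞ modulo 5 is found from (q;q)_∞^3 having no exponent 2 modulo 5, and in (8), (9) the
-- class 0 of (q;q)_∞^9 is a norm from series in q to series in q^3, hence equals (q^3;q^3)_∞^12 / (q^9;q^9)_∞^3.

open import Defs
open import Algebra.Bundles using (CommutativeRing; CommutativeSemiring)
import Algebra.Properties.Semiring.Exp as Exp
import Algebra.Solver.Ring
open import Algebra.Solver.Ring.AlmostCommutativeRing using (fromCommutativeRing; _-Raw-AlmostCommutative⟶_)
import Algebra.Solver.Ring.NaturalCoefficients.Default as NatSolver
open import Algebra.Structures using (IsCommutativeRing)
open import Algebra.Structures.Biased using (isCommutativeSemiringˡ)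
open import Data.Bool using (if_then_else_)
open import Data.Empty using (⊥; ⊥-elim)
open import Data.Integer as ℤ using (ℤ; +_; 0ℤ; 1ℤ; -1ℤ) renaming (_+_ to _+ᶻ_; _*_ to _*ᶻ_)
import Data.Integer.Properties as ℤP
open import Data.List using (List; []; _∷_; length; map; upTo; mapMaybe; foldr)
open import Data.List.Membership.Propositional using (_∈_)
open import Data.List.Membership.Propositional.Properties using (∈-map⁺; ∈-map⁻; ∈-upTo⁺; ∈-filter⁺; ∈-filter⁻; foldr-selective)
open import Data.List.Relation.Unary.Any using (here; there)
open import Data.Maybe using (Maybe; just; nothing)
open import Data.Nat as ℕ using (ℕ; zero; suc; _≤_; _<_; _*_; _+_; _%_; _∸_; _⊔_; ∣_-_∣; z≤n; s≤s)
open import Data.Nat.DivMod using (_/_; m≡m%n+[m/n]*n; [m+kn]%n≡m%n; m<n⇒m%n≡m; m%n<n; m*n/n≡m; m*n%n≡0)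
open import Data.Nat.Divisibility using (_∣_; _∣?_; divides; ∣⇒≤; ∣m+n∣m⇒∣n; ∣m∣n⇒∣m+n; ∣-refl; _∣0; ∣-trans; m∣m*n)
open import Data.Nat.Primality using (Prime; prime⇒irreducible)
open import Data.Nat.Properties as ℕP using (≤-refl; ≤-trans; m≤m+n; m≤n+m; ≤-reflexive; n≤1+n; m≤m*n; m≤n⇒m≤1+n; ≤-<-trans)
open import Data.Nat.Tactic.RingSolver using (solve-∀)
open import Data.Product using (_×_; _,_; ∃-syntax; proj₁; proj₂)
open import Data.Sum using (_⊎_; inj₁; inj₂)
open import Function using (_∘_)
open import Level using (0ℓ)
open import Relation.Binary.PropositionalEquality hiding (J)
open import Relation.Binary.Structures using (IsEquivalence)
open import Relation.Nullary using (¬_; Dec; yes; no)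
open import Relation.Nullary.Decidable using (⌊_⌋)

-- The case distinctions come out of the exponents. Each factor of a class needs one or two copies
-- of 1/(q;q)_∞ to become nonnegative; one further copy, through its factor 1/(1 - q), makes every
-- coefficient strictly positive. In (8) and (9), with i = 9 + j, class 0 modulo 3 becomes (q;q)_∞^3
-- / ((q^3;q^3)_∞^3 (q;q)_∞^j). For j = 0, 2, 3 the numerator left is (q;q)_∞^3, (q;q)_∞, 1, and a
-- second dissection modulo 3 gives residues modulo 9; for j > 3 the series is positive throughout.
--
-- The obstacle is a class that is a difference of positive series: the weighted series from
-- (q;q)_∞^3, and class 2 of (q;q)_∞ modulo 5. There finite products are compared factor by factor,
-- and denominators borrowed from 1/(q;q)_∞ absorb the numerators 1 - q^k that arise.
--
-- In (1) and (2) the theta series is sparse and is not dissected into positive classes modulo p.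
-- The coefficient a_n is a sum over exponents i ≤ n with i ≡ n, all contributions having one sign,
-- so only the existence of such an i matters; this is what n > N guarantees.

infixr 5 _∙_
_∙_ : ∀ {A : Set} {x y z : A} → x ≡ y → y ≡ z → x ≡ z
_∙_ = trans

-- Finite sums of integers

sum-congᵇ : ∀ n {h k : ℕ → ℤ} → (∀ i → i ≤ n → h i ≡ k i) → sumTo n h ≡ sumTo n k
sum-congᵇ zero    e = e 0 z≤n
sum-congᵇ (suc n) e = cong₂ ℤ._+_ (sum-congᵇ n λ i p → e i (m≤n⇒m≤1+n p)) (e (suc n) ≤-refl)

sum-cong : ∀ n {h k : ℕ → ℤ} → (∀ i → h i ≡ k i) → sumTo n h ≡ sumTo n k
sum-cong n e = sum-congᵇ n λ i _ → e i

sum-head : ∀ n (h : ℕ → ℤ) → sumTo (suc n) h ≡ h 0 +ᶻ sumTo n (λ i → h (suc i))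
sum-head zero    h = refl
sum-head (suc n) h = cong (ℤ._+ h (suc (suc n))) (sum-head n h) ∙ ℤP.+-assoc (h 0) _ _

+-interchange : ∀ a b c d → (a +ᶻ b) +ᶻ (c +ᶻ d) ≡ (a +ᶻ c) +ᶻ (b +ᶻ d)
+-interchange a b c d = ℤP.+-assoc a b _ ∙
  cong (a +ᶻ_) (sym (ℤP.+-assoc b c d) ∙ cong (ℤ._+ d) (ℤP.+-comm b c) ∙ ℤP.+-assoc c b d) ∙
    sym (ℤP.+-assoc a c _)

sum-+ : ∀ n (h k : ℕ → ℤ) → sumTo n (λ i → h i +ᶻ k i) ≡ sumTo n h +ᶻ sumTo n k
sum-+ zero    h k = refl
sum-+ (suc n) h k = cong (ℤ._+ (h (suc n) +ᶻ k (suc n))) (sum-+ n h k) ∙ +-interchange (sumTo n h) (sumTo n k) _ _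

sum-*ˡ : ∀ n c (h : ℕ → ℤ) → sumTo n (λ i → c *ᶻ h i) ≡ c *ᶻ sumTo n h
sum-*ˡ zero    c h = refl
sum-*ˡ (suc n) c h = cong (ℤ._+ (c *ᶻ h (suc n))) (sum-*ˡ n c h) ∙ sym (ℤP.*-distribˡ-+ c (sumTo n h) _)

sum-0 : ∀ n {h : ℕ → ℤ} → (∀ i → i ≤ n → h i ≡ 0ℤ) → sumTo n h ≡ 0ℤ
sum-0 zero    e = e 0 z≤n
sum-0 (suc n) e = cong₂ ℤ._+_ (sum-0 n λ i p → e i (m≤n⇒m≤1+n p)) (e (suc n) ≤-refl) ∙ refl

-- The ring of power series

private
  tl : PS → PS
  tl f n = f (suc n)

  ⊛-head : ∀ f g n → (f ⊛ g) (suc n) ≡ f 0 *ᶻ g (suc n) +ᶻ (tl f ⊛ g) n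
  ⊛-head f g n = sum-head n (λ i → f i *ᶻ g (suc n ∸ i))

  ⊛-last : ∀ f g n → (f ⊛ g) (suc n) ≡ (f ⊛ tl g) n +ᶻ f (suc n) *ᶻ g 0
  ⊛-last f g n = cong₂ ℤ._+_
    (sum-congᵇ n λ i p → cong (λ t → f i *ᶻ g t) (ℕP.+-∸-assoc 1 p))
    (cong (λ t → f (suc n) *ᶻ g t) (ℕP.n∸n≡0 n))

  -- One side is expanded at its first summand, the other at its last; what remains is commutativity
  -- one degree lower.
  ⊛-comm : ∀ f g n → (f ⊛ g) n ≡ (g ⊛ f) n
  ⊛-comm f g zero    = ℤP.*-comm (f 0) (g 0)
  ⊛-comm f g (suc n) = ⊛-head f g n ∙
    ℤP.+-comm (f 0 *ᶻ g (suc n)) _ ∙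
      cong₂ ℤ._+_ (⊛-comm (tl f) g n) (ℤP.*-comm (f 0) (g (suc n))) ∙ sym (⊛-last g f n)

  ⊛-congᵇ : ∀ n {f f′ g g′ : PS} → (∀ i → i ≤ n → f i ≡ f′ i) → (∀ i → i ≤ n → g i ≡ g′ i) →
            (f ⊛ g) n ≡ (f′ ⊛ g′) n
  ⊛-congᵇ n p q = sum-congᵇ n λ i i≤n → cong₂ ℤ._*_ (p i i≤n) (q (n ∸ i) (ℕP.m∸n≤m n i))

  ⊛-distribʳ : ∀ f g h n → ((λ i → f i +ᶻ g i) ⊛ h) n ≡ (f ⊛ h) n +ᶻ (g ⊛ h) n
  ⊛-distribʳ f g h n = (sum-cong n λ i → ℤP.*-distribʳ-+ (h (n ∸ i)) (f i) (g i)) ∙ sum-+ n _ _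

  ⊛-scale : ∀ c f g n → ((λ i → c *ᶻ f i) ⊛ g) n ≡ c *ᶻ (f ⊛ g) n
  ⊛-scale c f g n = (sum-cong n λ i → ℤP.*-assoc c (f i) (g (n ∸ i))) ∙ sum-*ˡ n c _

  -- Induction on the degree with f = f 0 + q · `tl f`: the scalar f 0 passes through by `⊛-scale`,
  -- the rest is associativity for `tl f` one degree lower.
  ⊛-assoc : ∀ f g h n → ((f ⊛ g) ⊛ h) n ≡ (f ⊛ (g ⊛ h)) n
  ⊛-assoc f g h zero    = ℤP.*-assoc (f 0) (g 0) (h 0)
  ⊛-assoc f g h (suc n) = begin
    ((f ⊛ g) ⊛ h) (suc n)
      ≡⟨ ⊛-head (f ⊛ g) h n ⟩
    f 0 *ᶻ g 0 *ᶻ h (suc n) +ᶻ (tl (f ⊛ g) ⊛ h) n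
      ≡⟨ cong₂ ℤ._+_ (ℤP.*-assoc (f 0) (g 0) _)
           (⊛-congᵇ n {g = h} (λ i _ → ⊛-head f g i) (λ _ _ → refl) ∙
             ⊛-distribʳ (λ i → f 0 *ᶻ tl g i) (tl f ⊛ g) h n ∙
               cong₂ ℤ._+_ (⊛-scale (f 0) (tl g) h n) (⊛-assoc (tl f) g h n)) ⟩
    f 0 *ᶻ (g 0 *ᶻ h (suc n)) +ᶻ (f 0 *ᶻ (tl g ⊛ h) n +ᶻ (tl f ⊛ (g ⊛ h)) n)
      ≡⟨ sym (ℤP.+-assoc (f 0 *ᶻ (g 0 *ᶻ h (suc n))) _ _) ⟩
    f 0 *ᶻ (g 0 *ᶻ h (suc n)) +ᶻ f 0 *ᶻ (tl g ⊛ h) n +ᶻ (tl f ⊛ (g ⊛ h)) n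
      ≡⟨ cong (ℤ._+ (tl f ⊛ (g ⊛ h)) n) (sym (ℤP.*-distribˡ-+ (f 0) _ _) ∙ cong (f 0 *ᶻ_) (sym (⊛-head g h n))) ⟩
    f 0 *ᶻ (g ⊛ h) (suc n) +ᶻ (tl f ⊛ (g ⊛ h)) n
      ≡⟨ sym (⊛-head f (g ⊛ h) n) ⟩
    (f ⊛ (g ⊛ h)) (suc n) ∎
    where open ≡-Reasoning

  ⊛-zeroˡ : ∀ g n → ((λ _ → 0ℤ) ⊛ g) n ≡ 0ℤ
  ⊛-zeroˡ g n = sum-0 n λ i _ → refl

  const : ℤ → PS
  const c zero    = c
  const c (suc _) = 0ℤ

  ⊛-const : ∀ c g n → (const c ⊛ g) n ≡ c *ᶻ g n
  ⊛-const c g zero    = refl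
  ⊛-const c g (suc n) = ⊛-head (const c) g n ∙
    cong (c *ᶻ g (suc n) +ᶻ_) (⊛-zeroˡ g n) ∙ ℤP.+-identityʳ _

-- Sums and products are opaque so that unification sees their arguments.

infix 4 _≈_
record _≈_ (f g : PS) : Set where
  constructor ptwise
  field at : ∀ n → f n ≡ g n
open _≈_

infixl 6 _⊕_
infixl 7 _·_

opaque
  _⊕_ _·_ : PS → PS → PS
  (f ⊕ g) n = f n +ᶻ g n
  _·_ = _⊛_

  ⊖_ : PS → PS
  (⊖ f) n = ℤ.- f n

  κ : ℤ → PS
  κ = const

opaque
  unfolding _⊕_

  ⊕-at : ∀ f g n → (f ⊕ g) n ≡ f n +ᶻ g n
  ⊕-at f g n = refl


  ⊖-at : ∀ f n → (⊖ f) n ≡ ℤ.- f n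
  ⊖-at f n = refl

  κ-at0 : ∀ c → κ c 0 ≡ c
  κ-at0 c = refl

  κ-atsuc : ∀ c n → κ c (suc n) ≡ 0ℤ
  κ-atsuc c n = refl

  κ·-at : ∀ c f n → (κ c · f) n ≡ c *ᶻ f n
  κ·-at = ⊛-const

  κ-+ : ∀ c d → κ (c +ᶻ d) ≈ κ c ⊕ κ d
  κ-+ c d = ptwise λ { zero → refl ; (suc n) → refl }

  κ-* : ∀ c d → κ (c *ᶻ d) ≈ κ c · κ d
  κ-* c d = ptwise λ { zero → refl
    ; (suc n) → sym (⊛-const c (const d) (suc n) ∙ ℤP.*-zeroʳ c) }

  κ-neg : ∀ c → κ (ℤ.- c) ≈ ⊖ κ c
  κ-neg c = ptwise λ { zero → refl ; (suc n) → refl }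

  onePS≈κ1 : onePS ≈ κ 1ℤ
  onePS≈κ1 = ptwise λ { zero → refl ; (suc n) → refl }

  ·-head : ∀ f g n → (f · g) (suc n) ≡ f 0 *ᶻ g (suc n) +ᶻ ((λ i → f (suc i)) · g) n
  ·-head = ⊛-head

  ·-at0 : ∀ f g → (f · g) 0 ≡ f 0 *ᶻ g 0
  ·-at0 f g = refl

  psIsRing : IsCommutativeRing _≈_ _⊕_ _·_ ⊖_ (κ 0ℤ) (κ 1ℤ)
  psIsRing = record
    { isRing = record
      { +-isAbelianGroup = record
        { isGroup = record
          { isMonoid = record
            { isSemigroup = record
              { isMagma = record
                { isEquivalence = record
                  { refl = ptwise λ _ → refl
                  ; sym = λ e → ptwise λ n → sym (at e n)
                  ; trans = λ d e → ptwise λ n → trans (at d n) (at e n) }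
                ; ∙-cong = λ d e → ptwise λ n → cong₂ ℤ._+_ (at d n) (at e n) }
              ; assoc = λ f g h → ptwise λ n → ℤP.+-assoc (f n) (g n) (h n) }
            ; identity = (λ f → ptwise λ { zero → ℤP.+-identityˡ _ ; (suc n) → ℤP.+-identityˡ _ })
                       , (λ f → ptwise λ { zero → ℤP.+-identityʳ _ ; (suc n) → ℤP.+-identityʳ _ }) }
          ; inverse = (λ f → ptwise λ { zero → ℤP.+-inverseˡ (f 0) ; (suc n) → ℤP.+-inverseˡ (f (suc n)) })
                    , (λ f → ptwise λ { zero → ℤP.+-inverseʳ (f 0) ; (suc n) → ℤP.+-inverseʳ (f (suc n)) })
          ; ⁻¹-cong = λ e → ptwise λ n → cong ℤ.-_ (at e n) }
        ; comm = λ f g → ptwise λ n → ℤP.+-comm (f n) (g n) }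
      ; *-cong = λ d e → ptwise λ n → ⊛-congᵇ n (λ i _ → at d i) (λ i _ → at e i)
      ; *-assoc = λ f g h → ptwise (⊛-assoc f g h)
      ; *-identity = (λ f → ptwise λ n → 1·-at f n)
                   , (λ f → ptwise λ n → trans (⊛-comm f (const 1ℤ) n) (1·-at f n))
      ; distrib = (λ f g h → ptwise λ n → trans (⊛-comm f (g ⊕ h) n)
                     (⊛-distribʳ g h f n ∙ cong₂ ℤ._+_ (⊛-comm g f n) (⊛-comm h f n)))
                , (λ f g h → ptwise λ n → ⊛-distribʳ g h f n) }
    ; *-comm = λ f g → ptwise (⊛-comm f g) }
    where
    1·-at : ∀ f n → (const 1ℤ ⊛ f) n ≡ f n
    1·-at f n = ⊛-const 1ℤ f n ∙ ℤP.*-identityˡ (f n)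

psRing : CommutativeRing 0ℓ 0ℓ
psRing = record { isCommutativeRing = psIsRing }

open CommutativeRing psRing using ()
  renaming ( refl to ≈-refl; sym to ≈-sym; trans to ≈-trans; reflexive to ≈-reflexive
           ; +-cong to ⊕-cong; *-cong to ·-cong; -‿cong to ⊖-cong
           ; +-assoc to ⊕-assoc; +-comm to ⊕-comm; *-assoc to ·-assoc; *-comm to ·-comm
           ; *-identityˡ to ·-idˡ; *-identityʳ to ·-idʳ; +-identityˡ to ⊕-idˡ; +-identityʳ to ⊕-idʳ
           ; distribˡ to ·-distribˡ; distribʳ to ·-distribʳ; zeroˡ to ·-zeroˡ; zeroʳ to ·-zeroʳ
           ; setoid to psSetoid; commutativeSemiring to psSemiring)

private
  κ-homo : CommutativeRing.rawRing ℤP.+-*-commutativeRing -Raw-AlmostCommutative⟶ fromCommutativeRing psRing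
  κ-homo = record { ⟦_⟧ = κ ; +-homo = κ-+ ; *-homo = κ-* ; -‿homo = κ-neg ; 0-homo = ≈-refl ; 1-homo = ≈-refl }

  κ-≟ : ∀ c d → Maybe (κ c ≈ κ d)
  κ-≟ c d with c ℤ.≟ d
  ... | yes e = just (≈-reflexive (cong κ e))
  ... | no  _ = nothing

-- Coefficients are integers embedded by `κ`, so that the solver computes with numerical constants
-- instead of treating them as atoms.
module PS-Solver = Algebra.Solver.Ring _ (fromCommutativeRing psRing) κ-homo κ-≟
open PS-Solver using (solve; _:+_; _:*_; _:-_; :-_; _:^_; con; _:=_)

infixr 5 _⨾_
_⨾_ : ∀ {f g h} → f ≈ g → g ≈ h → f ≈ h
_⨾_ = ≈-trans

·-congˡ : ∀ {f f′ g} → f ≈ f′ → f · g ≈ f′ · g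
·-congˡ e = ·-cong e ≈-refl

·-congʳ : ∀ {f g g′} → g ≈ g′ → f · g ≈ f · g′
·-congʳ = ·-cong ≈-refl

⊕-congˡ : ∀ {f f′ g} → f ≈ f′ → f ⊕ g ≈ f′ ⊕ g
⊕-congˡ e = ⊕-cong e ≈-refl

⊕-congʳ : ∀ {f g g′} → g ≈ g′ → f ⊕ g ≈ f ⊕ g′
⊕-congʳ = ⊕-cong ≈-refl

≈-cong : ∀ {A : Set} (F : A → PS) {x y} → x ≡ y → F x ≈ F y
≈-cong F e = ≈-reflexive (cong F e)

:0 :1 : ∀ {n} → PS-Solver.Polynomial n
:0 = con 0ℤ
:1 = con 1ℤ


𝟙 : PS
𝟙 = κ 1ℤ

-- Congruence modulo q^n

infix 4 _≈⟨_⟩_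
record _≈⟨_⟩_ (f : PS) (n : ℕ) (g : PS) : Set where
  constructor below
  field coeff : ∀ i → i < n → f i ≡ g i
open _≈⟨_⟩_

≈⇒mod : ∀ {f g n} → f ≈ g → f ≈⟨ n ⟩ g
≈⇒mod e = below λ i _ → at e i

mod-refl : ∀ {f n} → f ≈⟨ n ⟩ f
mod-refl = below λ _ _ → refl

mod-sym : ∀ {f g n} → f ≈⟨ n ⟩ g → g ≈⟨ n ⟩ f
mod-sym e = below λ i p → sym (coeff e i p)

mod-trans : ∀ {f g h n} → f ≈⟨ n ⟩ g → g ≈⟨ n ⟩ h → f ≈⟨ n ⟩ h
mod-trans d e = below λ i p → trans (coeff d i p) (coeff e i p)

infixr 5 _⨾⟨⟩_
_⨾⟨⟩_ : ∀ {f g h n} → f ≈⟨ n ⟩ g → g ≈⟨ n ⟩ h → f ≈⟨ n ⟩ h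
_⨾⟨⟩_ = mod-trans

mod-mono : ∀ {f g m n} → m ≤ n → f ≈⟨ n ⟩ g → f ≈⟨ m ⟩ g
mod-mono m≤n e = below λ i p → coeff e i (≤-trans p m≤n)

mod⇒≈ : ∀ {f g} → (∀ n → f ≈⟨ n ⟩ g) → f ≈ g
mod⇒≈ e = ptwise λ n → coeff (e (suc n)) n ≤-refl

opaque
  unfolding _⊕_

  ⊕-cong⟨⟩ : ∀ {f f′ g g′ n} → f ≈⟨ n ⟩ f′ → g ≈⟨ n ⟩ g′ → f ⊕ g ≈⟨ n ⟩ f′ ⊕ g′
  ⊕-cong⟨⟩ d e = below λ i p → cong₂ _+ᶻ_ (coeff d i p) (coeff e i p)

  ⊖-cong⟨⟩ : ∀ {f f′ n} → f ≈⟨ n ⟩ f′ → ⊖ f ≈⟨ n ⟩ ⊖ f′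
  ⊖-cong⟨⟩ d = below λ i p → cong ℤ.-_ (coeff d i p)

  ·-cong⟨⟩ : ∀ {f f′ g g′ n} → f ≈⟨ n ⟩ f′ → g ≈⟨ n ⟩ g′ → f · g ≈⟨ n ⟩ f′ · g′
  ·-cong⟨⟩ d e = below λ i p → sum-congᵇ i λ j j≤i →
    cong₂ _*ᶻ_ (coeff d j (≤-<-trans j≤i p)) (coeff e (i ∸ j) (≤-<-trans (ℕP.m∸n≤m i j) p))

·-cong⟨⟩ˡ : ∀ {f f′ g n} → f ≈⟨ n ⟩ f′ → f · g ≈⟨ n ⟩ f′ · g
·-cong⟨⟩ˡ d = ·-cong⟨⟩ d mod-refl

·-cong⟨⟩ʳ : ∀ {f g g′ n} → g ≈⟨ n ⟩ g′ → f · g ≈⟨ n ⟩ f · g′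
·-cong⟨⟩ʳ = ·-cong⟨⟩ mod-refl

⊕-cong⟨⟩ʳ : ∀ {f g g′ n} → g ≈⟨ n ⟩ g′ → f ⊕ g ≈⟨ n ⟩ f ⊕ g′
⊕-cong⟨⟩ʳ = ⊕-cong⟨⟩ mod-refl

-- Monomials

private
  if-yes : ∀ {A : Set} (d : Dec A) {x y : ℤ} → A → (if ⌊ d ⌋ then x else y) ≡ x
  if-yes (yes _) a = refl
  if-yes (no ¬a) a = ⊥-elim (¬a a)

  if-no : ∀ {A : Set} (d : Dec A) {x y : ℤ} → ¬ A → (if ⌊ d ⌋ then x else y) ≡ y
  if-no (yes a) ¬a = ⊥-elim (¬a a)
  if-no (no _)  ¬a = refl

κ0-at : ∀ n → κ 0ℤ n ≡ 0ℤ
κ0-at zero    = κ-at0 0ℤ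
κ0-at (suc n) = κ-atsuc 0ℤ n

opaque
  X : ℕ → PS
  X = δ


  X-diag : ∀ k → X k k ≡ 1ℤ
  X-diag k = if-yes (k ℕ.≟ k) refl

  X-off : ∀ {k n} → k ≢ n → X k n ≡ 0ℤ
  X-off {k} {n} ne = if-no (k ℕ.≟ n) ne

  X0 : X 0 ≈ 𝟙
  X0 = ptwise λ { zero → sym (κ-at0 1ℤ) ; (suc n) → sym (κ-atsuc 1ℤ n) }

  X·-shift : ∀ k f n → (X (suc k) · f) (suc n) ≡ (X k · f) n
  X·-shift k f n = ·-head (X (suc k)) f n ∙
    cong₂ _+ᶻ_ (cong (_*ᶻ f (suc n)) (X-off {suc k} {0} λ ())) (at (·-cong (ptwise tail) (≈-refl {f})) n) ∙ ℤP.+-identityˡ _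
    where
    tail : ∀ i → X (suc k) (suc i) ≡ X k i
    tail i with k ℕ.≟ i
    ... | yes refl = X-diag (suc k)
    ... | no k≢i   = X-off λ e → k≢i (ℕP.suc-injective e)

  X·-zero : ∀ k f → (X (suc k) · f) 0 ≡ 0ℤ
  X·-zero k f = ·-at0 (X (suc k)) f ∙ cong (_*ᶻ f 0) (X-off {suc k} {0} λ ())

X·-at : ∀ k f n → (X k · f) (k + n) ≡ f n
X·-at zero    f n = at (·-congˡ X0 ⨾ ·-idˡ f) n
X·-at (suc k) f n = X·-shift k f (k + n) ∙ X·-at k f n

X·-low : ∀ k f n → n < k → (X k · f) n ≡ 0ℤ
X·-low (suc k) f zero    p       = X·-zero k f
X·-low (suc k) f (suc n) (s≤s p) = X·-shift k f n ∙ X·-low k f n p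

X·-0⟨⟩ : ∀ k f → X k · f ≈⟨ k ⟩ κ 0ℤ
X·-0⟨⟩ k f = below λ i p → trans (X·-low k f i p) (sym (κ0-at i))

data Offset (k n : ℕ) : Set where
  low  : n < k → Offset k n
  high : ∀ m → n ≡ k + m → Offset k n

offset : ∀ k n → Offset k n
offset k n with k ℕ.≤? n
... | yes p = high (n ∸ k) (sym (ℕP.m+[n∸m]≡n p))
... | no ¬p = low (ℕP.≰⇒> ¬p)

X·-ext : ∀ k f {g : PS} → (∀ n → n < k → g n ≡ 0ℤ) → (∀ m → g (k + m) ≡ f m) → X k · f ≈ g
X·-ext k f {g} lo hi = ptwise go
  where
  go : ∀ n → (X k · f) n ≡ g n
  go n with offset k n
  ... | low p       = X·-low k f n p ∙ sym (lo n p)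
  ... | high m refl = X·-at k f m ∙ sym (hi m)

X·-cong⟨⟩ : ∀ k {f g n} → f ≈⟨ n ⟩ g → X k · f ≈⟨ k + n ⟩ X k · g
X·-cong⟨⟩ k {f} {g} {n} e = below go
  where
  go : ∀ i → i < k + n → (X k · f) i ≡ (X k · g) i
  go i p with offset k i
  ... | low q       = X·-low k f i q ∙ sym (X·-low k g i q)
  ... | high m refl = X·-at k f m ∙ coeff e m (ℕP.+-cancelˡ-< k m n p) ∙ sym (X·-at k g m)

X-+ : ∀ a b → X (a + b) ≈ X a · X b
X-+ a b = ≈-sym (X·-ext a (X b) (λ n p → X-off λ { refl → ℕP.<⇒≱ p (m≤m+n a b) }) hi)
  where
  hi : ∀ m → X (a + b) (a + m) ≡ X b m
  hi m with b ℕ.≟ m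
  ... | yes refl = X-diag (a + b) ∙ sym (X-diag b)
  ... | no b≢m   = (X-off λ e → b≢m (ℕP.+-cancelˡ-≡ a b m e)) ∙ sym (X-off b≢m)

X-0⟨⟩ : ∀ k → X k ≈⟨ k ⟩ κ 0ℤ
X-0⟨⟩ k = ≈⇒mod (≈-sym (·-idʳ (X k))) ⨾⟨⟩ X·-0⟨⟩ k 𝟙

om : ℕ → PS
om j = 𝟙 ⊕ ⊖ X j

opaque
  gm : ℕ → PS
  gm = geom

opaque
  unfolding X gm _⊕_

  onePS≈𝟙 : onePS ≈ 𝟙
  onePS≈𝟙 = onePS≈κ1

  oneMinus≈om : ∀ j → oneMinus j ≈ om j
  oneMinus≈om j = ptwise λ n → cong (_+ᶻ (ℤ.- δ j n)) (at X0 n)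

  geom≈gm : ∀ j → geom j ≈ gm j
  geom≈gm j = ≈-refl

  gm-yes : ∀ {j n} → j ∣ n → gm j n ≡ 1ℤ
  gm-yes {j} {n} d = if-yes (j ∣? n) d

  gm-no : ∀ {j n} → ¬ j ∣ n → gm j n ≡ 0ℤ
  gm-no {j} {n} d = if-no (j ∣? n) d

gm-unfold : ∀ j → gm (suc j) ≈ 𝟙 ⊕ X (suc j) · gm (suc j)
gm-unfold j = ptwise λ n → trans (go n) (sym (⊕-at 𝟙 _ n))
  where
  go : ∀ n → gm (suc j) n ≡ 𝟙 n +ᶻ (X (suc j) · gm (suc j)) n
  go n with offset (suc j) n
  go zero    | low p = gm-yes (suc j ∣0) ∙ sym (cong₂ _+ᶻ_ (κ-at0 1ℤ) (X·-low (suc j) _ 0 p))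
  go (suc n) | low p = (gm-no λ d → ℕP.<⇒≱ p (∣⇒≤ d)) ∙
    sym (cong₂ _+ᶻ_ (κ-atsuc 1ℤ n) (X·-low (suc j) _ (suc n) p))
  go n | high m refl = same (suc j ∣? m) ∙
    sym (cong₂ _+ᶻ_ (κ-atsuc 1ℤ (j + m)) (X·-at (suc j) _ m) ∙ ℤP.+-identityˡ _)
    where
    same : Dec (suc j ∣ m) → gm (suc j) (suc j + m) ≡ gm (suc j) m
    same (yes d) = gm-yes (∣m∣n⇒∣m+n ∣-refl d) ∙ sym (gm-yes d)
    same (no ¬d) = (gm-no λ d → ¬d (∣m+n∣m⇒∣n d ∣-refl)) ∙ sym (gm-no ¬d)

om·gm : ∀ j → om (suc j) · gm (suc j) ≈ 𝟙
om·gm j = ≈-trans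
  (solve 2 (λ x g → (:1 :+ (:- x)) :* g := g :- (x :* g)) ≈-refl (X (suc j)) (gm (suc j)))
  (⊕-congˡ (gm-unfold j) ⨾
    solve 1 (λ y → (:1 :+ y) :- y := :1) ≈-refl (X (suc j) · gm (suc j)))

om·gm₂ : ∀ a b → om (suc a) · om (suc b) · (gm (suc a) · gm (suc b)) ≈ 𝟙
om·gm₂ a b = solve 4 (λ o o′ g g′ → o :* o′ :* (g :* g′) := (o :* g) :* (o′ :* g′)) ≈-refl (om (suc a)) (om (suc b)) (gm (suc a)) (gm (suc b)) ⨾
  ·-cong (om·gm a) (om·gm b) ⨾ ·-idˡ 𝟙

-- Finite and infinite products

module FiniteSums {c ℓ} (R : CommutativeSemiring c ℓ) where

  private
    module R = CommutativeSemiring R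
    open NatSolver R using () renaming (solve to solveᴿ; _:+_ to _⊞_; _:*_ to _⊠_; _:=_ to _⊜_; con to conᴿ)

  private
    infixr 5 _⟫_
    _⟫_ : ∀ {x y z} → x R.≈ y → y R.≈ z → x R.≈ z
    _⟫_ = R.trans

  ∏ᴿ ∑ᴿ : (ℕ → R.Carrier) → ℕ → R.Carrier
  ∏ᴿ F zero    = R.1#
  ∏ᴿ F (suc n) = ∏ᴿ F n R.* F n
  ∑ᴿ F zero    = R.0#
  ∑ᴿ F (suc n) = ∑ᴿ F n R.+ F n

  ∏ᴿ-head : ∀ F N → ∏ᴿ F (suc N) R.≈ F 0 R.* ∏ᴿ (F ∘ suc) N
  ∏ᴿ-head F zero    = R.*-comm _ _
  ∏ᴿ-head F (suc N) = R.*-cong (∏ᴿ-head F N) R.refl ⟫ R.*-assoc _ _ _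

  ∏ᴿ-cong : ∀ {F G} N → (∀ n → F n R.≈ G n) → ∏ᴿ F N R.≈ ∏ᴿ G N
  ∏ᴿ-cong zero    e = R.refl
  ∏ᴿ-cong (suc N) e = R.*-cong (∏ᴿ-cong N e) (e N)

  ∑ᴿ-head : ∀ F N → ∑ᴿ F (suc N) R.≈ F 0 R.+ ∑ᴿ (F ∘ suc) N
  ∑ᴿ-head F zero    = R.+-comm _ _
  ∑ᴿ-head F (suc N) = R.+-cong (∑ᴿ-head F N) R.refl ⟫ R.+-assoc _ _ _

  ∑ᴿ-cong : ∀ {F G} N → (∀ n → F n R.≈ G n) → ∑ᴿ F N R.≈ ∑ᴿ G N
  ∑ᴿ-cong zero    e = R.refl
  ∑ᴿ-cong (suc N) e = R.+-cong (∑ᴿ-cong N e) (e N)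

  ∑ᴿ-+ : ∀ F G N → ∑ᴿ (λ n → F n R.+ G n) N R.≈ ∑ᴿ F N R.+ ∑ᴿ G N
  ∑ᴿ-+ F G zero    = R.sym (R.+-identityˡ _)
  ∑ᴿ-+ F G (suc N) = R.+-cong (∑ᴿ-+ F G N) R.refl ⟫
    solveᴿ 4 (λ a b c d → (a ⊞ b) ⊞ (c ⊞ d) ⊜ (a ⊞ c) ⊞ (b ⊞ d)) R.refl _ _ _ _

  ∑ᴿ-*ˡ : ∀ x F N → ∑ᴿ (λ n → x R.* F n) N R.≈ x R.* ∑ᴿ F N
  ∑ᴿ-*ˡ x F zero    = R.sym (R.zeroʳ x)
  ∑ᴿ-*ˡ x F (suc N) = R.+-cong (∑ᴿ-*ˡ x F N) R.refl ⟫ R.sym (R.distribˡ x _ _)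

open FiniteSums psSemiring using () renaming
  ( ∏ᴿ to ∏; ∏ᴿ-head to ∏-head; ∏ᴿ-cong to ∏-cong
  ; ∑ᴿ to ∑; ∑ᴿ-head to ∑-head; ∑ᴿ-cong to ∑-cong; ∑ᴿ-+ to ∑-⊕; ∑ᴿ-*ˡ to ∑-·ˡ )

∏-· : ∀ F G N → ∏ (λ n → F n · G n) N ≈ ∏ F N · ∏ G N
∏-· F G zero    = ≈-sym (·-idˡ 𝟙)
∏-· F G (suc N) = ·-congˡ (∏-· F G N) ⨾
  solve 4 (λ a b c d → (a :* b) :* (c :* d) := (a :* c) :* (b :* d)) ≈-refl (∏ F N) (∏ G N) (F N) (G N)

∏-+ : ∀ F a b → ∏ F (b + a) ≈ ∏ F a · ∏ (λ r → F (r + a)) b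
∏-+ F a zero    = ≈-sym (·-idʳ _)
∏-+ F a (suc b) = ·-congˡ (∏-+ F a b) ⨾ ·-assoc _ _ _

block : ℕ → (ℕ → PS) → ℕ → PS
block k F n = ∏ (λ r → F (r + n * k)) k

∏-block : ∀ k F N → ∏ (block k F) N ≈ ∏ F (N * k)
∏-block k F zero    = ≈-refl
∏-block k F (suc N) = ·-congˡ (∏-block k F N) ⨾ ≈-sym (∏-+ F (N * k) k)

∏≈𝟙 : ∀ {F n} N → (∀ r → F r ≈⟨ n ⟩ 𝟙) → ∏ F N ≈⟨ n ⟩ 𝟙
∏≈𝟙 zero    e = mod-refl
∏≈𝟙 (suc N) e = ·-cong⟨⟩ (∏≈𝟙 N e) (e N) ⨾⟨⟩ ≈⇒mod (·-idˡ 𝟙)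

record Convergent (F : ℕ → PS) : Set where
  constructor convergent
  field tail≈𝟙 : ∀ n → F n ≈⟨ suc n ⟩ 𝟙
open Convergent

-- The diagonal suffices: factors with index ≥ n are 1 modulo q^(n+1), so coefficient n is final
-- after n factors. `qpoch` truncates in the same way, which reduces `qpoch≈E` to equal finite
-- products.
Lim : (ℕ → PS) → PS
Lim F n = ∏ F n n

∏-stable : ∀ {F} → Convergent F → ∀ N k → ∏ F (k + N) ≈⟨ suc N ⟩ ∏ F N
∏-stable c N zero    = mod-refl
∏-stable c N (suc k) = mod-trans
  (·-cong⟨⟩ (∏-stable c N k) (mod-mono (s≤s (m≤n+m N k)) (tail≈𝟙 c (k + N))))
  (≈⇒mod (·-idʳ _))

Lim-∏ : ∀ {F} → Convergent F → ∀ N → Lim F ≈⟨ suc N ⟩ ∏ F N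
Lim-∏ {F} c N = below go
  where
  go : ∀ i → i < suc N → ∏ F i i ≡ ∏ F N i
  go i (s≤s p) = sym (coeff (∏-stable c i (N ∸ i)) i ≤-refl) ∙ cong (λ t → ∏ F t i) (ℕP.m∸n+n≡m p)

-- The way into identities of infinite products: only finite products, one for each precision, have
-- to be compared.
Lim-unique : ∀ {F f} → Convergent F → (∀ N → f ≈⟨ suc N ⟩ ∏ F N) → f ≈ Lim F
Lim-unique c e = mod⇒≈ λ n → mod-mono (n≤1+n n) (e n ⨾⟨⟩ mod-sym (Lim-∏ c n))

Lim-cong : ∀ {F G} → (∀ n → F n ≈ G n) → Lim F ≈ Lim G
Lim-cong e = ptwise λ n → at (∏-cong n e) n

·-conv : ∀ {F G} → Convergent F → Convergent G → Convergent (λ n → F n · G n)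
·-conv c d = convergent λ n → mod-trans (·-cong⟨⟩ (tail≈𝟙 c n) (tail≈𝟙 d n)) (≈⇒mod (·-idˡ 𝟙))

Lim-· : ∀ {F G} → Convergent F → Convergent G → Lim F · Lim G ≈ Lim (λ n → F n · G n)
Lim-· {F} {G} c d = Lim-unique (·-conv c d) λ N →
  mod-trans (·-cong⟨⟩ (Lim-∏ c N) (Lim-∏ d N)) (≈⇒mod (≈-sym (∏-· F G N)))

block-conv : ∀ k {F} → Convergent F → Convergent (block (suc k) F)
block-conv k c = convergent λ n → ∏≈𝟙 (suc k) λ r → mod-mono
  (s≤s (≤-trans (m≤m*n n (suc k)) (m≤n+m (n * suc k) r))) (tail≈𝟙 c (r + n * suc k))

Lim-block : ∀ k {F} → Convergent F → Lim F ≈ Lim (block (suc k) F)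
Lim-block k {F} c = Lim-unique (block-conv k c) λ N → mod-trans
  (mod-mono (s≤s (m≤m*n N (suc k))) (Lim-∏ c (N * suc k))) (≈⇒mod (≈-sym (∏-block (suc k) F N)))

suc-conv : ∀ {F} → Convergent F → Convergent (F ∘ suc)
suc-conv c = convergent λ n → mod-mono (n≤1+n _) (tail≈𝟙 c (suc n))

Lim-head : ∀ {F} → Convergent F → Lim F ≈ F 0 · Lim (F ∘ suc)
Lim-head {F} c = mod⇒≈ λ n → mod-trans
  (mod-mono (m≤n+m n 2) (Lim-∏ c (suc n)) ⨾⟨⟩ ≈⇒mod (∏-head F n))
  (·-cong⟨⟩ʳ (mod-sym (mod-mono (n≤1+n n) (Lim-∏ (suc-conv c) n))))

Lim-𝟙 : Lim (λ _ → 𝟙) ≈ 𝟙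
Lim-𝟙 = ≈-sym (Lim-unique (convergent λ _ → mod-refl) λ N → mod-sym (∏≈𝟙 N λ _ → mod-refl))

om-low : ∀ {n} j → n ≤ j → om j ≈⟨ n ⟩ 𝟙
om-low j p = mod-mono p (⊕-cong⟨⟩ʳ (⊖-cong⟨⟩ (X-0⟨⟩ j)) ⨾⟨⟩
  ≈⇒mod (solve 0 (:1 :- :0 := :1) ≈-refl))

gm-low : ∀ {n} j → n ≤ suc j → gm (suc j) ≈⟨ n ⟩ 𝟙
gm-low j p = mod-mono p (≈⇒mod (gm-unfold j) ⨾⟨⟩
  ⊕-cong⟨⟩ʳ (X·-0⟨⟩ (suc j) _) ⨾⟨⟩ ≈⇒mod (⊕-idʳ 𝟙))

E I : ℕ → PS
E k = Lim λ n → om (k * suc n)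
I k = Lim λ n → gm (k * suc n)

E-conv : ∀ k → Convergent λ n → om (suc k * suc n)
E-conv k = convergent λ n → om-low _ (m≤m+n (suc n) (k * suc n))

I-conv : ∀ k → Convergent λ n → gm (suc k * suc n)
I-conv k = convergent λ n → gm-low (n + k * suc n) (m≤m+n (suc n) (k * suc n))

E·I : ∀ k → E (suc k) · I (suc k) ≈ 𝟙
E·I k = Lim-· (E-conv k) (I-conv k) ⨾ (Lim-cong λ n → om·gm (n + k * suc n)) ⨾ Lim-𝟙

opaque
  unfolding _·_
  prodUpTo-∏ : ∀ {F G} N → (∀ n → F (suc n) ≈ G n) → prodUpTo F N ≈ ∏ G N
  prodUpTo-∏ zero    e = onePS≈𝟙
  prodUpTo-∏ (suc N) e = ·-cong (prodUpTo-∏ N e) (e N)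

qpoch≈E : ∀ k → qpoch k ≈ E k
qpoch≈E k = ptwise λ n → at (prodUpTo-∏ n λ m → oneMinus≈om (k * suc m)) n

qpochInv≈I : ∀ k → qpochInv k ≈ I k
qpochInv≈I k = ptwise λ n → at (prodUpTo-∏ n λ m → geom≈gm (k * suc m)) n

-- Finite and infinite sums

⊕-interchange : ∀ a b c d → (a ⊕ b) ⊕ (c ⊕ d) ≈ (a ⊕ c) ⊕ (b ⊕ d)
⊕-interchange = solve 4 (λ a b c d → (a :+ b) :+ (c :+ d) := (a :+ c) :+ (b :+ d)) ≈-refl

∑-0 : ∀ N → ∑ (λ _ → κ 0ℤ) N ≈ κ 0ℤ
∑-0 zero    = ≈-refl
∑-0 (suc N) = ⊕-idʳ _ ⨾ ∑-0 N

∑-+ : ∀ h a b → ∑ h (b + a) ≈ ∑ h a ⊕ ∑ (λ r → h (r + a)) b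
∑-+ h a zero    = ≈-sym (⊕-idʳ _)
∑-+ h a (suc b) = ⊕-congˡ (∑-+ h a b) ⨾ ⊕-assoc _ _ _

∑-residues : ∀ k h N → ∑ h (N * k) ≈ ∑ (λ r → ∑ (λ j → h (r + j * k)) N) k
∑-residues k h zero    = ≈-sym (∑-0 k)
∑-residues k h (suc N) = ∑-+ h (N * k) k ⨾
  ⊕-congˡ (∑-residues k h N) ⨾ ≈-sym (∑-⊕ _ _ k)

∑≈0 : ∀ {h n} N → (∀ r → h r ≈⟨ n ⟩ κ 0ℤ) → ∑ h N ≈⟨ n ⟩ κ 0ℤ
∑≈0 zero    e = mod-refl
∑≈0 (suc N) e = ⊕-cong⟨⟩ (∑≈0 N e) (e N) ⨾⟨⟩ ≈⇒mod (⊕-idʳ _)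

∑-cong⟨⟩ : ∀ {h g n} N → (∀ r → h r ≈⟨ n ⟩ g r) → ∑ h N ≈⟨ n ⟩ ∑ g N
∑-cong⟨⟩ zero    e = mod-refl
∑-cong⟨⟩ (suc N) e = ⊕-cong⟨⟩ (∑-cong⟨⟩ N e) (e N)

-- The weaker index allows for the exponents j(j-1)/2, which are only ≥ j - 1.
record Summable (h : ℕ → PS) : Set where
  constructor summable
  field vanish : ∀ j → h (suc j) ≈⟨ j ⟩ κ 0ℤ
open Summable

-- Term j + 1 vanishes modulo q^j, so exactly the terms 0, ..., n + 1 can reach coefficient n; hence
-- n + 2 terms.
Σ∞ : (ℕ → PS) → PS
Σ∞ h n = ∑ h (suc (suc n)) n

∑-stable : ∀ {h} → Summable h → ∀ N k → ∑ h (k + suc N) ≈⟨ N ⟩ ∑ h (suc N)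
∑-stable s N zero    = mod-refl
∑-stable {h} s N (suc k) = mod-trans
  (⊕-cong⟨⟩ (∑-stable s N k) (subst (λ t → h t ≈⟨ N ⟩ κ 0ℤ) (sym (ℕP.+-suc k N)) (mod-mono (m≤n+m N k) (vanish s (k + N)))))
  (≈⇒mod (⊕-idʳ _))

Σ∞-∑ : ∀ {h} → Summable h → ∀ {N} M → N < M → Σ∞ h ≈⟨ N ⟩ ∑ h M
Σ∞-∑ {h} s {N} M N<M = below go
  where
  go : ∀ i → i < N → ∑ h (suc (suc i)) i ≡ ∑ h M i
  go i i<N = sym (coeff (∑-stable s (suc i) (M ∸ suc (suc i))) i ≤-refl) ∙
    cong (λ t → ∑ h t i) (ℕP.m∸n+n≡m (≤-trans (s≤s i<N) N<M))

Σ∞-unique : ∀ {h f} → Summable h → (∀ N → f ≈⟨ N ⟩ ∑ h (suc N)) → f ≈ Σ∞ h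
Σ∞-unique s e = mod⇒≈ λ N → mod-trans (e N) (mod-sym (Σ∞-∑ s (suc N) ≤-refl))

Σ∞-cong : ∀ {h g} → (∀ n → h n ≈ g n) → Σ∞ h ≈ Σ∞ g
Σ∞-cong e = ptwise λ n → at (∑-cong (suc (suc n)) e) n

Σ∞-⊕ : ∀ h g → Σ∞ (λ n → h n ⊕ g n) ≈ Σ∞ h ⊕ Σ∞ g
Σ∞-⊕ h g = ptwise λ n → trans (at (∑-⊕ h g (suc (suc n))) n)
  (⊕-at (∑ h (suc (suc n))) _ n ∙ sym (⊕-at (Σ∞ h) _ n))

·-summable : ∀ f {h} → Summable h → Summable (λ n → f · h n)
·-summable f s = summable λ j → mod-trans (·-cong⟨⟩ʳ (vanish s j)) (≈⇒mod (·-zeroʳ f))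

Σ∞-·ˡ : ∀ f {h} → Summable h → Σ∞ (λ n → f · h n) ≈ f · Σ∞ h
Σ∞-·ˡ f s = ≈-sym (Σ∞-unique (·-summable f s) λ N →
  mod-trans (·-cong⟨⟩ʳ (Σ∞-∑ s (suc N) ≤-refl)) (≈⇒mod (≈-sym (∑-·ˡ f _ (suc N)))))

Σ∞-head : ∀ {h} → Summable h → Summable (h ∘ suc) → Σ∞ h ≈ h 0 ⊕ Σ∞ (h ∘ suc)
Σ∞-head {h} s s′ = mod⇒≈ λ N → mod-trans (Σ∞-∑ s (suc (suc N)) (n≤1+n _))
  (≈⇒mod (∑-head h (suc N)) ⨾⟨⟩ ⊕-cong⟨⟩ʳ (mod-sym (Σ∞-∑ s′ (suc N) ≤-refl)))

residue-summable : ∀ k r {h} → Summable h → Summable (λ j → h (r + j * suc k))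
residue-summable k r {h} s = summable λ j → subst (λ t → h t ≈⟨ j ⟩ κ 0ℤ) (sym (ℕP.+-suc r _))
  (mod-mono (≤-trans (m≤m*n j (suc k)) (≤-trans (m≤n+m _ k) (m≤n+m _ r))) (vanish s (r + (k + j * suc k))))

Σ∞-residues : ∀ k {h} → Summable h → Σ∞ h ≈ ∑ (λ r → Σ∞ (λ j → h (r + j * suc k))) (suc k)
Σ∞-residues k {h} s = mod⇒≈ λ N → mod-trans
  (Σ∞-∑ s (suc N * suc k) (m≤m*n (suc N) (suc k)))
  (≈⇒mod (∑-residues (suc k) h (suc N)) ⨾⟨⟩
    ∑-cong⟨⟩ (suc k) λ r → mod-sym (Σ∞-∑ (residue-summable k r s) (suc N) ≤-refl))

-- One-sided theta series Σ_{j≥0} s^j (u + v j) q^{b j(j-1)/2 + a j}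

-- T j = j(j-1)/2, by recursion so that no division enters the exponents.
T : ℕ → ℕ
T zero    = 0
T (suc j) = T j + j

T-+ : ∀ m n → T (m + n) ≡ T m + T n + m * n
T-+ zero    n = sym (ℕP.+-identityʳ (T n))
T-+ (suc m) n = cong (_+ (m + n)) (T-+ m n) ∙ arith (T m) (T n) m n
  where
  arith : ∀ t u m n → t + u + m * n + (m + n) ≡ t + m + u + (n + m * n)
  arith = solve-∀

T-* : ∀ j k → T (j * k) ≡ k * k * T j + T k * j
T-* zero    k = sym (cong₂ _+_ (ℕP.*-zeroʳ (k * k)) (ℕP.*-zeroʳ (T k)) ∙ refl)
T-* (suc j) k = T-+ k (j * k) ∙ cong (λ t → T k + t + k * (j * k)) (T-* j k) ∙ arith (T k) (T j) j k
  where
  arith : ∀ a t j k → a + (k * k * t + a * j) + k * (j * k) ≡ k * k * (t + j) + a * suc j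
  arith = solve-∀

term : ℤ → ℤ → ℤ → ℕ → ℕ → ℕ → PS
term s u v b a j = κ (s ℤ.^ j *ᶻ (u +ᶻ v *ᶻ + j)) · X (b * T j + a * j)

os : ℤ → ℤ → ℤ → ℕ → ℕ → PS
os s u v b a = Σ∞ (term s u v b a)

θ⁺ : ℕ → ℕ → PS
θ⁺ = os 1ℤ 1ℤ 0ℤ

κX-0⟨⟩ : ∀ c {n} k → n ≤ k → κ c · X k ≈⟨ n ⟩ κ 0ℤ
κX-0⟨⟩ c k p = mod-mono p (·-cong⟨⟩ʳ (X-0⟨⟩ k) ⨾⟨⟩ ≈⇒mod (·-zeroʳ (κ c)))

term-summable : ∀ s u v b a → Summable (term s u v (suc b) a)
term-summable s u v b a = summable λ j → κX-0⟨⟩ _ _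
  (≤-trans (m≤n+m j (T j)) (≤-trans (m≤m+n _ (b * T (suc j))) (m≤m+n _ (a * suc j))))

private
  ℤ-arith : ∀ s u v r j k → s ℤ.^ (r + j * k) *ᶻ (u +ᶻ v *ᶻ + (r + j * k))
            ≡ s ℤ.^ r *ᶻ ((s ℤ.^ k) ℤ.^ j *ᶻ ((u +ᶻ v *ᶻ + r) +ᶻ (v *ᶻ + k) *ᶻ + j))
  ℤ-arith s u v r j k = cong₂ _*ᶻ_ pow lin ∙ ℤP.*-assoc (s ℤ.^ r) _ _
    where
    pow : s ℤ.^ (r + j * k) ≡ s ℤ.^ r *ᶻ (s ℤ.^ k) ℤ.^ j
    pow = ℤP.^-distribˡ-+-* s r (j * k) ∙
      cong (s ℤ.^ r *ᶻ_) (cong (s ℤ.^_) (ℕP.*-comm j k) ∙ sym (ℤP.^-*-assoc s k j))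
    lin : u +ᶻ v *ᶻ + (r + j * k) ≡ (u +ᶻ v *ᶻ + r) +ᶻ (v *ᶻ + k) *ᶻ + j
    lin = cong (u +ᶻ_) (ℤP.*-distribˡ-+ v (+ r) (+ (j * k)) ∙
        cong (v *ᶻ + r +ᶻ_) (cong (v *ᶻ_) (cong +_ (ℕP.*-comm j k) ∙ ℤP.pos-* k j) ∙ sym (ℤP.*-assoc v (+ k) (+ j)))) ∙
      sym (ℤP.+-assoc u _ _)

  κX-· : ∀ c d m n → κ (c *ᶻ d) · X (m + n) ≈ κ c · X m · (κ d · X n)
  κX-· c d m n = ·-cong (κ-* c d) (X-+ m n) ⨾
    solve 4 (λ c d x y → (c :* d) :* (x :* y) := c :* x :* (d :* y)) ≈-refl (κ c) (κ d) (X m) (X n)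

  term-residue : ∀ s u v b a k r j → term s u v b a (r + j * k) ≈
    κ (s ℤ.^ r) · X (b * T r + a * r) ·
      term (s ℤ.^ k) (u +ᶻ v *ᶻ + r) (v *ᶻ + k) (b * (k * k)) (a * k + b * (T k + k * r)) j
  term-residue s u v b a k r j = ≈-trans
    (·-cong (≈-cong κ (ℤ-arith s u v r j k)) (≈-reflexive (cong X expo)))
    (κX-· (s ℤ.^ r) _ (b * T r + a * r) _)
    where
    arith : ∀ b a k r j t x y → b * (x + (k * k * y + t * j) + r * (j * k)) + a * (r + j * k)
            ≡ (b * x + a * r) + (b * (k * k) * y + (a * k + b * (t + k * r)) * j)
    arith = solve-∀
    expo : b * T (r + j * k) + a * (r + j * k)
           ≡ (b * T r + a * r) + (b * (k * k) * T j + (a * k + b * (T k + k * r)) * j)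
    expo = cong (λ t → b * t + a * (r + j * k)) (T-+ r (j * k) ∙ cong (λ t → T r + t + r * (j * k)) (T-* j k)) ∙
      arith b a k r j (T k) (T r) (T j)

-- Substituting j = r + i(k + 1) leaves an exponent quadratic in i, by `T-+` and `T-*`, and a weight
-- linear in i. So each residue class of the index is again a one-sided theta series, times a
-- monomial.
os-residues : ∀ s u v b a k → os s u v (suc b) a ≈
  ∑ (λ r → κ (s ℤ.^ r) · X (suc b * T r + a * r) ·
    os (s ℤ.^ suc k) (u +ᶻ v *ᶻ + r) (v *ᶻ + suc k) (suc b * (suc k * suc k)) (a * suc k + suc b * (T (suc k) + suc k * r))) (suc k)
os-residues s u v b a k = Σ∞-residues k (term-summable s u v b a) ⨾ ∑-cong (suc k) λ r →
  ≈-trans (Σ∞-cong (term-residue s u v (suc b) a (suc k) r)) (Σ∞-·ˡ _ (term-summable (s ℤ.^ suc k) (u +ᶻ v *ᶻ + r) (v *ᶻ + suc k) (k + k * suc k + b * (suc k * suc k)) (a * suc k + suc b * (T (suc k) + suc k * r))))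

term-suc : ∀ s u v b a j → term s u v b a (suc j) ≈ κ s · X a · term s (u +ᶻ v) v b (b + a) j
term-suc s u v b a j = ·-cong
    (≈-cong κ (cong (s ℤ.^ suc j *ᶻ_) lin ∙ ℤP.*-assoc s (s ℤ.^ j) _))
    (≈-cong X (arith b a (T j) j)) ⨾ κX-· s _ a _
  where
  lin : u +ᶻ v *ᶻ + suc j ≡ (u +ᶻ v) +ᶻ v *ᶻ + j
  lin = cong (u +ᶻ_) (ℤP.*-distribˡ-+ v 1ℤ (+ j) ∙ cong (_+ᶻ v *ᶻ + j) (ℤP.*-identityʳ v)) ∙ sym (ℤP.+-assoc u v _)
  arith : ∀ b a t j → b * (t + j) + a * suc j ≡ a + (b * t + (b + a) * j)
  arith = solve-∀

os-tail : ∀ s u v b a → Σ∞ (term s u v (suc b) a ∘ suc) ≈ κ s · X a · os s (u +ᶻ v) v (suc b) (suc b + a)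
os-tail s u v b a = Σ∞-cong (term-suc s u v (suc b) a) ⨾ Σ∞-·ˡ _ (term-summable s (u +ᶻ v) v b (suc b + a))

tail-summable : ∀ s u v b a → Summable (term s u v (suc b) a ∘ suc)
tail-summable s u v b a = summable λ j → mod-mono (n≤1+n j) (vanish (term-summable s u v b a) (suc j))

os-head : ∀ s u v b a → os s u v (suc b) a ≈ κ u ⊕ κ s · X a · os s (u +ᶻ v) v (suc b) (suc b + a)
os-head s u v b a = Σ∞-head (term-summable s u v b a) (tail-summable s u v b a) ⨾ ⊕-cong first (os-tail s u v b a)
  where
  first : term s u v (suc b) a 0 ≈ κ u
  first = ·-cong (≈-cong κ (ℤP.*-identityˡ _ ∙ cong (u +ᶻ_) (ℤP.*-zeroʳ v) ∙ ℤP.+-identityʳ u))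
    (≈-cong X (cong₂ _+_ (ℕP.*-zeroʳ b) (ℕP.*-zeroʳ a)) ⨾ X0) ⨾ ·-idʳ (κ u)

os-⊕ : ∀ s u v u′ v′ b a → os s (u +ᶻ u′) (v +ᶻ v′) b a ≈ os s u v b a ⊕ os s u′ v′ b a
os-⊕ s u v u′ v′ b a = (Σ∞-cong λ j → ≈-trans
    (·-congˡ (≈-cong κ (arith j) ⨾ κ-+ _ _)) (·-distribʳ _ _ _)) ⨾ Σ∞-⊕ _ _
  where
  arith : ∀ j → s ℤ.^ j *ᶻ (u +ᶻ u′ +ᶻ (v +ᶻ v′) *ᶻ + j) ≡ s ℤ.^ j *ᶻ (u +ᶻ v *ᶻ + j) +ᶻ s ℤ.^ j *ᶻ (u′ +ᶻ v′ *ᶻ + j)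
  arith j = cong (s ℤ.^ j *ᶻ_) (cong (u +ᶻ u′ +ᶻ_) (ℤP.*-distribʳ-+ (+ j) v v′) ∙ +-interchange u u′ _ _) ∙
    ℤP.*-distribˡ-+ (s ℤ.^ j) _ _

os-scale : ∀ c s u v b a → os s (c *ᶻ u) (c *ᶻ v) (suc b) a ≈ κ c · os s u v (suc b) a
os-scale c s u v b a = (Σ∞-cong λ j → ≈-trans
    (·-congˡ (≈-cong κ (arith j) ⨾ κ-* _ _)) (·-assoc _ _ _)) ⨾ Σ∞-·ˡ (κ c) (term-summable s u v b a)
  where
  arith : ∀ j → s ℤ.^ j *ᶻ (c *ᶻ u +ᶻ c *ᶻ v *ᶻ + j) ≡ c *ᶻ (s ℤ.^ j *ᶻ (u +ᶻ v *ᶻ + j))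
  arith j = cong (s ℤ.^ j *ᶻ_) (cong (c *ᶻ u +ᶻ_) (ℤP.*-assoc c v (+ j)) ∙ sym (ℤP.*-distribˡ-+ c u _)) ∙
    sym (ℤP.*-assoc (s ℤ.^ j) c _) ∙ cong (_*ᶻ _) (ℤP.*-comm (s ℤ.^ j) c) ∙ ℤP.*-assoc c (s ℤ.^ j) _

-- The substitution q ↦ q^k

opaque
  dil : ℕ → PS → PS
  dil k f n with k ∣? n
  ... | yes (divides q _) = f q
  ... | no _              = 0ℤ

  dil-at : ∀ k f q → dil (suc k) f (q * suc k) ≡ f q
  dil-at k f q with suc k ∣? (q * suc k)
  ... | yes (divides q′ e) = cong f (sym (ℕP.*-cancelʳ-≡ q q′ (suc k) e))
  ... | no ¬d              = ⊥-elim (¬d (divides q refl))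

  dil-no : ∀ k f {n} → ¬ k ∣ n → dil k f n ≡ 0ℤ
  dil-no k f {n} ¬d with k ∣? n
  ... | yes d = ⊥-elim (¬d d)
  ... | no _  = refl

dil-ext : ∀ k f {g} → (∀ q → g (q * suc k) ≡ f q) → (∀ n → ¬ suc k ∣ n → g n ≡ 0ℤ) → dil (suc k) f ≈ g
dil-ext k f {g} y n = ptwise go
  where
  go : ∀ m → dil (suc k) f m ≡ g m
  go m with suc k ∣? m
  ... | yes (divides q refl) = dil-at k f q ∙ sym (y q)
  ... | no ¬d                = dil-no (suc k) f ¬d ∙ sym (n m ¬d)

dil-cong⟨⟩ : ∀ k {f g n} → f ≈⟨ n ⟩ g → dil (suc k) f ≈⟨ n ⟩ dil (suc k) g
dil-cong⟨⟩ k {f} {g} {n} e = below go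
  where
  go : ∀ i → i < n → dil (suc k) f i ≡ dil (suc k) g i
  go i p with suc k ∣? i
  ... | yes (divides q refl) = dil-at k f q ∙ coeff e q (≤-<-trans (m≤m*n q (suc k)) p) ∙ sym (dil-at k g q)
  ... | no ¬d                = dil-no (suc k) f ¬d ∙ sym (dil-no (suc k) g ¬d)

dil-cong : ∀ k {f g} → f ≈ g → dil (suc k) f ≈ dil (suc k) g
dil-cong k e = mod⇒≈ λ n → dil-cong⟨⟩ k (≈⇒mod e)

dil-⊕ : ∀ k f g → dil (suc k) (f ⊕ g) ≈ dil (suc k) f ⊕ dil (suc k) g
dil-⊕ k f g = dil-ext k (f ⊕ g)
  (λ q → trans (⊕-at _ _ _) (cong₂ _+ᶻ_ (dil-at k f q) (dil-at k g q) ∙ sym (⊕-at f g q)))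
  (λ n ¬d → trans (⊕-at _ _ n) (cong₂ _+ᶻ_ (dil-no (suc k) f ¬d) (dil-no (suc k) g ¬d)))

dil-κ· : ∀ k c f → dil (suc k) (κ c · f) ≈ κ c · dil (suc k) f
dil-κ· k c f = dil-ext k (κ c · f)
  (λ q → trans (κ·-at c _ _) (cong (c *ᶻ_) (dil-at k f q) ∙ sym (κ·-at c f q)))
  (λ n ¬d → trans (κ·-at c _ n) (cong (c *ᶻ_) (dil-no (suc k) f ¬d) ∙ ℤP.*-zeroʳ c))

dil-X· : ∀ k e f → dil (suc k) (X e · f) ≈ X (e * suc k) · dil (suc k) f
dil-X· k e f = dil-ext k (X e · f) yes-case no-case
  where
  yes-case : ∀ q → (X (e * suc k) · dil (suc k) f) (q * suc k) ≡ (X e · f) q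
  yes-case q with offset e q
  ... | low p       = X·-low _ _ _ (ℕP.*-monoˡ-< (suc k) p) ∙ sym (X·-low e f q p)
  ... | high m refl = cong (X (e * suc k) · dil (suc k) f) (ℕP.*-distribʳ-+ (suc k) e m) ∙
    X·-at (e * suc k) _ (m * suc k) ∙ dil-at k f m ∙ sym (X·-at e f m)
  no-case : ∀ n → ¬ suc k ∣ n → (X (e * suc k) · dil (suc k) f) n ≡ 0ℤ
  no-case n ¬d with offset (e * suc k) n
  ... | low p       = X·-low _ _ n p
  ... | high m refl = X·-at (e * suc k) _ m ∙ dil-no (suc k) f λ d → ¬d (∣m∣n⇒∣m+n (divides e refl) d)

dil-κ : ∀ k c → dil (suc k) (κ c) ≈ κ c
dil-κ k c = dil-ext k (κ c) go λ { zero ¬d → ⊥-elim (¬d (suc k ∣0)) ; (suc n) _ → κ-atsuc c n }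
  where
  go : ∀ q → κ c (q * suc k) ≡ κ c q
  go zero    = refl
  go (suc q) = κ-atsuc c _ ∙ sym (κ-atsuc c q)

dil-X : ∀ k e → dil (suc k) (X e) ≈ X (e * suc k)
dil-X k e = dil-cong k (≈-sym (·-idʳ (X e))) ⨾ dil-X· k e 𝟙 ⨾ ·-congʳ (dil-κ k 1ℤ) ⨾ ·-idʳ _

const+X· : ∀ f → f ≈ κ (f 0) ⊕ X 1 · (f ∘ suc)
const+X· f = ptwise λ n → trans (go n) (sym (⊕-at (κ (f 0)) _ n))
  where
  go : ∀ n → f n ≡ κ (f 0) n +ᶻ (X 1 · (f ∘ suc)) n
  go zero    = sym (cong₂ _+ᶻ_ (κ-at0 (f 0)) (X·-low 1 _ 0 (s≤s z≤n)) ∙ ℤP.+-identityʳ (f 0))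
  go (suc n) = sym (cong₂ _+ᶻ_ (κ-atsuc (f 0) n) (X·-at 1 (f ∘ suc) n) ∙ ℤP.+-identityˡ _)

-- Induction on the precision: writing f = f 0 + q f′ reduces the claim for f to the claim for f′,
-- and the monomial in front of it gains at least one degree.
dil-· : ∀ k f g → dil (suc k) (f · g) ≈ dil (suc k) f · dil (suc k) g
dil-· k f g = mod⇒≈ λ n → go n f
  where
  D = dil (suc k)
  expand : ∀ f → D (f · g) ≈ κ (f 0) · D g ⊕ X (1 * suc k) · D ((f ∘ suc) · g)
  expand f = dil-cong k (·-congˡ (const+X· f) ⨾ ·-distribʳ g _ _ ⨾ ⊕-congʳ (·-assoc _ _ _)) ⨾
    dil-⊕ k _ _ ⨾ ⊕-cong (dil-κ· k (f 0) g) (dil-X· k 1 _)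
  contract : ∀ f → κ (f 0) · D g ⊕ X (1 * suc k) · (D (f ∘ suc) · D g) ≈ D f · D g
  contract f = ≈-sym (·-congˡ (dil-cong k (const+X· f) ⨾ dil-⊕ k _ _ ⨾ ⊕-cong (dil-κ k (f 0)) (dil-X· k 1 _)) ⨾
    ·-distribʳ (D g) _ _ ⨾ ⊕-congʳ (·-assoc _ _ _))
  go : ∀ n f → D (f · g) ≈⟨ n ⟩ D f · D g
  go zero    f = below λ _ ()
  go (suc n) f = ≈⇒mod (expand f) ⨾⟨⟩ mod-trans
    (⊕-cong⟨⟩ʳ (mod-mono (s≤s (m≤n+m n (k + 0))) (X·-cong⟨⟩ (1 * suc k) (go n (f ∘ suc)))))
    (≈⇒mod (contract f))

dil-om : ∀ k j → dil (suc k) (om j) ≈ om (j * suc k)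
dil-om k j = dil-⊕ k 𝟙 (⊖ X j) ⨾ ⊕-cong (dil-κ k 1ℤ)
  (dil-cong k (neg (X j)) ⨾ dil-κ· k -1ℤ (X j) ⨾ ≈-sym (neg _) ⨾ ⊖-cong (dil-X k j))
  where
  neg : ∀ f → ⊖ f ≈ κ -1ℤ · f
  neg = solve 1 (λ f → :- f := con -1ℤ :* f) ≈-refl

dil-∏ : ∀ k F N → dil (suc k) (∏ F N) ≈ ∏ (λ n → dil (suc k) (F n)) N
dil-∏ k F zero    = dil-κ k 1ℤ
dil-∏ k F (suc N) = dil-· k _ _ ⨾ ·-congˡ (dil-∏ k F N)

dil-E : ∀ k j → dil (suc k) (E (suc j)) ≈ E (suc j * suc k)
dil-E k j = Lim-unique (E-conv (k + j * suc k)) λ N → mod-trans (dil-cong⟨⟩ k (Lim-∏ (E-conv j) N))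
  (≈⇒mod (dil-∏ k _ N ⨾ ∏-cong N λ n → ≈-trans (dil-om k _) (≈-cong om (arith j k n))))
  where
  arith : ∀ j k n → suc j * suc n * suc k ≡ suc j * suc k * suc n
  arith = solve-∀

inverse-unique : ∀ {f g h} → f · g ≈ 𝟙 → f · h ≈ 𝟙 → g ≈ h
inverse-unique {f} {g} {h} p q = ≈-sym (·-idʳ g) ⨾ ·-congʳ (≈-sym q) ⨾
  solve 3 (λ f g h → g :* (f :* h) := (f :* g) :* h) ≈-refl f g h ⨾ ·-congˡ p ⨾ ·-idˡ h

dil-I : ∀ k j → dil (suc k) (I (suc j)) ≈ I (suc j * suc k)
dil-I k j = inverse-unique (·-congˡ (≈-sym (dil-E k j)) ⨾
  ≈-sym (dil-· k _ _) ⨾ dil-cong k (E·I j) ⨾ dil-κ k 1ℤ) (E·I (k + j * suc k))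

dil-os : ∀ k s u v b a → dil (suc k) (os s u v (suc b) a) ≈ os s u v (suc b * suc k) (a * suc k)
dil-os k s u v b a = Σ∞-unique (term-summable s u v (k + b * suc k) (a * suc k)) λ N → mod-trans
  (dil-cong⟨⟩ k (Σ∞-∑ (term-summable s u v b a) (suc N) ≤-refl)) (≈⇒mod (dil-∑ (suc N)))
  where
  arith : ∀ b a t j k → (b * t + a * j) * k ≡ b * k * t + a * k * j
  arith = solve-∀
  dil-∑ : ∀ N → dil (suc k) (∑ (term s u v (suc b) a) N) ≈ ∑ (term s u v (suc b * suc k) (a * suc k)) N
  dil-∑ zero    = dil-κ k 0ℤ
  dil-∑ (suc N) = dil-⊕ k _ _ ⨾ ⊕-cong (dil-∑ N) (dil-κ· k _ _ ⨾
    ·-congʳ (dil-X k _ ⨾ ≈-cong X (arith (suc b) a (T N) N (suc k))))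

-- Dissections Σ_r q^r f_r(q^k)

comb : ℕ → ℕ → List PS → PS
comb k r []       = κ 0ℤ
comb k r (f ∷ fs) = X r · dil k f ⊕ comb k (suc r) fs

nth : List PS → ℕ → PS
nth []       _       = κ 0ℤ
nth (f ∷ fs) zero    = f
nth (f ∷ fs) (suc i) = nth fs i

Xdil-diag : ∀ k r f m → (X r · dil (suc k) f) (r + m * suc k) ≡ f m
Xdil-diag k r f m = X·-at r _ _ ∙ dil-at k f m

Xdil-off : ∀ k {r s} f m → r < suc k → s < suc k → r ≢ s → (X r · dil (suc k) f) (s + m * suc k) ≡ 0ℤ
Xdil-off k {r} {s} f m r<k s<k r≢s with offset r (s + m * suc k)
... | low p     = X·-low r _ _ p
... | high n′ e = cong (X r · dil (suc k) f) e ∙ X·-at r _ n′ ∙ dil-no (suc k) f λ where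
        (divides q e′) → r≢s (sym (residue r<k q) ∙ cong (_% suc k) (cong (_+_ r) (sym e′) ∙ sym e) ∙ residue s<k m)
  where
  residue : ∀ {r} → r < suc k → ∀ q → (r + q * suc k) % suc k ≡ r
  residue {r} p q = [m+kn]%n≡m%n r q (suc k) ∙ m<n⇒m%n≡m p

comb-below : ∀ k r fs s m → s < r → r + length fs ≤ suc k → comb (suc k) r fs (s + m * suc k) ≡ 0ℤ
comb-below k r []       s m s<r le = κ0-at (s + m * suc k)
comb-below k r (f ∷ fs) s m s<r le = ⊕-at _ _ (s + m * suc k) ∙ cong₂ _+ᶻ_
  (Xdil-off k f m r<k (ℕP.<-trans s<r r<k) (ℕP.>⇒≢ s<r))
  (comb-below k (suc r) fs s m (m≤n⇒m≤1+n s<r) (subst (_≤ suc k) (ℕP.+-suc r (length fs)) le))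
  where
  r<k : r < suc k
  r<k = ≤-trans (s≤s (m≤m+n r (length fs))) (subst (_≤ suc k) (ℕP.+-suc r (length fs)) le)

comb-at′ : ∀ k r fs i m → r + i < suc k → r + length fs ≤ suc k → comb (suc k) r fs ((r + i) + m * suc k) ≡ nth fs i m
comb-at′ k r []       i       m lt le = κ0-at ((r + i) + m * suc k) ∙ sym (κ0-at m)
comb-at′ k r (f ∷ fs) zero    m lt le = ⊕-at _ _ ((r + 0) + m * suc k) ∙ cong₂ _+ᶻ_
  (cong (λ t → (X r · dil (suc k) f) (t + m * suc k)) (ℕP.+-identityʳ r) ∙ Xdil-diag k r f m)
  (comb-below k (suc r) fs (r + 0) m (s≤s (≤-reflexive (ℕP.+-identityʳ r))) (subst (_≤ suc k) (ℕP.+-suc r (length fs)) le)) ∙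
  ℤP.+-identityʳ (f m)
comb-at′ k r (f ∷ fs) (suc i) m lt le = ⊕-at _ _ ((r + suc i) + m * suc k) ∙ cong₂ _+ᶻ_
  (Xdil-off k f m (≤-<-trans (m≤m+n r (suc i)) lt) lt (ℕP.<⇒≢ (subst (r <_) (sym (ℕP.+-suc r i)) (s≤s (m≤m+n r i)))))
  (cong (λ t → comb (suc k) (suc r) fs (t + m * suc k)) (ℕP.+-suc r i) ∙
    comb-at′ k (suc r) fs i m (subst (_< suc k) (ℕP.+-suc r i) lt) (subst (_≤ suc k) (ℕP.+-suc r (length fs)) le)) ∙
  ℤP.+-identityˡ _

comb-at : ∀ k fs i m → i < suc k → length fs ≤ suc k → comb (suc k) 0 fs (i + m * suc k) ≡ nth fs i m
comb-at k = comb-at′ k 0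

-- The finite Jacobi triple product

-- Over a commutative semiring, so that one proof serves power series and dual numbers over them.
-- Nothing is inverted: z and Q/z enter as elements x and y with xy = Q.
module FiniteTripleProduct {c ℓ} (R : CommutativeSemiring c ℓ) where

  private
    module R = CommutativeSemiring R
    open NatSolver R using () renaming (solve to solveᴿ; _:+_ to _⊞_; _:*_ to _⊠_; _:=_ to _⊜_; con to conᴿ)

  private
    infixr 5 _⟫_
    _⟫_ : ∀ {x y z} → x R.≈ y → y R.≈ z → x R.≈ z
    _⟫_ = R.trans

  open FiniteSums R public

  infixr 8 _^^_
  _^^_ : R.Carrier → ℕ → R.Carrier
  x ^^ zero  = R.1#
  x ^^ suc n = x ^^ n R.* x

  ^^-* : ∀ x y n → (x R.* y) ^^ n R.≈ x ^^ n R.* y ^^ n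
  ^^-* x y zero    = R.sym (R.*-identityˡ _)
  ^^-* x y (suc n) = R.*-cong (^^-* x y n) R.refl ⟫
    solveᴿ 4 (λ a b c d → (a ⊠ b) ⊠ (c ⊠ d) ⊜ (a ⊠ c) ⊠ (b ⊠ d)) R.refl _ _ _ _

  ^^-+ : ∀ x m n → x ^^ (m + n) R.≈ x ^^ m R.* x ^^ n
  ^^-+ x m zero    = R.reflexive (cong (x ^^_) (ℕP.+-identityʳ m)) ⟫ R.sym (R.*-identityʳ _)
  ^^-+ x m (suc n) = R.reflexive (cong (x ^^_) (ℕP.+-suc m n)) ⟫ R.*-cong (^^-+ x m n) R.refl ⟫ R.*-assoc _ _ _

  module _ (Q : R.Carrier) where

    -- The Gaussian binomial coefficient, given by its Pascal recursion instead of a quotient of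
    -- q-factorials.
    gauss : ℕ → ℕ → R.Carrier
    gauss L       zero    = R.1#
    gauss zero    (suc j) = R.0#
    gauss (suc L) (suc j) = gauss L j R.+ Q ^^ suc j R.* gauss L (suc j)

    gauss-zero : ∀ L k → gauss L (suc (k + L)) R.≈ R.0#
    gauss-zero zero    k = R.refl
    gauss-zero (suc L) k = R.+-cong
      (R.reflexive (cong (gauss L) (ℕP.+-suc k L)) ⟫ gauss-zero L k)
      (R.*-cong R.refl (R.reflexive (cong (λ t → gauss L (suc t)) (ℕP.+-suc k L)) ⟫ gauss-zero L (suc k))) ⟫
      R.+-identityˡ _ ⟫ R.zeroʳ _

    gauss-diag : ∀ N → gauss N N R.≈ R.1#
    gauss-diag zero    = R.refl
    gauss-diag (suc N) = R.+-cong (gauss-diag N) (R.*-cong R.refl (gauss-zero N 0) ⟫ R.zeroʳ _) ⟫ R.+-identityʳ _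

    -- Induction on M: after splitting off the factor 1 + x, the remaining product is the one for xQ
    -- with one factor less, and Pascal's rule combines the two sums.
    q-binomial : ∀ M x → ∏ᴿ (λ n → R.1# R.+ x R.* Q ^^ n) M R.≈ ∑ᴿ (λ j → (x ^^ j R.* Q ^^ T j) R.* gauss M j) (suc M)
    q-binomial zero    x = solveᴿ 0 (conᴿ 1 ⊜ conᴿ 0 ⊞ (conᴿ 1 ⊠ conᴿ 1) ⊠ conᴿ 1) R.refl
    q-binomial (suc M) x = ∏ᴿ-head _ M ⟫ R.trans
      (R.*-cong R.refl ((∏ᴿ-cong M λ n → solveᴿ 3 (λ x Q q → conᴿ 1 ⊞ x ⊠ (q ⊠ Q) ⊜ conᴿ 1 ⊞ (x ⊠ Q) ⊠ q) R.refl x Q (Q ^^ n)) ⟫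
        q-binomial M (x R.* Q)))
      (solveᴿ 2 (λ x A → (conᴿ 1 ⊞ x ⊠ conᴿ 1) ⊠ A ⊜ x ⊠ A ⊞ A) R.refl x A ⟫ R.sym rhs)
      where
      t : ℕ → R.Carrier
      t j = ((x R.* Q) ^^ j R.* Q ^^ T j) R.* gauss M j
      A = ∑ᴿ t (suc M)
      t-extend : ∑ᴿ t (suc (suc M)) R.≈ A
      t-extend = R.+-cong R.refl (R.*-cong R.refl (gauss-zero M 0) ⟫ R.zeroʳ _) ⟫ R.+-identityʳ _
      pascal : ∀ j → (x ^^ suc j R.* Q ^^ T (suc j)) R.* gauss (suc M) (suc j) R.≈ x R.* t j R.+ t (suc j)
      pascal j = R.trans
        (R.*-cong (R.*-cong R.refl (^^-+ Q (T j) j)) R.refl)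
        (solveᴿ 7 (λ x Q xj qt qj g g′ → ((xj ⊠ x) ⊠ (qt ⊠ qj)) ⊠ (g ⊞ (qj ⊠ Q) ⊠ g′)
            ⊜ x ⊠ (((xj ⊠ qj) ⊠ qt) ⊠ g) ⊞ ((((xj ⊠ qj) ⊠ (x ⊠ Q)) ⊠ (qt ⊠ qj)) ⊠ g′)) R.refl
            x Q (x ^^ j) (Q ^^ T j) (Q ^^ j) (gauss M j) (gauss M (suc j)) ⟫
          R.+-cong
            (R.*-cong R.refl (R.*-cong (R.*-cong (R.sym (^^-* x Q j)) R.refl) R.refl))
            (R.*-cong (R.*-cong (R.*-cong (R.sym (^^-* x Q j)) R.refl) (R.sym (^^-+ Q (T j) j))) R.refl))
      rhs : ∑ᴿ (λ j → (x ^^ j R.* Q ^^ T j) R.* gauss (suc M) j) (suc (suc M)) R.≈ x R.* A R.+ A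
      rhs = ∑ᴿ-head _ (suc M) ⟫ R.+-cong R.refl (∑ᴿ-cong (suc M) pascal ⟫
          ∑ᴿ-+ _ _ (suc M) ⟫ R.+-cong (∑ᴿ-*ˡ x t (suc M)) R.refl) ⟫
        solveᴿ 3 (λ h a b → h ⊞ (a ⊞ b) ⊜ a ⊞ (h ⊞ b)) R.refl _ _ _ ⟫
          R.+-cong R.refl (R.sym (∑ᴿ-head t (suc M)) ⟫ t-extend)

  module _ (x y Q : R.Carrier) (xy≈Q : x R.* y R.≈ Q) where

    -- shifted N j is z^(j-N) Q^((j-N)(j-N-1)/2) for x = z, y = Q/z.
    shifted : ℕ → ℕ → R.Carrier
    shifted zero    j       = x ^^ j R.* Q ^^ T j
    shifted (suc N) zero    = y ^^ suc N R.* Q ^^ T (suc N)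
    shifted (suc N) (suc j) = shifted N j

    shifted-step : ∀ N j → shifted N j R.* (y R.* Q ^^ N) R.≈ shifted (suc N) j R.* Q ^^ j
    shifted-step zero    zero    = solveᴿ 1 (λ y → (conᴿ 1 ⊠ conᴿ 1) ⊠ (y ⊠ conᴿ 1) ⊜ ((conᴿ 1 ⊠ y) ⊠ conᴿ 1) ⊠ conᴿ 1) R.refl y
    shifted-step zero    (suc j) = R.*-cong (R.*-cong R.refl (^^-+ Q (T j) j)) R.refl ⟫
      solveᴿ 5 (λ x y xj qt qj → ((xj ⊠ x) ⊠ (qt ⊠ qj)) ⊠ (y ⊠ conᴿ 1) ⊜ (xj ⊠ qt) ⊠ (qj ⊠ (x ⊠ y))) R.refl x y (x ^^ j) (Q ^^ T j) (Q ^^ j) ⟫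
        R.*-cong R.refl (R.*-cong R.refl xy≈Q)
    shifted-step (suc N) zero    = R.trans
      (solveᴿ 4 (λ yn qt qn y → (yn ⊠ qt) ⊠ (y ⊠ qn) ⊜ ((yn ⊠ y) ⊠ (qt ⊠ qn)) ⊠ conᴿ 1) R.refl (y ^^ suc N) (Q ^^ T (suc N)) (Q ^^ suc N) y)
      (R.*-cong (R.*-cong R.refl (R.sym (^^-+ Q (T (suc N)) (suc N)))) R.refl)
    shifted-step (suc N) (suc j) = R.trans
      (solveᴿ 4 (λ s y q Q → s ⊠ (y ⊠ (q ⊠ Q)) ⊜ (s ⊠ (y ⊠ q)) ⊠ Q) R.refl (shifted N j) y (Q ^^ N) Q)
      (R.*-cong (shifted-step N j) R.refl ⟫ R.*-assoc _ _ _)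

    S : ℕ → ℕ → R.Carrier
    S L N = ∑ᴿ (λ j → shifted N j R.* gauss Q L j) (suc L)

    -- Multiplying by one more factor 1 + y Q^N is Pascal's rule again: by `shifted-step` the
    -- product with y Q^N yields the summand of Pascal's rule that carries Q^j.
    S-step : ∀ L N → S L N R.* (R.1# R.+ y R.* Q ^^ N) R.≈ S (suc L) (suc N)
    S-step L N = solveᴿ 2 (λ s w → s ⊠ (conᴿ 1 ⊞ w) ⊜ s ⊞ w ⊠ s) R.refl (S L N) (y R.* Q ^^ N) ⟫ R.sym rhs
      where
      w = y R.* Q ^^ N
      u : ℕ → R.Carrier
      u j = (shifted (suc N) j R.* Q ^^ j) R.* gauss Q L j
      pascal : ∀ j → shifted (suc N) (suc j) R.* gauss Q (suc L) (suc j) R.≈ shifted N j R.* gauss Q L j R.+ u (suc j)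
      pascal j = solveᴿ 4 (λ s g q g′ → s ⊠ (g ⊞ q ⊠ g′) ⊜ s ⊠ g ⊞ (s ⊠ q) ⊠ g′) R.refl (shifted N j) (gauss Q L j) (Q ^^ suc j) (gauss Q L (suc j))
      u-extend : ∑ᴿ u (suc (suc L)) R.≈ ∑ᴿ u (suc L)
      u-extend = R.+-cong R.refl (R.*-cong R.refl (gauss-zero Q L 0) ⟫ R.zeroʳ _) ⟫ R.+-identityʳ _
      u-step : ∀ j → u j R.≈ w R.* (shifted N j R.* gauss Q L j)
      u-step j = R.*-cong (R.sym (shifted-step N j)) R.refl ⟫
        solveᴿ 3 (λ s w g → (s ⊠ w) ⊠ g ⊜ w ⊠ (s ⊠ g)) R.refl (shifted N j) w (gauss Q L j)
      rhs : S (suc L) (suc N) R.≈ S L N R.+ w R.* S L N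
      rhs = ∑ᴿ-head _ (suc L) ⟫ R.+-cong
          (solveᴿ 1 (λ s → s ⊠ conᴿ 1 ⊜ (s ⊠ conᴿ 1) ⊠ conᴿ 1) R.refl (shifted (suc N) 0))
          (∑ᴿ-cong (suc L) pascal ⟫ ∑ᴿ-+ _ _ (suc L)) ⟫
        solveᴿ 3 (λ h a b → h ⊞ (a ⊞ b) ⊜ a ⊞ (h ⊞ b)) R.refl _ _ _ ⟫
          R.+-cong R.refl (R.sym (∑ᴿ-head u (suc L)) ⟫ u-extend ⟫
            ∑ᴿ-cong (suc L) u-step ⟫ ∑ᴿ-*ˡ w _ (suc L))

    triple-product : ∀ M N → ∏ᴿ (λ n → R.1# R.+ x R.* Q ^^ n) M R.* ∏ᴿ (λ n → R.1# R.+ y R.* Q ^^ n) N R.≈ S (N + M) N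
    triple-product M zero    = R.*-identityʳ _ ⟫ q-binomial Q M x
    triple-product M (suc N) = R.sym (R.*-assoc _ _ _) ⟫ R.*-cong (triple-product M N) R.refl ⟫ S-step (N + M) N

-- Dual numbers over a commutative semiring

module _ {c ℓ} (R : CommutativeSemiring c ℓ) where

  private
    module R = CommutativeSemiring R
    open NatSolver R using () renaming (solve to solveᴿ; _:+_ to _⊞_; _:*_ to _⊠_; _:=_ to _⊜_; con to conᴿ)

  -- The pair (a , b) stands for a + bε with ε^2 = 0, so second components follow the product rule
  -- of a derivative.
  dualNumbers : CommutativeSemiring c ℓ
  dualNumbers = record
    { Carrier = R.Carrier × R.Carrier
    ; _≈_ = λ (a , b) (a′ , b′) → (a R.≈ a′) × (b R.≈ b′)
    ; _+_ = λ (a , b) (a′ , b′) → (a R.+ a′) , (b R.+ b′)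
    ; _*_ = λ (a , b) (a′ , b′) → (a R.* a′) , (a R.* b′ R.+ b R.* a′)
    ; 0# = R.0# , R.0#
    ; 1# = R.1# , R.0#
    ; isCommutativeSemiring = isCommutativeSemiringˡ record
      { +-isCommutativeMonoid = record
        { isMonoid = record
          { isSemigroup = record
            { isMagma = record
              { isEquivalence = equiv
              ; ∙-cong = λ (p , q) (p′ , q′) → R.+-cong p p′ , R.+-cong q q′ }
            ; assoc = λ _ _ _ → R.+-assoc _ _ _ , R.+-assoc _ _ _ }
          ; identity = (λ _ → R.+-identityˡ _ , R.+-identityˡ _) , (λ _ → R.+-identityʳ _ , R.+-identityʳ _) }
        ; comm = λ _ _ → R.+-comm _ _ , R.+-comm _ _ }
      ; *-isCommutativeMonoid = record
        { isMonoid = record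
          { isSemigroup = record
            { isMagma = record
              { isEquivalence = equiv
              ; ∙-cong = λ (p , q) (p′ , q′) → R.*-cong p p′ , R.+-cong (R.*-cong p q′) (R.*-cong q p′) }
            ; assoc = λ (a , b) (c , d) (e , f) → R.*-assoc _ _ _ ,
                solveᴿ 6 (λ a b c d e f → (a ⊠ c) ⊠ f ⊞ (a ⊠ d ⊞ b ⊠ c) ⊠ e ⊜ a ⊠ (c ⊠ f ⊞ d ⊠ e) ⊞ b ⊠ (c ⊠ e)) R.refl a b c d e f }
          ; identity = (λ (a , b) → R.*-identityˡ _ , solveᴿ 2 (λ a b → conᴿ 1 ⊠ b ⊞ conᴿ 0 ⊠ a ⊜ b) R.refl a b)
                     , (λ (a , b) → R.*-identityʳ _ , solveᴿ 2 (λ a b → a ⊠ conᴿ 0 ⊞ b ⊠ conᴿ 1 ⊜ b) R.refl a b) }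
        ; comm = λ (a , b) (c , d) → R.*-comm _ _ , solveᴿ 4 (λ a b c d → a ⊠ d ⊞ b ⊠ c ⊜ c ⊠ b ⊞ d ⊠ a) R.refl a b c d }
      ; distribʳ = λ (a , b) (c , d) (e , f) → R.distribʳ _ _ _ ,
          solveᴿ 6 (λ a b c d e f → (c ⊞ e) ⊠ b ⊞ (d ⊞ f) ⊠ a ⊜ (c ⊠ b ⊞ d ⊠ a) ⊞ (e ⊠ b ⊞ f ⊠ a)) R.refl a b c d e f
      ; zeroˡ = λ (a , b) → R.zeroˡ _ , solveᴿ 2 (λ a b → conᴿ 0 ⊠ b ⊞ conᴿ 0 ⊠ a ⊜ conᴿ 0) R.refl a b } }
    where
    equiv : IsEquivalence λ (a , b) (a′ , b′) → (a R.≈ a′) × (b R.≈ b′)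
    equiv = record
      { refl = R.refl , R.refl
      ; sym = λ (p , q) → R.sym p , R.sym q
      ; trans = λ (p , q) (p′ , q′) → R.trans p p′ , R.trans q q′ }

-- The Jacobi triple product over the dual numbers

∑-cong⟨⟩ᵇ : ∀ {h g n} N → (∀ r → r < N → h r ≈⟨ n ⟩ g r) → ∑ h N ≈⟨ n ⟩ ∑ g N
∑-cong⟨⟩ᵇ zero    e = mod-refl
∑-cong⟨⟩ᵇ (suc N) e = ⊕-cong⟨⟩ (∑-cong⟨⟩ᵇ N λ r p → e r (m≤n⇒m≤1+n p)) (e N ≤-refl)

shift-out : ∀ {a f} → f ≈⟨ a ⟩ κ 0ℤ → f ≈ X a · (λ n → f (a + n))
shift-out {a} {f} e = ≈-sym (X·-ext a _ (λ n p → trans (coeff e n p) (κ0-at n)) λ m → refl)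

-- Precisions add: f is divisible by q^a, so g matters only modulo q^b.
·-cong⟨+⟩ : ∀ {a b f g h} → f ≈⟨ a ⟩ κ 0ℤ → g ≈⟨ b ⟩ h → f · g ≈⟨ a + b ⟩ f · h
·-cong⟨+⟩ {a} {f = f} {g} {h} e d = ≈⇒mod (pull g) ⨾⟨⟩ mod-trans
    (X·-cong⟨⟩ a (·-cong⟨⟩ʳ d)) (≈⇒mod (≈-sym (pull h)))
  where
  pull : ∀ g → f · g ≈ X a · ((λ n → f (a + n)) · g)
  pull g = ·-congˡ (shift-out e) ⨾ ·-assoc _ _ _

-- For a + a′ = b this is Σ_{m∈ℤ} s^m (u + v m) q^{b m(m-1)/2 + a m}; the second summand collects m < 0.
th : ℤ → ℤ → ℤ → ℕ → ℕ → ℕ → PS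
th s u v b a a′ = os s u v b a ⊕ κ s · X a′ · os s (u +ᶻ ℤ.- v) (ℤ.- v) b (b + a′)

module P = FiniteTripleProduct psSemiring

module D where
  open CommutativeSemiring (dualNumbers psSemiring) public
  open FiniteTripleProduct (dualNumbers psSemiring) public

module _ (b : ℕ) where

  private
    β = suc b
    G = P.gauss (X β)
    e : ℕ → PS
    e = ∏ λ n → om (β * suc n)

  X^^ : ∀ n → X β P.^^ n ≈ X (β * n)
  X^^ zero    = ≈-sym (≈-cong X (ℕP.*-zeroʳ β) ⨾ X0)
  X^^ (suc n) = ·-congˡ (X^^ n) ⨾ ≈-sym (X-+ (β * n) β) ⨾
    ≈-cong X (ℕP.+-comm (β * n) β ∙ sym (ℕP.*-suc β n))

  -- The quotient formula for Gaussian binomials, cleared of denominators. Pascal's rule reduces it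
  -- to (1 - y) + y(1 - x) = 1 - xy.
  gauss-product : ∀ M N → G (N + M) N · e M · e N ≈ e (N + M)
  gauss-product M       zero    = solve 1 (λ e → :1 :* e :* :1 := e) ≈-refl (e M)
  gauss-product zero    (suc N) = ·-congˡ (·-cong
      (≈-cong (λ t → G t (suc N)) (ℕP.+-identityʳ (suc N)) ⨾ P.gauss-diag (X β) (suc N)) ≈-refl) ⨾
    solve 1 (λ e → :1 :* :1 :* e := e) ≈-refl (e (suc N)) ⨾ ≈-cong e (sym (ℕP.+-identityʳ (suc N)))
  gauss-product (suc M) (suc N) = (·-congˡ (·-congˡ (⊕-congʳ (·-congˡ (X^^ (suc N))))) ⨾
    solve 6 (λ g y g′ em x en → (g :+ y :* g′) :* (em :* (:1 :- x)) :* (en :* (:1 :- y))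
       := (g :* (em :* (:1 :- x)) :* en) :* (:1 :- y) :+ y :* (:1 :- x) :* (g′ :* em :* (en :* (:1 :- y)))) ≈-refl
       (G (N + suc M) N) y (G (N + suc M) (suc N)) (e M) x (e N)) ⨾
    ⊕-cong (·-congˡ (gauss-product (suc M) N))
        (·-congʳ (·-congˡ (·-congˡ (≈-cong (λ t → G t (suc N)) (ℕP.+-suc N M))) ⨾ gauss-product M (suc N))) ⨾
      ⊕-congʳ (·-congʳ (≈-cong e (sym (ℕP.+-suc N M)))) ⨾
        solve 3 (λ e x y → e :* (:1 :- y) :+ y :* (:1 :- x) :* e := e :* (:1 :- (y :* x))) ≈-refl (e (N + suc M)) x y ⨾
          ·-congʳ (⊕-congʳ (⊖-cong (≈-sym (X-+ (β * suc N) (β * suc M)) ⨾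
            ≈-cong X (sym (ℕP.*-distribˡ-+ β (suc N) (suc M)) ∙ refl))))
    where
    x = X (β * suc M)
    y = X (β * suc N)

  -- In `gauss-product` all three finite products may be replaced by `E β` up to q^K. This gives the
  -- claim multiplied by `E β`, and `I β` removes that factor.
  gauss-lim : ∀ {K M N} → K ≤ M → K ≤ N → E β · G (N + M) N ≈⟨ suc K ⟩ 𝟙
  gauss-lim {K} {M} {N} K≤M K≤N = ≈⇒mod (cancelˡ (E β · G (N + M) N)) ⨾⟨⟩
    ·-cong⟨⟩ʳ step ⨾⟨⟩ ≈⇒mod (·-comm _ _ ⨾ E·I b)
    where
    toE : ∀ {L} → K ≤ L → E β ≈⟨ suc K ⟩ e L
    toE {L} p = mod-mono (s≤s p) (Lim-∏ (E-conv b) L)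
    step : E β · (E β · G (N + M) N) ≈⟨ suc K ⟩ E β
    step = ≈⇒mod (solve 2 (λ e g → e :* (e :* g) := g :* e :* e) ≈-refl (E β) (G (N + M) N)) ⨾⟨⟩
      ·-cong⟨⟩ (·-cong⟨⟩ʳ (toE K≤M)) (toE K≤N) ⨾⟨⟩
        ≈⇒mod (gauss-product M N) ⨾⟨⟩ mod-sym (toE (≤-trans K≤N (m≤m+n N M)))
    cancelˡ : ∀ f → f ≈ I β · (E β · f)
    cancelˡ f = ≈-sym (solve 3 (λ i e f → i :* (e :* f) := (e :* i) :* f) ≈-refl (I β) (E β) f ⨾
      ·-congˡ (E·I b) ⨾ ·-idˡ f)

-- At z = 1 + ε one has z^m = 1 + mε, so this functional turns z^m into the weight u + v m.
functional : ℤ → ℤ → D.Carrier → PS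
functional u v (f , g) = κ u · f ⊕ κ v · g

module TripleProduct (s u v : ℤ) (b a a′ : ℕ) (s² : s *ᶻ s ≡ 1ℤ) (a+a′ : a + a′ ≡ suc b) where

  private
    β = suc b
    ℓ = functional u v
    Q x y : D.Carrier
    Q = X β , κ 0ℤ
    -- x = s z q^a and y = s z⁻¹ q^a′ with z = 1 + ε and z⁻¹ = 1 - ε. Writing the ε-part as `s *ᶻ ε`
    -- with ε = 1 or -1 lets `pow` and `ℓ-term` treat both at once.
    x = κ s · X a , κ (s *ᶻ 1ℤ) · X a
    y = κ s · X a′ , κ (s *ᶻ -1ℤ) · X a′

    ℓ-cong : ∀ {c d} → c D.≈ d → ℓ c ≈ ℓ d
    ℓ-cong (p , q) = ⊕-cong (·-congʳ p) (·-congʳ q)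

    xy≈Q : x D.* y D.≈ Q
    xy≈Q = first , second
      where
      ss : κ s · κ s ≈ 𝟙
      ss = ≈-sym (κ-* s s) ⨾ ≈-reflexive (cong κ s²)
      first : κ s · X a · (κ s · X a′) ≈ X β
      first = solve 3 (λ c x y → c :* x :* (c :* y) := (c :* c) :* (x :* y)) ≈-refl (κ s) (X a) (X a′) ⨾
        ·-cong ss (≈-sym (X-+ a a′) ⨾ ≈-reflexive (cong X a+a′)) ⨾ ·-idˡ _
      second : κ s · X a · (κ (s *ᶻ -1ℤ) · X a′) ⊕ κ (s *ᶻ 1ℤ) · X a · (κ s · X a′) ≈ κ 0ℤ
      second = ⊕-cong (·-congʳ (·-congˡ (κ-* s -1ℤ))) (·-congˡ (·-congˡ (κ-* s 1ℤ))) ⨾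
        solve 3 (λ c x y → c :* x :* (c :* con -1ℤ :* y) :+ c :* :1 :* x :* (c :* y) := :0) ≈-refl (κ s) (X a) (X a′)

    Q^^ : ∀ n → Q D.^^ n D.≈ (X (β * n) , κ 0ℤ)
    Q^^ zero    = ≈-sym (≈-cong X (ℕP.*-zeroʳ β) ⨾ X0) , ≈-refl
    Q^^ (suc n) = D.trans (D.*-cong (Q^^ n) D.refl)
      ( ≈-trans (≈-sym (X-+ (β * n) β)) (≈-cong X (ℕP.+-comm (β * n) β ∙ sym (ℕP.*-suc β n)))
      , solve 2 (λ x y → x :* :0 :+ :0 :* y := :0) ≈-refl (X (β * n)) (X β))

    pow : ∀ ε c n → (κ s · X c , κ (s *ᶻ ε) · X c) D.^^ n D.≈ (κ (s ℤ.^ n) · X (c * n) , κ (s ℤ.^ n *ᶻ (ε *ᶻ + n)) · X (c * n))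
    pow ε c zero    = ≈-sym (·-idˡ _ ⨾ ≈-cong X (ℕP.*-zeroʳ c) ⨾ X0)
      , ≈-sym (·-congˡ (≈-cong κ (ℤP.*-identityˡ _ ∙ ℤP.*-zeroʳ ε)) ⨾ ·-zeroˡ _)
    pow ε c (suc n) = D.trans (D.*-cong (pow ε c n) D.refl)
      ( ≈-trans (solve 4 (λ t x s y → t :* x :* (s :* y) := (s :* t) :* (x :* y)) ≈-refl (κ (s ℤ.^ n)) (X (c * n)) (κ s) (X c))
          (·-cong (≈-sym (κ-* s _)) expo)
      , ≈-trans (⊕-cong (·-congʳ (·-congˡ (κ-* s ε))) (·-congˡ (·-congˡ (κ-* (s ℤ.^ n) _ ⨾ ·-congʳ (κ-* ε (+ n))))))
          (solve 6 (λ t x s y ε n → t :* x :* (s :* ε :* y) :+ t :* (ε :* n) :* x :* (s :* y)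
              := (s :* t) :* (ε :* (:1 :+ n)) :* (x :* y)) ≈-refl (κ (s ℤ.^ n)) (X (c * n)) (κ s) (X c) (κ ε) (κ (+ n)) ⨾
            ·-cong (≈-sym (κ-* (s ℤ.^ suc n) _ ⨾ ·-cong (κ-* s _) (κ-* ε (+ suc n) ⨾ ·-congʳ (κ-+ 1ℤ (+ n))))) expo))
      where
      expo : X (c * n) · X c ≈ X (c * suc n)
      expo = ≈-sym (X-+ (c * n) c) ⨾ ≈-cong X (ℕP.+-comm (c * n) c ∙ sym (ℕP.*-suc c n))

    ℓ-term : ∀ ε c n → ℓ ((κ s · X c , κ (s *ᶻ ε) · X c) D.^^ n D.* Q D.^^ T n) ≈ term s u (v *ᶻ ε) β c n
    ℓ-term ε c n = ℓ-cong (D.*-cong (pow ε c n) (Q^^ (T n))) ⨾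
      ⊕-congʳ (·-congʳ (⊕-congʳ (·-congˡ (·-congˡ (κ-* (s ℤ.^ n) _ ⨾ ·-congʳ (κ-* ε (+ n))))))) ⨾
      solve 7 (λ u v t x q ε n → u :* (t :* x :* q) :+ v :* (t :* x :* :0 :+ t :* (ε :* n) :* x :* q)
          := t :* (u :+ v :* ε :* n) :* (q :* x)) ≈-refl (κ u) (κ v) (κ (s ℤ.^ n)) (X (c * n)) (X (β * T n)) (κ ε) (κ (+ n)) ⨾
        ·-cong (≈-sym (κ-* (s ℤ.^ n) _ ⨾ ·-congʳ (κ-+ u _ ⨾ ⊕-congʳ (κ-* (v *ᶻ ε) (+ n) ⨾ ·-congˡ (κ-* v ε)))))
          (≈-sym (X-+ (β * T n) (c * n)))

    W : ℕ → ℕ → PS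
    W N j = ℓ (D.shifted x y Q xy≈Q N j)

    W-x : ∀ j → W 0 j ≈ term s u v β a j
    W-x j = ℓ-term 1ℤ a j ⨾ ≈-cong (λ w → term s u w β a j) (ℤP.*-identityʳ v)

    W-y : ∀ N → W (suc N) 0 ≈ term s u (ℤ.- v) β a′ (suc N)
    W-y N = ℓ-term -1ℤ a′ (suc N) ⨾ ≈-cong (λ w → term s u w β a′ (suc N)) (ℤP.*-comm v -1ℤ ∙ ℤP.-1*i≡-i v)

    W-low : ∀ N j → W N j ≈⟨ N ∸ suc j ⟩ κ 0ℤ
    W-low zero    j       = below λ _ ()
    W-low (suc N) zero    = ≈⇒mod (W-y N) ⨾⟨⟩ vanish (term-summable s u (ℤ.- v) b a′) N
    W-low (suc N) (suc j) = W-low N j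

    W-high : ∀ N j → W N j ≈⟨ j ∸ suc N ⟩ κ 0ℤ
    W-high zero    zero    = below λ _ ()
    W-high zero    (suc j) = ≈⇒mod (W-x (suc j)) ⨾⟨⟩ vanish (term-summable s u v b a) j
    W-high (suc N) zero    = below λ _ ()
    W-high (suc N) (suc j) = W-high N j

    W-shift : ∀ N r → W N (r + N) ≈ W 0 r
    W-shift zero    r = ≈-cong (W 0) (ℕP.+-identityʳ r)
    W-shift (suc N) r = ≈-cong (W (suc N)) (ℕP.+-suc r N) ⨾ W-shift N r

    ∑W-low : ∀ N → ∑ (W N) N ≈ ∑ (λ i → W (suc i) 0) N
    ∑W-low zero    = ≈-refl
    ∑W-low (suc N) = ∑-head (W (suc N)) N ⨾ ⊕-comm _ _ ⨾ ⊕-congˡ (∑W-low N)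

    gauss-dual : ∀ L j → D.gauss Q L j D.≈ (P.gauss (X β) L j , κ 0ℤ)
    gauss-dual L       zero    = D.refl
    gauss-dual zero    (suc j) = D.refl
    gauss-dual (suc L) (suc j) = D.trans (D.+-cong (gauss-dual L j) (D.*-cong (Q^^ (suc j)) (gauss-dual L (suc j))))
      ( ⊕-congʳ (·-congˡ (≈-sym (X^^ b (suc j))))
      , solve 2 (λ x g → :0 :+ (x :* :0 :+ :0 :* g) := :0) ≈-refl (X (β * suc j)) (P.gauss (X β) L (suc j)))

    -- The Gaussian coefficients have no ε-part, by `gauss-dual`, so the functional passes through
    -- them as through scalars.
    E·ℓ-∑ : ∀ N M → E β · ℓ (D.∑ᴿ (λ j → D.shifted x y Q xy≈Q N j D.* D.gauss Q (N + N) j) M)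
              ≈ ∑ (λ j → W N j · (E β · P.gauss (X β) (N + N) j)) M
    E·ℓ-∑ N zero    = solve 3 (λ e u v → e :* (u :* :0 :+ v :* :0) := :0) ≈-refl (E β) (κ u) (κ v)
    E·ℓ-∑ N (suc M) = ≈-trans
      (solve 7 (λ e u v f g f′ g′ → e :* (u :* (f :+ f′) :+ v :* (g :+ g′)) := e :* (u :* f :+ v :* g) :+ e :* (u :* f′ :+ v :* g′)) ≈-refl
        (E β) (κ u) (κ v) _ _ _ _)
      (⊕-cong (E·ℓ-∑ N M) (·-congʳ (ℓ-cong (D.*-cong D.refl (gauss-dual (N + N) M))) ⨾
        solve 6 (λ e u v f g h → e :* (u :* (f :* h) :+ v :* (f :* :0 :+ g :* h)) := (u :* f :+ v :* g) :* (e :* h)) ≈-refl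
          (E β) (κ u) (κ v) _ _ _))

    -- The term at distance |j - N| from the centre has order at least |j - N| - 1, while the
    -- Gaussian coefficient times `E β` is 1 up to order min(j, 2N - j) + 1. The two orders always
    -- add up to at least N, so no uniform convergence of the coefficients is required.
    estimate : ∀ N j → j < suc (N + N) → W N j · (E β · P.gauss (X β) (N + N) j) ≈⟨ N ⟩ W N j
    estimate N j (s≤s j≤2N) = go (ℕP.≤-total j N) ⨾⟨⟩ ≈⇒mod (·-idʳ _)
      where
      M = (N + N) ∸ j
      j+M : j + M ≡ N + N
      j+M = ℕP.m+[n∸m]≡n j≤2N
      lim : ∀ {K} → K ≤ M → K ≤ j → E β · P.gauss (X β) (N + N) j ≈⟨ suc K ⟩ 𝟙
      lim {K} p q = subst (λ L → E β · P.gauss (X β) L j ≈⟨ suc K ⟩ 𝟙) j+M (gauss-lim b p q)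
      bound₁ : j ≤ N → N ≤ (N ∸ suc j) + suc j
      bound₁ p = ≤-trans (ℕP.m≤n+m∸n N (suc j)) (≤-reflexive (ℕP.+-comm (suc j) _))
      bound₂ : N ≤ (j ∸ suc N) + suc M
      bound₂ = ℕP.+-cancelʳ-≤ j N _ (≤-trans (ℕP.+-monoʳ-≤ N (ℕP.m≤n+m∸n j (suc N)))
        (≤-reflexive (arith N (j ∸ suc N) ∙ cong (λ t → suc (t + (j ∸ suc N))) (sym j+M) ∙ arith′ j M (j ∸ suc N))))
        where
        arith : ∀ N k → N + (suc N + k) ≡ suc (N + N + k)
        arith = solve-∀
        arith′ : ∀ j M k → suc (j + M + k) ≡ k + suc M + j
        arith′ = solve-∀
      go : j ≤ N ⊎ N ≤ j → W N j · (E β · P.gauss (X β) (N + N) j) ≈⟨ N ⟩ W N j · 𝟙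
      go (inj₁ p) = mod-mono (bound₁ p) (·-cong⟨+⟩ (W-low N j) (lim {j}
        (≤-trans p (ℕP.+-cancelˡ-≤ j N M (≤-trans (ℕP.+-monoˡ-≤ N p) (≤-reflexive (sym j+M))))) ≤-refl))
      go (inj₂ p) = mod-mono bound₂ (·-cong⟨+⟩ (W-high N j) (lim {M} ≤-refl
        (≤-trans (ℕP.+-cancelˡ-≤ j M N (≤-trans (≤-reflexive j+M) (ℕP.+-monoˡ-≤ N p))) p)))

  factor : ℤ → ℕ → ℕ → D.Carrier
  factor ε c n = 𝟙 ⊕ κ s · X (c + β * n) , κ (s *ᶻ ε) · X (c + β * n)

  private
    factor-≈ : ∀ ε c n → D.1# D.+ (κ s · X c , κ (s *ᶻ ε) · X c) D.* Q D.^^ n D.≈ factor ε c n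
    factor-≈ ε c n = D.trans (D.+-cong D.refl (D.*-cong D.refl (Q^^ n)))
      ( ⊕-congʳ (·-assoc _ _ _ ⨾ ·-congʳ (≈-sym (X-+ c (β * n))))
      , ≈-trans (solve 4 (λ s x q t → :0 :+ (s :* :0 :+ t :* x :* q) := t :* (x :* q)) ≈-refl (κ s · X c) (X c) (X (β * n)) (κ (s *ᶻ ε)))
          (·-congʳ (≈-sym (X-+ c (β * n)))))

  partialProduct : ℕ → D.Carrier
  partialProduct N = D.∏ᴿ (factor 1ℤ a) N D.* D.∏ᴿ (factor -1ℤ a′) N

  triple-product : ∀ N → E (suc b) · functional u v (partialProduct (suc N)) ≈⟨ N ⟩ th s u v (suc b) a a′
  triple-product N = ≈⇒mod (≈-trans
      (·-congʳ (ℓ-cong (D.trans (D.*-cong (D.∏ᴿ-cong L λ n → D.sym (factor-≈ 1ℤ a n)) (D.∏ᴿ-cong L λ n → D.sym (factor-≈ -1ℤ a′ n)))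
        (D.triple-product x y Q xy≈Q L L))))
      (E·ℓ-∑ L (suc (L + L)))) ⨾⟨⟩
    mod-mono (n≤1+n N) (∑-cong⟨⟩ᵇ (suc (L + L)) (estimate L)) ⨾⟨⟩
    ≈⇒mod (∑-+ (W L) L (suc L) ⨾ ⊕-comm _ _ ⨾ ⊕-cong
        (∑-cong (suc L) λ r → ≈-trans (W-shift L r) (W-x r)) (∑W-low L ⨾ ∑-cong L W-y)) ⨾⟨⟩
      ⊕-cong⟨⟩ (mod-sym (Σ∞-∑ (term-summable s u v b a) (suc L) (m≤n+m (suc N) 1)))
        (mod-sym (Σ∞-∑ (tail-summable s u (ℤ.- v) b a′) L ≤-refl) ⨾⟨⟩ ≈⇒mod (os-tail s u (ℤ.- v) b a′))
    where
    -- One more factor than the precision: the half with m < 0 contributes only L terms, and these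
    -- determine N = L - 1 degrees.
    L = suc N

-- Positivity

record NonNeg (f : PS) : Set where
  constructor nonNeg
  field 0≤ : ∀ n → 0ℤ ℤ.≤ f n
open NonNeg

-- The positive constant term is what makes a product with an `AllPos` series `AllPos` again: in
-- each degree the summand with index 0 is already positive.
record NonNeg₊ (f : PS) : Set where
  constructor nonNeg₊
  field
    nn  : NonNeg f
    0<₀ : 0ℤ ℤ.< f 0
open NonNeg₊

record AllPos (f : PS) : Set where
  constructor allPos
  field 0< : ∀ n → 0ℤ ℤ.< f n
open AllPos

*-nonneg : ∀ {a b} → 0ℤ ℤ.≤ a → 0ℤ ℤ.≤ b → 0ℤ ℤ.≤ a *ᶻ b
*-nonneg {+ m} {+ n} _ _ = subst (0ℤ ℤ.≤_) (ℤP.pos-* m n) (ℤ.+≤+ z≤n)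

*-pos : ∀ {a b} → 0ℤ ℤ.< a → 0ℤ ℤ.< b → 0ℤ ℤ.< a *ᶻ b
*-pos {+ suc m} {+ suc n} _ _ = ℤ.+<+ (s≤s z≤n)
*-pos {+ suc m} {+ zero}  _ (ℤ.+<+ ())
*-pos {+ zero}            (ℤ.+<+ ()) _

sum-nonneg : ∀ n {h} → (∀ i → i ≤ n → 0ℤ ℤ.≤ h i) → 0ℤ ℤ.≤ sumTo n h
sum-nonneg zero    p = p 0 z≤n
sum-nonneg (suc n) p = ℤP.+-mono-≤ (sum-nonneg n λ i q → p i (m≤n⇒m≤1+n q)) (p (suc n) ≤-refl)

sum-pos : ∀ n {h} → (∀ i → i ≤ n → 0ℤ ℤ.≤ h i) → ∀ j → j ≤ n → 0ℤ ℤ.< h j → 0ℤ ℤ.< sumTo n h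
sum-pos zero    p zero z≤n q = q
sum-pos (suc n) p j j≤ q with ℕP.m≤n⇒m<n∨m≡n j≤
... | inj₁ (s≤s j≤n) = ℤP.+-mono-<-≤ (sum-pos n (λ i r → p i (m≤n⇒m≤1+n r)) j j≤n q) (p (suc n) ≤-refl)
... | inj₂ refl      = ℤP.+-mono-≤-< (sum-nonneg n λ i r → p i (m≤n⇒m≤1+n r)) q

NonNeg-resp : ∀ {f g} → f ≈ g → NonNeg f → NonNeg g
NonNeg-resp e p = nonNeg λ n → subst (0ℤ ℤ.≤_) (at e n) (0≤ p n)

NonNeg₊-resp : ∀ {f g} → f ≈ g → NonNeg₊ f → NonNeg₊ g
NonNeg₊-resp e p = nonNeg₊ (NonNeg-resp e (nn p)) (subst Pos (at e 0) (0<₀ p))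

AllPos-resp : ∀ {f g} → f ≈ g → AllPos f → AllPos g
AllPos-resp e p = allPos λ n → subst Pos (at e n) (0< p n)

AllPos⇒NonNeg₊ : ∀ {f} → AllPos f → NonNeg₊ f
AllPos⇒NonNeg₊ p = nonNeg₊ (nonNeg λ n → ℤP.<⇒≤ (0< p n)) (0< p 0)

NonNeg-lim : ∀ {f} → (∀ N → ∃[ g ] (f ≈⟨ N ⟩ g × NonNeg g)) → NonNeg f
NonNeg-lim {f} p = nonNeg λ n → let (g , e , q) = p (suc n) in subst (0ℤ ℤ.≤_) (sym (coeff e n ≤-refl)) (0≤ q n)

opaque
  unfolding _⊕_

  NonNeg-⊕ : ∀ {f g} → NonNeg f → NonNeg g → NonNeg (f ⊕ g)
  NonNeg-⊕ p q = nonNeg λ n → ℤP.+-mono-≤ (0≤ p n) (0≤ q n)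

  NonNeg₊-⊕ : ∀ {f g} → NonNeg₊ f → NonNeg g → NonNeg₊ (f ⊕ g)
  NonNeg₊-⊕ p q = nonNeg₊ (NonNeg-⊕ (nn p) q) (ℤP.+-mono-<-≤ (0<₀ p) (0≤ q 0))

  AllPos-⊕ : ∀ {f g} → AllPos f → NonNeg g → AllPos (f ⊕ g)
  AllPos-⊕ p q = allPos λ n → ℤP.+-mono-<-≤ (0< p n) (0≤ q n)

  NonNeg-· : ∀ {f g} → NonNeg f → NonNeg g → NonNeg (f · g)
  NonNeg-· p q = nonNeg λ n → sum-nonneg n λ i _ → *-nonneg (0≤ p i) (0≤ q (n ∸ i))

  NonNeg₊-· : ∀ {f g} → NonNeg₊ f → NonNeg₊ g → NonNeg₊ (f · g)
  NonNeg₊-· p q = nonNeg₊ (NonNeg-· (nn p) (nn q)) (*-pos (0<₀ p) (0<₀ q))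

  ·-pos-from : ∀ {f g} j n → NonNeg f → 0ℤ ℤ.< f j → AllPos g → j ≤ n → 0ℤ ℤ.< (f · g) n
  ·-pos-from j n p fj q j≤n = sum-pos n (λ i _ → *-nonneg (0≤ p i) (ℤP.<⇒≤ (0< q (n ∸ i)))) j j≤n (*-pos fj (0< q (n ∸ j)))

AllPos-· : ∀ {f g} → NonNeg₊ f → AllPos g → AllPos (f · g)
AllPos-· p q = allPos λ n → ·-pos-from 0 n (nn p) (0<₀ p) q z≤n

NonNeg-κ : ∀ n → NonNeg (κ (+ n))
NonNeg-κ n = nonNeg λ { zero → subst (0ℤ ℤ.≤_) (sym (κ-at0 (+ n))) (ℤ.+≤+ z≤n) ; (suc m) → ℤP.≤-reflexive (sym (κ-atsuc (+ n) m)) }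

NonNeg₊-κ : ∀ n → NonNeg₊ (κ (+ suc n))
NonNeg₊-κ n = nonNeg₊ (NonNeg-κ (suc n)) (subst Pos (sym (κ-at0 (+ suc n))) (ℤ.+<+ (s≤s z≤n)))

NonNeg-X : ∀ k → NonNeg (X k)
NonNeg-X k = nonNeg go
  where
  go : ∀ n → 0ℤ ℤ.≤ X k n
  go n with k ℕ.≟ n
  ... | yes refl = subst (0ℤ ℤ.≤_) (sym (X-diag k)) (ℤ.+≤+ z≤n)
  ... | no ne    = ℤP.≤-reflexive (sym (X-off ne))

NonNeg₊-gm : ∀ j → NonNeg₊ (gm j)
NonNeg₊-gm j = nonNeg₊ (nonNeg λ n → go n (j ∣? n)) (subst Pos (sym (gm-yes (j ∣0))) (ℤ.+<+ (s≤s z≤n)))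
  where
  go : ∀ n → Dec (j ∣ n) → 0ℤ ℤ.≤ gm j n
  go n (yes d) = subst (0ℤ ℤ.≤_) (sym (gm-yes d)) (ℤ.+≤+ z≤n)
  go n (no ¬d) = ℤP.≤-reflexive (sym (gm-no ¬d))

AllPos-gm1 : AllPos (gm 1)
AllPos-gm1 = allPos λ n → subst Pos (sym (gm-yes (divides n (sym (ℕP.*-identityʳ n))))) (ℤ.+<+ (s≤s z≤n))

NonNeg₊-∏ : ∀ {F} → (∀ n → NonNeg₊ (F n)) → ∀ N → NonNeg₊ (∏ F N)
NonNeg₊-∏ p zero    = NonNeg₊-κ 0
NonNeg₊-∏ p (suc N) = NonNeg₊-· (NonNeg₊-∏ p N) (p N)

NonNeg₊-Lim : ∀ {F} → (∀ n → NonNeg₊ (F n)) → NonNeg₊ (Lim F)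
NonNeg₊-Lim p = nonNeg₊ (nonNeg λ n → 0≤ (nn (NonNeg₊-∏ p n)) n) (0<₀ (NonNeg₊-∏ p 0))

NonNeg-∑ : ∀ {h} → (∀ n → NonNeg (h n)) → ∀ N → NonNeg (∑ h N)
NonNeg-∑ p zero    = NonNeg-κ 0
NonNeg-∑ p (suc N) = NonNeg-⊕ (NonNeg-∑ p N) (p N)

NonNeg-os : ∀ u b a → NonNeg (os 1ℤ (+ u) 0ℤ b a)
NonNeg-os u b a = nonNeg λ n → 0≤ (NonNeg-∑ (λ j → NonNeg-· (coef j) (NonNeg-X _)) (suc (suc n))) n
  where
  coef : ∀ j → NonNeg (κ (1ℤ ℤ.^ j *ᶻ (+ u +ᶻ 0ℤ *ᶻ + j)))
  coef j = NonNeg-resp (≈-cong κ (sym (cong₂ _*ᶻ_ (ℤP.^-zeroˡ j) (ℤP.+-identityʳ (+ u)) ∙ ℤP.*-identityˡ (+ u)))) (NonNeg-κ u)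

-- The products (q^a;q^k)_∞ and their inverses

O J : ℕ → ℕ → PS
O k a = Lim λ n → om (a + k * n)
J k a = Lim λ n → gm (a + k * n)

private
  index≤ : ∀ k a n → suc n ≤ suc a + suc k * n
  index≤ k a n = s≤s (≤-trans (ℕP.m≤n*m n (suc k)) (m≤n+m _ a))

O-conv : ∀ k a → Convergent λ n → om (suc a + suc k * n)
O-conv k a = convergent λ n → om-low _ (index≤ k a n)

J-conv : ∀ k a → Convergent λ n → gm (suc a + suc k * n)
J-conv k a = convergent λ n → gm-low (a + suc k * n) (index≤ k a n)

O·J : ∀ k a → O (suc k) (suc a) · J (suc k) (suc a) ≈ 𝟙
O·J k a = Lim-· (O-conv k a) (J-conv k a) ⨾ (Lim-cong λ n → om·gm (a + suc k * n)) ⨾ Lim-𝟙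

NonNeg₊-J : ∀ k a → NonNeg₊ (J k a)
NonNeg₊-J k a = NonNeg₊-Lim λ n → NonNeg₊-gm _

J-head : ∀ k a → J (suc k) (suc a) ≈ gm (suc a) · J (suc k) (suc a + suc k)
J-head k a = Lim-head (J-conv k a) ⨾ ·-cong
  (≈-cong gm (cong (_+_ (suc a)) (ℕP.*-zeroʳ (suc k)) ∙ ℕP.+-identityʳ _))
  (Lim-cong λ n → ≈-cong gm (arith a k n))
  where
  arith : ∀ a k n → suc a + suc k * suc n ≡ suc a + suc k + suc k * n
  arith = solve-∀

E≈O : ∀ k → E k ≈ O k k
E≈O k = Lim-cong λ n → ≈-cong om (ℕP.*-suc k n)

∏-conv : ∀ {G : ℕ → ℕ → PS} → (∀ r → Convergent (G r)) → ∀ k → Convergent (λ n → ∏ (λ r → G r n) k)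
∏-conv c k = convergent λ n → ∏≈𝟙 k λ r → tail≈𝟙 (c r) n

Lim-∏-swap : ∀ {G : ℕ → ℕ → PS} → (∀ r → Convergent (G r)) → ∀ k → Lim (λ n → ∏ (λ r → G r n) k) ≈ ∏ (λ r → Lim (G r)) k
Lim-∏-swap c zero    = Lim-𝟙
Lim-∏-swap c (suc k) = ≈-sym (Lim-· (∏-conv c k) (c k)) ⨾ ·-congˡ (Lim-∏-swap c k)

Lim-residues : ∀ k {F} → Convergent F → Lim F ≈ ∏ (λ r → Lim (λ n → F (r + n * suc k))) (suc k)
Lim-residues k {F} c = Lim-block k c ⨾ Lim-∏-swap (λ r → convergent λ n →
  mod-mono (s≤s (≤-trans (m≤m*n n (suc k)) (m≤n+m _ r))) (tail≈𝟙 c (r + n * suc k))) (suc k)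

private
  residue-index : ∀ m k r n → suc m * suc (r + n * suc k) ≡ suc m * suc r + suc m * suc k * n
  residue-index = solve-∀

E-residues : ∀ m k → E (suc m) ≈ ∏ (λ r → O (suc m * suc k) (suc m * suc r)) (suc k)
E-residues m k = Lim-residues k (E-conv m) ⨾
  ∏-cong (suc k) λ r → Lim-cong λ n → ≈-cong om (residue-index m k r n)

I-residues : ∀ m k → I (suc m) ≈ ∏ (λ r → J (suc m * suc k) (suc m * suc r)) (suc k)
I-residues m k = Lim-residues k (I-conv m) ⨾
  ∏-cong (suc k) λ r → Lim-cong λ n → ≈-cong gm (residue-index m k r n)

I1-residues : ∀ k → I 1 ≈ ∏ (λ r → J (suc k) (suc r)) (suc k)
I1-residues k = I-residues 0 k ⨾ ∏-cong (suc k) λ r → ≈-reflexive (cong₂ J (ℕP.*-identityˡ (suc k)) (ℕP.*-identityˡ (suc r)))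

E1-residues : ∀ k → E 1 ≈ ∏ (λ r → O (suc k) (suc r)) (suc k)
E1-residues k = E-residues 0 k ⨾ ∏-cong (suc k) λ r → ≈-reflexive (cong₂ O (ℕP.*-identityˡ (suc k)) (ℕP.*-identityˡ (suc r)))

-- Replacing a cancelled factor by 1 keeps the remaining denominators an indexed product, so their
-- positivity is still proved uniformly.
omit : ℕ → (ℕ → PS) → ℕ → PS
omit r F i with i ℕ.≟ r
... | yes _ = 𝟙
... | no _  = F i

omit-self : ∀ r F → omit r F r ≈ 𝟙
omit-self r F with r ℕ.≟ r
... | yes _ = ≈-refl
... | no ne = ⊥-elim (ne refl)

omit-other : ∀ {r i} F → i ≢ r → omit r F i ≈ F i
omit-other {r} {i} F ne with i ℕ.≟ r
... | yes e = ⊥-elim (ne e)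
... | no _  = ≈-refl

NonNeg₊-omit : ∀ r {F} → (∀ n → NonNeg₊ (F n)) → ∀ n → NonNeg₊ (omit r F n)
NonNeg₊-omit r p n with n ℕ.≟ r
... | yes _ = NonNeg₊-κ 0
... | no _  = p n

∏-congᵇ : ∀ {F G} N → (∀ n → n < N → F n ≈ G n) → ∏ F N ≈ ∏ G N
∏-congᵇ zero    e = ≈-refl
∏-congᵇ (suc N) e = ·-cong (∏-congᵇ N λ n p → e n (m≤n⇒m≤1+n p)) (e N ≤-refl)

∏-omit : ∀ {r} F N → r < N → ∏ F N ≈ F r · ∏ (omit r F) N
∏-omit {r} F (suc N) (s≤s r≤N) with ℕP.m≤n⇒m<n∨m≡n r≤N
... | inj₁ r<N  = ·-cong (∏-omit F N r<N) (≈-sym (omit-other F (ℕP.>⇒≢ r<N))) ⨾ ·-assoc _ _ _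
... | inj₂ refl = ·-congˡ (∏-congᵇ N λ n p → ≈-sym (omit-other F (ℕP.<⇒≢ p))) ⨾
  solve 2 (λ p f → p :* f := f :* (p :* :1)) ≈-refl (∏ (omit r F) N) (F r) ⨾
    ·-congʳ (·-congʳ (≈-sym (omit-self r F)))

-- The factor 1/(1 - q) has all coefficients 1; the other factors are nonnegative with positive
-- constant term.
AllPos-I1 : AllPos (I 1)
AllPos-I1 = AllPos-resp (≈-sym (Lim-head (I-conv 0) ⨾ ·-comm _ _))
  (AllPos-· (NonNeg₊-Lim λ n → NonNeg₊-gm _) AllPos-gm1)

-- Theta functions as products

private
  -1² : -1ℤ *ᶻ -1ℤ ≡ 1ℤ
  -1² = refl

  functional₁ : ∀ f g → functional 1ℤ 0ℤ (f , g) ≈ f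
  functional₁ = solve 2 (λ f g → :1 :* f :+ :0 :* g := f) ≈-refl

  proj₁-∏ : ∀ F N → proj₁ (D.∏ᴿ F N) ≈ ∏ (λ n → proj₁ (F n)) N
  proj₁-∏ F zero    = ≈-refl
  proj₁-∏ F (suc N) = ·-congˡ (proj₁-∏ F N)

triple-product₁ : ∀ s b a a′ → s *ᶻ s ≡ 1ℤ → a + a′ ≡ suc b → ∀ N →
  E (suc b) · (∏ (λ n → 𝟙 ⊕ κ s · X (a + suc b * n)) (suc N) · ∏ (λ n → 𝟙 ⊕ κ s · X (a′ + suc b * n)) (suc N))
    ≈⟨ N ⟩ th s 1ℤ 0ℤ (suc b) a a′
triple-product₁ s b a a′ s² a+a′ N = mod-trans
  (≈⇒mod (·-congʳ (≈-sym (functional₁ _ _ ⨾ ·-cong (proj₁-∏ _ (suc N)) (proj₁-∏ _ (suc N))))))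
  (TripleProduct.triple-product s 1ℤ 0ℤ b a a′ s² a+a′ N)

κ·X-low : ∀ s {n} j → n ≤ j → 𝟙 ⊕ κ s · X j ≈⟨ n ⟩ 𝟙
κ·X-low s j p = ⊕-cong⟨⟩ʳ (κX-0⟨⟩ s j p) ⨾⟨⟩ ≈⇒mod (⊕-idʳ 𝟙)

op-conv : ∀ s k a → Convergent λ n → 𝟙 ⊕ κ s · X (suc a + suc k * n)
op-conv s k a = convergent λ n → κ·X-low s _ (s≤s (≤-trans (ℕP.m≤n*m n (suc k)) (m≤n+m _ a)))

triple-product∞ : ∀ s b a a′ → s *ᶻ s ≡ 1ℤ → suc a + suc a′ ≡ suc b →
  E (suc b) · (Lim (λ n → 𝟙 ⊕ κ s · X (suc a + suc b * n)) · Lim (λ n → 𝟙 ⊕ κ s · X (suc a′ + suc b * n)))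
    ≈ th s 1ℤ 0ℤ (suc b) (suc a) (suc a′)
triple-product∞ s b a a′ s² a+a′ = mod⇒≈ λ N → mod-trans
  (·-cong⟨⟩ʳ (·-cong⟨⟩ (lim a N) (lim a′ N)))
  (triple-product₁ s b (suc a) (suc a′) s² a+a′ N)
  where
  lim : ∀ c N → Lim (λ n → 𝟙 ⊕ κ s · X (suc c + suc b * n)) ≈⟨ N ⟩ ∏ (λ n → 𝟙 ⊕ κ s · X (suc c + suc b * n)) (suc N)
  lim c N = mod-mono (m≤n+m N 2) (Lim-∏ (op-conv s b c) (suc N))

neg-om : ∀ j → 𝟙 ⊕ κ -1ℤ · X j ≈ om j
neg-om j = solve 1 (λ x → :1 :+ con -1ℤ :* x := :1 :- x) ≈-refl (X j)

Θ : ℕ → ℕ → ℕ → PS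
Θ = th -1ℤ 1ℤ 0ℤ

Θ-product : ∀ b a a′ → suc a + suc a′ ≡ suc b → E (suc b) · (O (suc b) (suc a) · O (suc b) (suc a′)) ≈ Θ (suc b) (suc a) (suc a′)
Θ-product b a a′ e = ·-congʳ (·-cong (Lim-cong λ n → ≈-sym (neg-om _)) (Lim-cong λ n → ≈-sym (neg-om _))) ⨾
  triple-product∞ -1ℤ b a a′ -1² e

-- By the triple product the numerator consists of three residue classes modulo b + 1. As a ≢ a′
-- they are distinct, so each cancels against its own class in one copy of 1/(q;q)_∞.
Θ/E1-NonNeg₊ : ∀ b a a′ → suc a + suc a′ ≡ suc b → a ≢ a′ → NonNeg₊ (Θ (suc b) (suc a) (suc a′) · I 1)
Θ/E1-NonNeg₊ b a a′ e a≢a′ = NonNeg₊-resp (≈-sym eq) (NonNeg₊-∏ (NonNeg₊-omit a′ (NonNeg₊-omit a (NonNeg₊-omit b λ r → NonNeg₊-J β (suc r)))) β)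
  where
  β = suc b
  F₀ F₁ F₂ : ℕ → PS
  F₀ r = J β (suc r)
  F₁ = omit b F₀
  F₂ = omit a F₁
  a<b : a < b
  a<b = ≤-trans (s≤s (m≤m+n a a′)) (≤-reflexive (sym (ℕP.+-suc a a′) ∙ ℕP.suc-injective e))
  a′<b : a′ < b
  a′<b = ≤-trans (m≤n+m (suc a′) a) (≤-reflexive (ℕP.suc-injective e))
  eq : Θ β (suc a) (suc a′) · I 1 ≈ ∏ (omit a′ F₂) β
  eq = ·-cong (≈-sym (Θ-product b a a′ e)) (I1-residues b ⨾
        ∏-omit {b} F₀ β ≤-refl ⨾ ·-congʳ (∏-omit {a} F₁ β (m≤n⇒m≤1+n a<b) ⨾ ·-cong (omit-other F₀ (ℕP.<⇒≢ a<b))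
            (∏-omit {a′} F₂ β (m≤n⇒m≤1+n a′<b) ⨾ ·-congˡ (omit-other F₁ (a≢a′ ∘ sym) ⨾ omit-other F₀ (ℕP.<⇒≢ a′<b))))) ⨾
    ·-congˡ (·-congˡ (E≈O β)) ⨾
    solve 7 (λ e o o′ i j j′ r → e :* (o :* o′) :* (i :* (j :* (j′ :* r))) := (e :* i) :* ((o :* j) :* ((o′ :* j′) :* r))) ≈-refl
        (O β β) (O β (suc a)) (O β (suc a′)) (J β β) (J β (suc a)) (J β (suc a′)) (∏ (omit a′ F₂) β) ⨾
      ·-cong (O·J b b) (·-cong (O·J b a) (·-congˡ (O·J b a′))) ⨾
        solve 1 (λ r → :1 :* (:1 :* (:1 :* r)) := r) ≈-refl _

E1-two : E 1 ≈ O 2 1 · E 2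
E1-two = E1-residues 1 ⨾ ·-cong (·-idˡ _) (≈-sym (E≈O 2))

E2-two : E 2 ≈ O 4 2 · E 4
E2-two = E-residues 1 1 ⨾ ·-cong (·-idˡ _) (≈-sym (E≈O 4))

φ⁻-product : Θ 2 1 1 · E 2 ≈ E 1 · E 1
φ⁻-product = ·-congˡ (≈-sym (Θ-product 1 0 0 refl)) ⨾
  solve 2 (λ e o → e :* (o :* o) :* e := (o :* e) :* (o :* e)) ≈-refl (E 2) (O 2 1) ⨾
    ≈-sym (·-cong E1-two E1-two)

-- The product with plus signs is eliminated by (1 + q^(2n+1))(1 - q^(2n+1)) = 1 - q^(4n+2), so that
-- only the `E k` remain.
φ⁺-product : th 1ℤ 1ℤ 0ℤ 2 1 1 · (E 1 · E 1) · (E 4 · E 4) ≈ E 2 · E 2 · E 2 · E 2 · E 2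
φ⁺-product = ·-congˡ (·-cong (≈-sym (triple-product∞ 1ℤ 1 0 0 refl refl)) (·-cong E1-two E1-two)) ⨾
  solve 4 (λ e p o f → e :* (p :* p) :* ((o :* e) :* (o :* e)) :* (f :* f) := e :* ((p :* o) :* f) :* ((p :* o) :* f) :* e :* e) ≈-refl (E 2) P⁺ (O 2 1) (E 4) ⨾
    ·-congˡ (·-congˡ (·-cong (·-congʳ step) step))
  where
  P⁺ = Lim (λ n → 𝟙 ⊕ κ 1ℤ · X (1 + 2 * n))
  double : ∀ n → (𝟙 ⊕ κ 1ℤ · X (1 + 2 * n)) · om (1 + 2 * n) ≈ om (2 + 4 * n)
  double n = solve 1 (λ x → (:1 :+ :1 :* x) :* (:1 :- x) := :1 :- (x :* x)) ≈-refl (X (1 + 2 * n)) ⨾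
    ⊕-congʳ (⊖-cong (≈-sym (X-+ (1 + 2 * n) (1 + 2 * n)) ⨾ ≈-cong X (arith n)))
    where
    arith : ∀ n → (1 + 2 * n) + (1 + 2 * n) ≡ 2 + 4 * n
    arith = solve-∀
  step : P⁺ · O 2 1 · E 4 ≈ E 2
  step = ·-congˡ (Lim-· (op-conv 1ℤ 1 0) (O-conv 1 0) ⨾ Lim-cong double) ⨾ ≈-sym E2-two

Θ-swap-product : ∀ b a a′ → suc a + suc a′ ≡ suc b → E (suc b) · (O (suc b) (suc a′) · O (suc b) (suc a)) ≈ Θ (suc b) (suc a) (suc a′)
Θ-swap-product b a a′ e = ·-congʳ (·-comm _ _) ⨾ Θ-product b a a′ e

-- Euler's pentagonal number theorem: the three residue classes modulo 3 make up the whole of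
-- (q;q)_∞.
pentagonal : Θ 3 1 2 ≈ E 1
pentagonal = ≈-sym (Θ-product 2 0 1 refl) ⨾ ≈-sym (E1-residues 2 ⨾ ·-congʳ (≈-sym (E≈O 3)) ⨾
  solve 3 (λ o o′ e → :1 :* o :* o′ :* e := e :* (o :* o′)) ≈-refl (O 3 1) (O 3 2) (E 3))

pentagonal′ : Θ 3 2 1 ≈ E 1
pentagonal′ = ≈-sym (Θ-swap-product 2 1 0 refl) ⨾ Θ-product 2 0 1 refl ⨾ pentagonal

κ-cancel : ∀ c {f g} → κ (+ suc c) · f ≈ κ (+ suc c) · g → f ≈ g
κ-cancel c {f} {g} e = ptwise λ n → ℤP.*-cancelˡ-≡ (+ suc c) (f n) (g n) (sym (κ·-at (+ suc c) f n) ∙ at e n ∙ κ·-at (+ suc c) g n)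

ψ : PS
ψ = θ⁺ 1 1

-- The two-sided series with a = 0 takes every triangular exponent twice, and its product contains
-- the factor 1 + q^0 = 2; both sides are halved by `κ-cancel`. What is left is (1 + q^n)(1 - q^n) =
-- 1 - q^(2n).
ψ-product : ψ · E 1 ≈ E 2 · E 2
ψ-product = κ-cancel 1 (solve 2 (λ p e → con (+ 2) :* (p :* e) := con (+ 2) :* p :* e) ≈-refl ψ (E 1) ⨾
  ·-congˡ (≈-sym two-ψ ⨾ ≈-sym product) ⨾
    solve 2 (λ e a → e :* (con (+ 2) :* (a :* a)) :* e := con (+ 2) :* ((a :* e) :* (a :* e))) ≈-refl (E 1) A ⨾
      ·-congʳ (·-cong A·E1 A·E1))
  where
  a : ℕ → ℕ → PS
  a c n = 𝟙 ⊕ κ 1ℤ · X (c + 1 * n)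
  A = Lim (a 1)
  two-ψ : th 1ℤ 1ℤ 0ℤ 1 0 1 ≈ κ (+ 2) · ψ
  two-ψ = ⊕-congˡ (os-head 1ℤ 1ℤ 0ℤ 0 0 ⨾ ⊕-congʳ (·-congˡ (·-congʳ X0))) ⨾
    solve 3 (λ x p r → (:1 :+ :1 :* :1 :* p) :+ :1 :* x :* r := (:1 :+ :1 :* x :* r) :+ p) ≈-refl (X 1) ψ (θ⁺ 1 2) ⨾
      ⊕-congˡ (≈-sym (os-head 1ℤ 1ℤ 0ℤ 0 1)) ⨾ solve 1 (λ p → p :+ p := con (+ 2) :* p) ≈-refl ψ
  product : E 1 · (κ (+ 2) · (A · A)) ≈ th 1ℤ 1ℤ 0ℤ 1 0 1
  product = mod⇒≈ λ N → mod-trans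
    (·-cong⟨⟩ʳ (mod-trans
      (·-cong⟨⟩ʳ (·-cong⟨⟩ (mod-mono (n≤1+n N) (Lim-∏ (op-conv 1ℤ 0 0) N)) (mod-mono (m≤n+m N 2) (Lim-∏ (op-conv 1ℤ 0 0) (suc N)))))
      (≈⇒mod (≈-sym (·-assoc _ _ _) ⨾ ·-congˡ (≈-sym (head N))))))
    (triple-product₁ 1ℤ 0 0 1 refl refl N)
    where
    head : ∀ N → ∏ (a 0) (suc N) ≈ κ (+ 2) · ∏ (a 1) N
    head N = ∏-head (a 0) N ⨾ ·-congˡ (⊕-congʳ (·-idˡ _ ⨾ X0) ⨾ ≈-sym (κ-+ 1ℤ 1ℤ))
  A·E1 : A · E 1 ≈ E 2
  A·E1 = Lim-· (op-conv 1ℤ 0 0) (E-conv 0) ⨾ Lim-cong λ n → ≈-trans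
    (·-congˡ (⊕-congʳ (·-congʳ (≈-cong X (arith n)))))
    (solve 1 (λ x → (:1 :+ :1 :* x) :* (:1 :- x) := :1 :- (x :* x)) ≈-refl (X (1 * suc n)) ⨾
      ⊕-congʳ (⊖-cong (≈-sym (X-+ (1 * suc n) (1 * suc n)) ⨾ ≈-cong X (arith′ n))))
    where
    arith : ∀ n → 1 + 1 * n ≡ 1 * suc n
    arith = solve-∀
    arith′ : ∀ n → 1 * suc n + 1 * suc n ≡ 2 * suc n
    arith′ = solve-∀

-- The triple product with weight m, s = -1 and a = 0. On the product side the factor 1 - z is -ε,
-- so the ε-part is minus the product of the other factors at ε = 0. On the series side m = j + 1
-- and m = -j share the exponent j(j+1)/2, and their signed weights add up to -(-1)^j (2j + 1).
jacobi : os -1ℤ 1ℤ (+ 2) 1 1 ≈ E 1 · E 1 · E 1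
jacobi = ≈-sym neg-th ⨾ ⊖-cong th≈ ⨾ solve 1 (λ e → :- (:- e) := e) ≈-refl _
  where
  module TP = TripleProduct -1ℤ 0ℤ 1ℤ 0 0 1 refl refl
  e : ℕ → PS
  e = ∏ λ n → om (1 * suc n)
  A B : ℕ → D.Carrier
  A N = D.∏ᴿ (TP.factor 1ℤ 0 ∘ suc) N
  B N = D.∏ᴿ (TP.factor -1ℤ 1) (suc N)
  A₁ : ∀ N → proj₁ (A N) ≈ e N
  A₁ N = proj₁-∏ _ N ⨾ ∏-cong N λ n → neg-om _
  B₁ : ∀ N → proj₁ (B N) ≈ e (suc N)
  B₁ N = proj₁-∏ _ (suc N) ⨾ ∏-cong (suc N) λ n → ≈-trans (neg-om _) (≈-cong om (arith n))
    where
    arith : ∀ n → 1 + 1 * n ≡ 1 * suc n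
    arith = solve-∀
  first : TP.factor 1ℤ 0 0 D.≈ (κ 0ℤ , κ -1ℤ)
  first = ⊕-congʳ (·-congʳ X0) ⨾ solve 0 (:1 :+ con -1ℤ :* :1 := :0) ≈-refl
        , ≈-trans (·-congʳ X0) (·-idʳ _)
  value : ∀ N → functional 0ℤ 1ℤ (TP.partialProduct (suc N)) ≈ ⊖ (e N · e (suc N))
  value N = solve 2 (λ f g → :0 :* f :+ :1 :* g := g) ≈-refl _ _ ⨾
    proj₂ (D.*-cong (D.trans (D.∏ᴿ-head (TP.factor 1ℤ 0) N) (D.*-cong first (D.refl {A N}))) (D.refl {B N})) ⨾
      solve 4 (λ a a′ b b′ → (:0 :* a) :* b′ :+ (:0 :* a′ :+ con -1ℤ :* a) :* b := :- (a :* b)) ≈-refl (proj₁ (A N)) (proj₂ (A N)) (proj₁ (B N)) (proj₂ (B N)) ⨾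
        ⊖-cong (·-cong (A₁ N) (B₁ N))
  th≈ : th -1ℤ 0ℤ 1ℤ 1 0 1 ≈ ⊖ (E 1 · E 1 · E 1)
  th≈ = mod⇒≈ λ N → mod-trans (mod-sym (TP.triple-product N)) (≈⇒mod (·-congʳ (value N)) ⨾⟨⟩
    ·-cong⟨⟩ʳ (⊖-cong⟨⟩ (mod-sym (·-cong⟨⟩ (mod-mono (n≤1+n N) (Lim-∏ (E-conv 0) N)) (mod-mono (m≤n+m N 2) (Lim-∏ (E-conv 0) (suc N)))))) ⨾⟨⟩
      ≈⇒mod (solve 1 (λ e → e :* (:- (e :* e)) := :- (e :* e :* e)) ≈-refl (E 1)))
  neg-th : ⊖ th -1ℤ 0ℤ 1ℤ 1 0 1 ≈ os -1ℤ 1ℤ (+ 2) 1 1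
  neg-th = ⊖-cong (⊕-cong (os-head -1ℤ 0ℤ 1ℤ 0 0 ⨾ ⊕-congʳ (·-congˡ (·-congʳ X0)))
      (·-congʳ (os-scale -1ℤ -1ℤ 1ℤ 1ℤ 0 2))) ⨾
    solve 3 (λ x f g → :- ((:0 :+ con -1ℤ :* :1 :* f) :+ con -1ℤ :* x :* (con -1ℤ :* g)) := f :+ (:0 :+ con -1ℤ :* x :* g)) ≈-refl
        (X 1) (os -1ℤ 1ℤ 1ℤ 1 1) (os -1ℤ 1ℤ 1ℤ 1 2) ⨾
      ⊕-congʳ (≈-sym (os-head -1ℤ 0ℤ 1ℤ 0 1)) ⨾ ≈-sym (os-⊕ -1ℤ 1ℤ 1ℤ 0ℤ 1ℤ 1 1)

dil-th : ∀ k s u v b a a′ → dil (suc k) (th s u v (suc b) a a′) ≈ th s u v (suc b * suc k) (a * suc k) (a′ * suc k)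
dil-th k s u v b a a′ = dil-⊕ k _ _ ⨾ ⊕-cong (dil-os k s u v b a)
  (dil-cong k (·-assoc _ _ _) ⨾ dil-κ· k s _ ⨾ ·-congʳ (dil-X· k a′ _) ⨾
    ≈-sym (·-assoc _ _ _) ⨾ ·-congʳ (dil-os k s (u +ᶻ ℤ.- v) (ℤ.- v) b (suc b + a′) ⨾
      ≈-cong (os s (u +ᶻ ℤ.- v) (ℤ.- v) (suc b * suc k)) (ℕP.*-distribʳ-+ (suc k) (suc b) a′)))

open Exp (CommutativeRing.semiring psRing) using () renaming (_^_ to _↑_)

-- Dissections of theta functions

-- Monomials become powers of a single variable, so that the ring solver does the bookkeeping of
-- exponents in the dissections.
X≈↑ : ∀ n → X n ≈ X 1 ↑ n
X≈↑ zero    = X0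
X≈↑ (suc n) = X-+ 1 n ⨾ ·-congʳ (X≈↑ n)

os-dissect : ∀ s u v b a k → os s u v (suc b) a ≈
  ∑ (λ r → κ (s ℤ.^ r) · X 1 ↑ (suc b * T r + a * r) ·
    os (s ℤ.^ suc k) (u +ᶻ v *ᶻ + r) (v *ᶻ + suc k) (suc b * (suc k * suc k)) (a * suc k + suc b * (T (suc k) + suc k * r))) (suc k)
os-dissect s u v b a k = os-residues s u v b a k ⨾
  ∑-cong (suc k) λ r → ·-congˡ (·-congʳ (X≈↑ (suc b * T r + a * r)))

comb-∷ : ∀ {k} r {f f′ rest rest′} → f′ ≈ dil k f → rest ≈ rest′ → X 1 ↑ r · f′ ⊕ rest ≈ X r · dil k f ⊕ rest′
comb-∷ r e d = ⊕-cong (·-cong (≈-sym (X≈↑ r)) e) d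

dil-Θ : ∀ k b a a′ → os -1ℤ 1ℤ 0ℤ (suc b * suc k) (a * suc k) ⊕ κ -1ℤ · X 1 ↑ (a′ * suc k) · os -1ℤ 1ℤ 0ℤ (suc b * suc k) (suc b * suc k + a′ * suc k)
        ≈ dil (suc k) (Θ (suc b) a a′)
dil-Θ k b a a′ = ⊕-congʳ (·-congˡ (·-congʳ (≈-sym (X≈↑ (a′ * suc k))))) ⨾ ≈-sym (dil-th k -1ℤ 1ℤ 0ℤ b a a′)

private
  θ : ℕ → ℕ → PS
  θ = os -1ℤ 1ℤ 0ℤ

  dil-neg : ∀ k {f f′} → f′ ≈ dil (suc k) f → κ -1ℤ · f′ ≈ dil (suc k) (κ -1ℤ · f)
  dil-neg k {f} e = ·-congʳ e ⨾ ≈-sym (dil-κ· k -1ℤ f)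

-- Squares are 0 or 1 modulo 3. The indices m ≡ 1 and m ≡ 2 are exchanged by m ↦ -m, whence the
-- coefficient 2.
φ⁻-mod3 : Θ 2 1 1 ≈ comb 3 0 (Θ 6 3 3 ∷ κ (ℤ.- (+ 2)) · Θ 6 5 1 ∷ [])
φ⁻-mod3 = ⊕-cong (os-dissect -1ℤ 1ℤ 0ℤ 1 1 2) (·-cong (·-congʳ (X≈↑ 1)) (os-dissect -1ℤ 1ℤ 0ℤ 1 3 2)) ⨾
  solve 5 (λ x θ₉ θ₁₅ θ₂₁ θ₂₇ →
      (:0 :+ :1 :* x :^ 0 :* θ₉ :+ con -1ℤ :* x :^ 1 :* θ₁₅ :+ :1 :* x :^ 4 :* θ₂₁)
        :+ con -1ℤ :* x :^ 1 :* (:0 :+ :1 :* x :^ 0 :* θ₁₅ :+ con -1ℤ :* x :^ 3 :* θ₂₁ :+ :1 :* x :^ 8 :* θ₂₇)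
      := x :^ 0 :* (θ₉ :+ con -1ℤ :* x :^ 9 :* θ₂₇)
        :+ (x :^ 1 :* (con (ℤ.- (+ 2)) :* (θ₁₅ :+ con -1ℤ :* x :^ 3 :* θ₂₁)) :+ :0)) ≈-refl
      (X 1) (θ 18 9) (θ 18 15) (θ 18 21) (θ 18 27) ⨾
    comb-∷ 0 (dil-Θ 2 5 3 3) (comb-∷ 1 (·-congʳ (dil-Θ 2 5 5 1) ⨾ ≈-sym (dil-κ· 2 (ℤ.- (+ 2)) (Θ 6 5 1))) ≈-refl)

-- Each residue class of the index in the half m ≥ 0 joins a class of the half m < 0 to form a
-- two-sided series. For exponents 2 modulo 3 the halves change roles.
euler-mod3 : E 1 ≈ comb 3 0 (Θ 9 4 5 ∷ κ -1ℤ · Θ 9 7 2 ∷ κ -1ℤ · Θ 9 8 1 ∷ [])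
euler-mod3 = ≈-sym pentagonal ⨾ ≈-trans
  (⊕-cong (os-dissect -1ℤ 1ℤ 0ℤ 2 1 2) (·-cong (·-congʳ (X≈↑ 2)) (os-dissect -1ℤ 1ℤ 0ℤ 2 5 2)))
  (solve 7 (λ x a b c a′ b′ c′ →
      (:0 :+ :1 :* x :^ 0 :* a :+ con -1ℤ :* x :^ 1 :* b :+ :1 :* x :^ 5 :* c)
        :+ con -1ℤ :* x :^ 2 :* (:0 :+ :1 :* x :^ 0 :* a′ :+ con -1ℤ :* x :^ 5 :* b′ :+ :1 :* x :^ 13 :* c′)
      := x :^ 0 :* (a :+ con -1ℤ :* x :^ 15 :* c′)
        :+ (x :^ 1 :* (con -1ℤ :* (b :+ con -1ℤ :* x :^ 6 :* b′))
        :+ (x :^ 2 :* (con -1ℤ :* (a′ :+ con -1ℤ :* x :^ 3 :* c)) :+ :0))) ≈-refl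
      (X 1) (θ 27 12) (θ 27 21) (θ 27 30) (θ 27 24) (θ 27 33) (θ 27 42) ⨾
    comb-∷ 0 (dil-Θ 2 8 4 5) (comb-∷ 1 (dil-neg 2 (dil-Θ 2 8 7 2)) (comb-∷ 2 (dil-neg 2 (dil-Θ 2 8 8 1)) ≈-refl)))

-- The outer classes of (q;q)_∞ modulo 5, the second up to sign. Classically they are `E 5` divided
-- by, respectively multiplied by, the Rogers-Ramanujan continued fraction without its factor
-- q^(1/5).
A₅ Z₅ : PS
A₅ = Θ 15 7 8 ⊕ X 1 · Θ 15 13 2
Z₅ = Θ 15 11 4 ⊕ κ -1ℤ · (X 1 · Θ 15 14 1)

euler-mod5 : E 1 ≈ comb 5 0 (A₅ ∷ κ -1ℤ · E 5 ∷ κ -1ℤ · Z₅ ∷ [])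
euler-mod5 = ≈-sym pentagonal ⨾ ≈-trans
  (⊕-cong (os-dissect -1ℤ 1ℤ 0ℤ 2 1 4) (·-cong (·-congʳ (X≈↑ 2)) (os-dissect -1ℤ 1ℤ 0ℤ 2 5 4)))
  (solve 11 (λ x a b c d e a′ b′ c′ d′ e′ →
      (:0 :+ :1 :* x :^ 0 :* a :+ con -1ℤ :* x :^ 1 :* b :+ :1 :* x :^ 5 :* c :+ con -1ℤ :* x :^ 12 :* d :+ :1 :* x :^ 22 :* e)
        :+ con -1ℤ :* x :^ 2 :* (:0 :+ :1 :* x :^ 0 :* a′ :+ con -1ℤ :* x :^ 5 :* b′ :+ :1 :* x :^ 13 :* c′ :+ con -1ℤ :* x :^ 24 :* d′ :+ :1 :* x :^ 38 :* e′)
      := x :^ 0 :* ((a :+ con -1ℤ :* x :^ 40 :* e′) :+ x :^ 5 :* (c :+ con -1ℤ :* x :^ 10 :* c′))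
        :+ (x :^ 1 :* (con -1ℤ :* (b :+ con -1ℤ :* x :^ 25 :* d′))
        :+ (x :^ 2 :* (con -1ℤ :* ((a′ :+ con -1ℤ :* x :^ 20 :* e) :+ con -1ℤ :* (x :^ 5 :* (b′ :+ con -1ℤ :* x :^ 5 :* d)))) :+ :0))) ≈-refl
      (X 1) (θ 75 35) (θ 75 50) (θ 75 65) (θ 75 80) (θ 75 95) (θ 75 55) (θ 75 70) (θ 75 85) (θ 75 100) (θ 75 115) ⨾
    comb-∷ 0 dilA (comb-∷ 1 (dil-neg 4 dilE) (comb-∷ 2 (dil-neg 4 dilZ) ≈-refl)))
  where
  shifted-Θ : ∀ {f} a a′ → f ≈ dil 5 (Θ 15 a a′) → X 1 ↑ 5 · f ≈ dil 5 (X 1 · Θ 15 a a′)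
  shifted-Θ a a′ e = ·-cong (≈-sym (X≈↑ 5)) e ⨾ ≈-sym (dil-X· 4 1 (Θ 15 a a′))
  dilA : (θ 75 35 ⊕ κ -1ℤ · X 1 ↑ 40 · θ 75 115) ⊕ X 1 ↑ 5 · (θ 75 65 ⊕ κ -1ℤ · X 1 ↑ 10 · θ 75 85) ≈ dil 5 A₅
  dilA = ⊕-cong (dil-Θ 4 14 7 8) (shifted-Θ 13 2 (dil-Θ 4 14 13 2)) ⨾ ≈-sym (dil-⊕ 4 _ _)
  dilE : θ 75 50 ⊕ κ -1ℤ · X 1 ↑ 25 · θ 75 100 ≈ dil 5 (E 5)
  dilE = dil-Θ 4 14 10 5 ⨾ dil-cong 4 (≈-sym (dil-th 4 -1ℤ 1ℤ 0ℤ 2 2 1) ⨾ dil-cong 4 pentagonal′ ⨾ dil-E 4 0)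
  dilZ : (θ 75 55 ⊕ κ -1ℤ · X 1 ↑ 20 · θ 75 95) ⊕ κ -1ℤ · (X 1 ↑ 5 · (θ 75 70 ⊕ κ -1ℤ · X 1 ↑ 5 · θ 75 80)) ≈ dil 5 Z₅
  dilZ = ⊕-cong (dil-Θ 4 14 11 4) (dil-neg 4 (shifted-Θ 14 1 (dil-Θ 4 14 14 1))) ⨾ ≈-sym (dil-⊕ 4 _ _)

-- The parity of m decides: (2u)^2 = 4u^2 and (2u+1)^2 = 4u(u+1) + 1, and the sign s^m survives only
-- for odd m. Odd squares come from m and -m, hence the 2.
φ-mod4 : ∀ s → s *ᶻ s ≡ 1ℤ → th s 1ℤ 0ℤ 2 1 1 ≈ comb 4 0 (th 1ℤ 1ℤ 0ℤ 2 1 1 ∷ κ (s *ᶻ (+ 2)) · θ⁺ 2 2 ∷ [])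
φ-mod4 s s² = ⊕-cong (dissect 1) (·-cong (·-congʳ (X≈↑ 1)) (dissect 3)) ⨾
  solve 5 (λ x s a b c →
      (:0 :+ :1 :* x :^ 0 :* a :+ s :* x :^ 1 :* b) :+ s :* x :^ 1 :* (:0 :+ :1 :* x :^ 0 :* b :+ s :* x :^ 3 :* c)
      := x :^ 0 :* (a :+ (s :* s) :* x :^ 4 :* c) :+ (x :^ 1 :* ((s :* con (+ 2)) :* b) :+ :0)) ≈-refl (X 1) (κ s) (g 8 4) (g 8 8) (g 8 12) ⨾
    comb-∷ 0 (⊕-congʳ (·-congˡ (·-cong (≈-sym (κ-* s s) ⨾ ≈-reflexive (cong κ s²)) (≈-sym (X≈↑ 4)))) ⨾ ≈-sym (dil-th 3 1ℤ 1ℤ 0ℤ 1 1 1))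
      (comb-∷ 1 (·-cong (≈-sym (κ-* s (+ 2))) (≈-sym (dil-os 3 1ℤ 1ℤ 0ℤ 1 2)) ⨾ ≈-sym (dil-κ· 3 (s *ᶻ (+ 2)) (g 2 2))) ≈-refl)
  where
  g : ℕ → ℕ → PS
  g = θ⁺
  s^2 : s ℤ.^ 2 ≡ 1ℤ
  s^2 = cong (s *ᶻ_) (ℤP.*-identityʳ s) ∙ s²
  dissect : ∀ a → os s 1ℤ 0ℤ 2 a ≈ κ 0ℤ ⊕ κ 1ℤ · X 1 ↑ 0 · g 8 (a * 2 + 2) ⊕ κ s · X 1 ↑ a · g 8 (a * 2 + 6)
  dissect a = os-dissect s 1ℤ 0ℤ 1 a 1 ⨾ ⊕-cong (⊕-congʳ (·-cong (·-congʳ (≈-cong (X 1 ↑_) (ℕP.*-zeroʳ a))) (≈-reflexive (cong (λ t → os t 1ℤ 0ℤ 8 (a * 2 + 2)) s^2))))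
    (·-cong (·-cong (≈-cong κ (ℤP.*-identityʳ s)) (≈-cong (X 1 ↑_) (ℕP.*-identityʳ a))) (≈-reflexive (cong (λ t → os t 1ℤ 0ℤ 8 (a * 2 + 6)) s^2)))

-- `P₃` is the sum of (-1)^m (1 + 6m) q^(m(3m+1)/2) over all integers m. It and -3 `C₃` are the
-- classes 0 and 1 of (q;q)_∞^3 modulo 3.
P₃ C₃ : PS
P₃ = th -1ℤ 1ℤ (+ 6) 3 2 1
C₃ = E 3 · E 3 · E 3

C₃-dil : C₃ ≈ dil 3 (os -1ℤ 1ℤ (+ 2) 1 1)
C₃-dil = ≈-sym (dil-cong 2 jacobi ⨾ dil-· 2 _ _ ⨾ ·-cong (dil-· 2 _ _ ⨾ ·-cong (dil-E 2 0) (dil-E 2 0)) (dil-E 2 0))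

-- In Jacobi's series the indices j = 3i + 1 have weight 3(2i + 1) and reproduce the series itself.
-- The weights 6i + 1 and 6i + 5 of the other indices fit together to one two-sided series.
cube-mod3 : E 1 · E 1 · E 1 ≈ comb 3 0 (P₃ ∷ κ (ℤ.- (+ 3)) · C₃ ∷ [])
cube-mod3 = ≈-sym jacobi ⨾ os-dissect -1ℤ 1ℤ (+ 2) 0 1 2 ⨾
  ⊕-congˡ (⊕-congʳ (·-congʳ (os-scale (+ 3) -1ℤ 1ℤ (+ 2) 8 9))) ⨾
  solve 4 (λ x a b c →
      :0 :+ :1 :* x :^ 0 :* a :+ con -1ℤ :* x :^ 1 :* (con (+ 3) :* b) :+ :1 :* x :^ 3 :* c
      := x :^ 0 :* (a :+ con -1ℤ :* x :^ 3 :* (con -1ℤ :* c)) :+ (x :^ 1 :* (con (ℤ.- (+ 3)) :* b) :+ :0)) ≈-refl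
      (X 1) (os -1ℤ 1ℤ (+ 6) 9 6) (os -1ℤ 1ℤ (+ 2) 9 9) (os -1ℤ (+ 5) (+ 6) 9 12) ⨾
    comb-∷ 0 dilP (comb-∷ 1 dilC ≈-refl)
  where
  dilP : os -1ℤ 1ℤ (+ 6) 9 6 ⊕ κ -1ℤ · X 1 ↑ 3 · (κ -1ℤ · os -1ℤ (+ 5) (+ 6) 9 12) ≈ dil 3 P₃
  dilP = ⊕-congʳ (·-cong (·-congʳ (≈-sym (X≈↑ 3))) (≈-sym (os-scale -1ℤ -1ℤ (+ 5) (+ 6) 8 12))) ⨾ ≈-sym (dil-th 2 -1ℤ 1ℤ (+ 6) 2 2 1)
  dilC : κ (ℤ.- (+ 3)) · os -1ℤ 1ℤ (+ 2) 9 9 ≈ dil 3 (κ (ℤ.- (+ 3)) · C₃)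
  dilC = ·-congʳ (≈-sym (dil-cong 2 (C₃-dil ⨾ dil-os 2 -1ℤ 1ℤ (+ 2) 0 1) ⨾ dil-os 2 -1ℤ 1ℤ (+ 2) 2 3)) ⨾ ≈-sym (dil-κ· 2 (ℤ.- (+ 3)) C₃)

cube-mod5 : ∃[ f₀ ] ∃[ f₁ ] ∃[ f₃ ] (E 1 · E 1 · E 1 ≈ comb 5 0 (f₀ ∷ f₁ ∷ κ 0ℤ ∷ f₃ ∷ []))
cube-mod5 = g (+ 1) 3 ⊕ X 2 · g (+ 9) 7 , κ -1ℤ · g (+ 3) 4 ⊕ κ -1ℤ · (X 1 · g (+ 7) 6) , g (+ 5) 5 ,
  ≈-trans (≈-sym jacobi) (os-dissect -1ℤ 1ℤ (+ 2) 0 1 4 ⨾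
  solve 6 (λ x a b c d e →
      :0 :+ :1 :* x :^ 0 :* a :+ con -1ℤ :* x :^ 1 :* b :+ :1 :* x :^ 3 :* c :+ con -1ℤ :* x :^ 6 :* d :+ :1 :* x :^ 10 :* e
      := x :^ 0 :* (a :+ x :^ 10 :* e) :+ (x :^ 1 :* (con -1ℤ :* b :+ con -1ℤ :* (x :^ 5 :* d)) :+ (x :^ 2 :* :0 :+ (x :^ 3 :* c :+ :0)))) ≈-refl
      (X 1) (os -1ℤ (+ 1) (+ 10) 25 15) (os -1ℤ (+ 3) (+ 10) 25 20) (os -1ℤ (+ 5) (+ 10) 25 25) (os -1ℤ (+ 7) (+ 10) 25 30) (os -1ℤ (+ 9) (+ 10) 25 35) ⨾
    comb-∷ 0 (⊕-cong (dil-g (+ 1) 3) (dil-Xg 2 (+ 9) 7) ⨾ ≈-sym (dil-⊕ 4 _ _))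
    (comb-∷ 1 (⊕-cong (dil-neg 4 (dil-g (+ 3) 4)) (dil-neg 4 (dil-Xg 1 (+ 7) 6)) ⨾ ≈-sym (dil-⊕ 4 _ _))
    (comb-∷ 2 (≈-sym (dil-κ 4 0ℤ)) (comb-∷ 3 (dil-g (+ 5) 5) ≈-refl))))
  where
  g : ℤ → ℕ → PS
  g u a = os -1ℤ u (+ 10) 5 a
  dil-g : ∀ u a → os -1ℤ u (+ 10) 25 (a * 5) ≈ dil 5 (g u a)
  dil-g u a = ≈-sym (dil-os 4 -1ℤ u (+ 10) 4 a)
  dil-Xg : ∀ e u a → X 1 ↑ (e * 5) · os -1ℤ u (+ 10) 25 (a * 5) ≈ dil 5 (X e · g u a)
  dil-Xg e u a = ·-cong (≈-sym (X≈↑ (e * 5))) (dil-g u a) ⨾ ≈-sym (dil-X· 4 e (g u a))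

-- Positivity of special quotients

E/E1 : ∀ b → E (suc (suc b)) · I 1 ≈ J (suc (suc b)) 1 · ∏ (omit 0 (omit (suc b) λ r → J (suc (suc b)) (suc r))) (suc (suc b))
E/E1 b = ·-cong (E≈O k) (I1-residues (suc b) ⨾
    ∏-omit F k ≤-refl ⨾ ·-congʳ (∏-omit {0} (omit (suc b) F) k (s≤s z≤n))) ⨾
  solve 4 (λ o j j₁ r → o :* (j :* (j₁ :* r)) := (o :* j) :* (j₁ :* r)) ≈-refl (O k k) (J k k) (omit (suc b) F 0) (∏ (omit 0 (omit (suc b) F)) k) ⨾
    ·-cong (O·J (suc b) (suc b)) (·-congˡ (omit-other {suc b} {0} F λ ())) ⨾ ·-idˡ _
  where
  k = suc (suc b)
  F : ℕ → PS
  F r = J k (suc r)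

-- Only class 0 modulo the index is cancelled; the index is at least 2, so the factor 1/(1 - q)
-- survives.
AllPos-E/E1 : ∀ b → AllPos (E (suc (suc b)) · I 1)
AllPos-E/E1 b = AllPos-resp (≈-sym (E/E1 b ⨾ ·-congˡ (J-head (suc b) 0) ⨾
    solve 3 (λ g j r → g :* j :* r := (j :* r) :* g) ≈-refl (gm 1) (J k (1 + k)) R))
  (AllPos-· (NonNeg₊-· (NonNeg₊-J k (1 + k)) (NonNeg₊-∏ (NonNeg₊-omit 0 (NonNeg₊-omit (suc b) λ r → NonNeg₊-J k (suc r))) k)) AllPos-gm1)
  where
  k = suc (suc b)
  R = ∏ (omit 0 (omit (suc b) λ r → J k (suc r))) k

E3/E1 : E 3 · I 1 ≈ J 3 1 · J 3 2
E3/E1 = ·-cong (E≈O 3) (I1-residues 2) ⨾ ≈-trans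
  (solve 4 (λ o j j′ i → o :* (:1 :* j :* j′ :* i) := (o :* i) :* (j :* j′)) ≈-refl (O 3 3) (J 3 1) (J 3 2) (J 3 3))
  (·-congˡ (O·J 2 2) ⨾ ·-idˡ _)

-- (1 - xy) / ((1 - x)(1 - y)) = 1/(1 - x) + y/(1 - y)
pair-NonNeg₊ : ∀ a b → NonNeg₊ (om (suc a + suc b) · (gm (suc a) · gm (suc b)))
pair-NonNeg₊ a b = NonNeg₊-resp (≈-sym eq) (NonNeg₊-⊕ (NonNeg₊-gm (suc a)) (NonNeg-· (NonNeg-X (suc b)) (nn (NonNeg₊-gm (suc b)))))
  where
  eq : om (suc a + suc b) · (gm (suc a) · gm (suc b)) ≈ gm (suc a) ⊕ X (suc b) · gm (suc b)
  eq = ·-congˡ (⊕-congʳ (⊖-cong (X-+ (suc a) (suc b)))) ⨾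
    solve 4 (λ x y g h → (:1 :- x :* y) :* (g :* h) := g :* ((:1 :- y) :* h) :+ y :* h :* ((:1 :- x) :* g)) ≈-refl
        (X (suc a)) (X (suc b)) (gm (suc a)) (gm (suc b)) ⨾
      ⊕-cong (·-congʳ (om·gm b)) (·-congʳ (om·gm a)) ⨾
        solve 3 (λ g y h → g :* :1 :+ y :* h :* :1 := g :+ y :* h) ≈-refl (gm (suc a)) (X (suc b)) (gm (suc b))

paired-products : ∀ k a b → NonNeg₊ (O (suc k + suc k) (suc a + suc b) · (J (suc k) (suc a) · J (suc k) (suc b)))
paired-products k a b = NonNeg₊-resp (≈-sym (·-congʳ (Lim-· (J-conv k a) (J-conv k b)) ⨾
    Lim-· (O-conv (k + suc k) (a + suc b)) (·-conv (J-conv k a) (J-conv k b))))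
  (NonNeg₊-Lim λ n → NonNeg₊-resp (·-congˡ (≈-cong om (arith a b k n)))
    (pair-NonNeg₊ (a + suc k * n) (b + suc k * n)))
  where
  arith : ∀ a b k n → suc (a + suc k * n) + suc (b + suc k * n) ≡ suc a + suc b + (suc k + suc k) * n
  arith = solve-∀

-- Each exponent 6j+3 or 6j+6 of (q^3;q^3)_∞ is a sum of exponents 3j+1, 3j+2 or 3j+4, 3j+2 of two denominator factors.
AllPos-C₃ : AllPos (C₃ · (I 1 · I 1))
AllPos-C₃ = AllPos-resp (≈-sym eq) (AllPos-· (NonNeg₊-· (paired-products 2 0 1) (paired-products 2 3 1)) AllPos-gm1)
  where
  eq : C₃ · (I 1 · I 1) ≈ (O 6 3 · (J 3 1 · J 3 2)) · (O 6 6 · (J 3 4 · J 3 2)) · gm 1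
  eq = solve 2 (λ e i → e :* e :* e :* (i :* i) := e :* (e :* i) :* (e :* i)) ≈-refl (E 3) (I 1) ⨾
    ·-cong (·-cong (E-residues 2 1) E3/E1) (E3/E1 ⨾ ·-congˡ (J-head 2 0)) ⨾
      solve 6 (λ o o′ j j′ j₄ g → :1 :* o :* o′ :* (j :* j′) :* (g :* j₄ :* j′) := (o :* (j :* j′)) :* (o′ :* (j₄ :* j′)) :* g) ≈-refl
        (O 6 3) (O 6 6) (J 3 1) (J 3 2) (J 3 4) (gm 1)

AllPos-lim : ∀ {f} → (∀ N → ∃[ g ] (f ≈⟨ N ⟩ g × AllPos g)) → AllPos f
AllPos-lim {f} p = allPos λ n → let (g , e , q) = p (suc n) in subst Pos (sym (coeff e n ≤-refl)) (0< q n)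

NonNeg₊-lim : ∀ {f} → (∀ N → ∃[ g ] (f ≈⟨ N ⟩ g × NonNeg₊ g)) → NonNeg₊ f
NonNeg₊-lim {f} p = nonNeg₊ (NonNeg-lim λ N → let (g , e , q) = p N in g , e , nn q)
  (let (g , e , q) = p 1 in subst Pos (sym (coeff e 0 ≤-refl)) (0<₀ q))

-- With weights 1 + 6m the theta series P₃ is E 1 plus six times a logarithmic derivative, whose n-th summand has the numerator
-- q^(3n+1) - q^(3n+2) = q^(3n+1)(1 - q).
AllPos-P₃ : AllPos (P₃ · (I 1 · I 1))
AllPos-P₃ = AllPos-lim λ N → _ , approx N , AllPos-⊕ AllPos-I1 (NonNeg-· (NonNeg-κ 6) (NonNeg-· (nn (NonNeg₊-J 3 3)) (deriv-NonNeg (suc N))))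
  where
  module TP = TripleProduct -1ℤ 1ℤ (+ 6) 2 2 1 refl refl
  x y : ℕ → PS
  x n = X (1 + 3 * n)
  y n = X (2 + 3 * n)
  g a d : ℕ → PS
  g = ∏ λ n → gm (1 + 3 * n) · gm (2 + 3 * n)
  a L = proj₁ (TP.partialProduct L)
  d L = proj₂ (TP.partialProduct L)
  y≈x : ∀ n → y n ≈ X 1 · x n
  y≈x n = X-+ 1 (1 + 3 * n)
  cancel : ∀ n → om (1 + 3 * n) · om (2 + 3 * n) · (gm (1 + 3 * n) · gm (2 + 3 * n)) ≈ 𝟙
  cancel n = om·gm₂ (3 * n) (1 + 3 * n)
  module _ (L : ℕ) where
    p p′ q q′ : PS
    p  = proj₁ (D.∏ᴿ (TP.factor 1ℤ 2) L)
    p′ = proj₂ (D.∏ᴿ (TP.factor 1ℤ 2) L)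
    q  = proj₁ (D.∏ᴿ (TP.factor -1ℤ 1) L)
    q′ = proj₂ (D.∏ᴿ (TP.factor -1ℤ 1) L)
    a-suc : a (suc L) ≈ a L · (om (1 + 3 * L) · om (2 + 3 * L))
    a-suc = solve 4 (λ p q x y → p :* (:1 :+ con -1ℤ :* y) :* (q :* (:1 :+ con -1ℤ :* x)) := p :* q :* ((:1 :- x) :* (:1 :- y))) ≈-refl p q (x L) (y L)
    -- The product rule: at z = 1 the pair (1 - y z)(1 - x/z) has derivative x - y.
    d-suc : d (suc L) ≈ a L · (x L ⊕ ⊖ y L) ⊕ d L · (om (1 + 3 * L) · om (2 + 3 * L))
    d-suc = solve 6 (λ p p′ q q′ x y →
        (p :* (:1 :+ con -1ℤ :* y)) :* (q :* (:1 :* x) :+ q′ :* (:1 :+ con -1ℤ :* x))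
          :+ (p :* (con -1ℤ :* y) :+ p′ :* (:1 :+ con -1ℤ :* y)) :* (q :* (:1 :+ con -1ℤ :* x))
        := p :* q :* (x :- y) :+ (p :* q′ :+ p′ :* q) :* ((:1 :- x) :* (:1 :- y))) ≈-refl p p′ q q′ (x L) (y L)
  a·g : ∀ L → a L · g L ≈ 𝟙
  a·g zero    = solve 0 (:1 :* :1 :* :1 := :1) ≈-refl
  a·g (suc L) = ·-congˡ (a-suc L) ⨾ ≈-trans
    (solve 4 (λ a o g h → a :* o :* (g :* h) := (a :* g) :* (o :* h)) ≈-refl (a L) (om (1 + 3 * L) · om (2 + 3 * L)) (g L) (gm (1 + 3 * L) · gm (2 + 3 * L)))
    (·-cong (a·g L) (cancel L) ⨾ ·-idˡ 𝟙)
  om1·g : ∀ L → NonNeg (om 1 · g (suc L))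
  om1·g L = NonNeg-resp (≈-sym (·-congʳ (∏-head _ L) ⨾ ≈-trans
      (solve 4 (λ o g h r → o :* (g :* h :* r) := (o :* g) :* (h :* r)) ≈-refl (om 1) (gm 1) (gm 2) _) (·-congˡ (om·gm 0) ⨾ ·-idˡ _)))
    (nn (NonNeg₊-· (NonNeg₊-gm 2) (NonNeg₊-∏ (λ n → NonNeg₊-· (NonNeg₊-gm _) (NonNeg₊-gm _)) L)))
  -- As g = 1/a, this is the logarithmic derivative divided by a once more. Its new summand keeps a
  -- full factor g, whose 1/(1 - q) absorbs the numerator 1 - q.
  deriv-NonNeg : ∀ L → NonNeg (d L · (g L · g L))
  deriv-NonNeg zero    = NonNeg-resp (≈-sym (solve 0 ((:1 :* :0 :+ :0 :* :1) :* (:1 :* :1) := :0) ≈-refl)) (NonNeg-κ 0)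
  deriv-NonNeg (suc L) = NonNeg-resp (≈-sym eq) (NonNeg-⊕
      (NonNeg-· (NonNeg-X _) (NonNeg-· (om1·g L) hL)) (NonNeg-· (deriv-NonNeg L) hL))
    where
    h = gm (1 + 3 * L) · gm (2 + 3 * L)
    hL : NonNeg h
    hL = NonNeg-· (nn (NonNeg₊-gm _)) (nn (NonNeg₊-gm _))
    eq : d (suc L) · (g (suc L) · g (suc L)) ≈ x L · ((om 1 · g (suc L)) · h) ⊕ (d L · (g L · g L)) · h
    eq = ·-congˡ (d-suc L ⨾ ⊕-congˡ (·-congʳ (⊕-congʳ (⊖-cong (y≈x L))))) ⨾
      solve 7 (λ a x z d o g h → (a :* (x :- z :* x) :+ d :* o) :* ((g :* h) :* (g :* h))
          := (a :* g) :* (x :* (((:1 :- z) :* (g :* h)) :* h)) :+ (o :* h) :* ((d :* (g :* g)) :* h)) ≈-refl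
          (a L) (x L) (X 1) (d L) (om (1 + 3 * L) · om (2 + 3 * L)) (g L) h ⨾
        ⊕-cong (·-congˡ (a·g L) ⨾ ·-idˡ _) (·-congˡ (cancel L) ⨾ ·-idˡ _)
  K = J 3 1 · J 3 2
  K-lim : ∀ N → K ≈⟨ N ⟩ g (suc N)
  K-lim N = ≈⇒mod (Lim-· (J-conv 2 0) (J-conv 2 1)) ⨾⟨⟩ mod-mono (m≤n+m N 2) (Lim-∏ (·-conv (J-conv 2 0) (J-conv 2 1)) (suc N))
  I≈ : I 1 ≈ J 3 3 · K
  I≈ = I1-residues 2 ⨾ solve 3 (λ j j′ i → :1 :* j :* j′ :* i := i :* (j :* j′)) ≈-refl (J 3 1) (J 3 2) (J 3 3)
  approx : ∀ N → P₃ · (I 1 · I 1) ≈⟨ N ⟩ I 1 ⊕ κ (+ 6) · (J 3 3 · (d (suc N) · (g (suc N) · g (suc N))))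
  approx N = ·-cong⟨⟩ˡ (mod-sym (TP.triple-product N)) ⨾⟨⟩ mod-trans
    (≈⇒mod (≈-trans
      (solve 4 (λ e a d i → e :* (:1 :* a :+ con (+ 6) :* d) :* (i :* i) := a :* ((e :* i) :* i) :+ con (+ 6) :* (d :* ((e :* i) :* i))) ≈-refl (E 3) (a (suc N)) (d (suc N)) (I 1))
      (⊕-cong (·-congʳ (·-cong E3/E1 I≈)) (·-congʳ (·-congʳ (·-cong E3/E1 I≈))))))
    (⊕-cong⟨⟩ (·-cong⟨⟩ʳ (·-cong⟨⟩ˡ (K-lim N)))
        (·-cong⟨⟩ʳ (·-cong⟨⟩ʳ (·-cong⟨⟩ (K-lim N) (·-cong⟨⟩ʳ (K-lim N))))) ⨾⟨⟩
      ≈⇒mod (⊕-cong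
        (solve 3 (λ a g r → a :* (g :* r) := (a :* g) :* r) ≈-refl (a (suc N)) (g (suc N)) (J 3 3 · K) ⨾
          ·-cong (a·g (suc N)) (≈-sym I≈) ⨾ ·-idˡ _)
        (solve 3 (λ d g j → con (+ 6) :* (d :* (g :* (j :* g))) := con (+ 6) :* (j :* (d :* (g :* g)))) ≈-refl (d (suc N)) (g (suc N)) (J 3 3))))

-- The finite products V N = ∏ s - q ∏ t satisfy V (N+1) = (s N - t N) ∏ s + t N · V N, and s N - t N has the numerator
-- q^(15N+1) (1 - q^3)(1 - q^10).
NonNeg₊-Z₅ : NonNeg₊ (Z₅ · I 1)
NonNeg₊-Z₅ = NonNeg₊-resp (≈-sym factorisation) (NonNeg₊-· V∞·c (NonNeg₊-· (NonNeg₊-· (NonNeg₊-J 15 18) (NonNeg₊-J 15 25))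
    (NonNeg₊-∏ F-NonNeg₊ 15)))
  where
  s t : ℕ → PS
  s n = gm (1 + 15 * n) · gm (14 + 15 * n)
  t n = gm (4 + 15 * n) · gm (11 + 15 * n)
  -- Two factors taken from the classes 3 and 10 modulo 15 of 1/(q;q)_∞, of which `J 15 18` and
  -- `J 15 25` remain. They cancel the numerator (1 - q^3)(1 - q^10).
  c = gm 3 · gm 10
  V : ℕ → PS
  V N = ∏ s N ⊕ ⊖ (X 1 · ∏ t N)
  s-NonNeg₊ : ∀ n → NonNeg₊ (s n)
  s-NonNeg₊ n = NonNeg₊-· (NonNeg₊-gm _) (NonNeg₊-gm _)
  t-NonNeg₊ : ∀ n → NonNeg₊ (t n)
  t-NonNeg₊ n = NonNeg₊-· (NonNeg₊-gm _) (NonNeg₊-gm _)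
  X-split : ∀ a n → X (a + 15 * n) ≈ X 1 ↑ a · X (15 * n)
  X-split a n = X-+ a (15 * n) ⨾ ·-congˡ (X≈↑ a)
  om-split : ∀ a n → om (a + 15 * n) ≈ 𝟙 ⊕ ⊖ (X 1 ↑ a · X (15 * n))
  om-split a n = ⊕-congʳ (⊖-cong (X-split a n))
  S·s : ∀ n → (om (1 + 15 * n) · om (14 + 15 * n)) · s n ≈ 𝟙
  S·s n = om·gm₂ (15 * n) (13 + 15 * n)
  T·t : ∀ n → (om (4 + 15 * n) · om (11 + 15 * n)) · t n ≈ 𝟙
  T·t n = om·gm₂ (3 + 15 * n) (10 + 15 * n)
  s-t : ∀ n → (s n ⊕ ⊖ t n) · c ≈ X (1 + 15 * n) · (s n · t n)
  s-t n = ·-congˡ (⊕-cong (≈-sym (·-idʳ _) ⨾ ·-congʳ (≈-sym (T·t n))) (⊖-cong (≈-sym (·-idʳ _) ⨾ ·-congʳ (≈-sym (S·s n))))) ⨾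
    ·-congˡ (⊕-cong (·-congʳ (·-congˡ (·-cong (om-split 4 n) (om-split 11 n)))) (⊖-cong (·-congʳ (·-congˡ (·-cong (om-split 1 n) (om-split 14 n)))))) ⨾
    solve 6 (λ x y s t g h →
        (s :* ((:1 :- x :^ 4 :* y) :* (:1 :- x :^ 11 :* y) :* t) :- t :* ((:1 :- x :^ 1 :* y) :* (:1 :- x :^ 14 :* y) :* s)) :* (g :* h)
        := (x :^ 1 :* y) :* (s :* t) :* (((:1 :- x :^ 3) :* g) :* ((:1 :- x :^ 10) :* h))) ≈-refl (X 1) (X (15 * n)) (s n) (t n) (gm 3) (gm 10) ⨾
      ·-cong (·-congˡ (≈-sym (X-split 1 n))) (·-cong
          (·-congˡ (⊕-congʳ (⊖-cong (≈-sym (X≈↑ 3)))) ⨾ om·gm 2) (·-congˡ (⊕-congʳ (⊖-cong (≈-sym (X≈↑ 10)))) ⨾ om·gm 9)) ⨾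
        solve 1 (λ f → f :* (:1 :* :1) := f) ≈-refl _
  V-suc : ∀ N → V (suc N) · c ≈ t N · (V N · c) ⊕ (X (1 + 15 * N) · (s N · t N)) · ∏ s N
  V-suc N = solve 6 (λ x p q s t c → (p :* s :- x :* (q :* t)) :* c := t :* ((p :- x :* q) :* c) :+ (s :- t) :* c :* p) ≈-refl (X 1) (∏ s N) (∏ t N) (s N) (t N) c ⨾
    ⊕-congʳ (·-congˡ (s-t N))
  -- The induction starts here because `V 0` is 1 - q and `V 0 · c` still has a negative
  -- coefficient. The common numerator is 1 - q times (1 - q^4)(1 - q^11) + (q^2 + q^3 + q^4)(1 -
  -- q^10), whose summands cancel separately.
  V₁ : V 1 · c ≈ (gm 14 · gm 10 ⊕ (X 2 ⊕ X 3 ⊕ X 4) · (gm 14 · t 0)) · gm 3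
  V₁ = ·-congˡ (⊕-cong (·-idˡ _ ⨾ ≈-sym (·-idʳ _) ⨾ ·-congʳ (≈-sym (T·t 0)))
        (⊖-cong (·-congʳ (·-idˡ _ ⨾ ≈-sym (·-idʳ _) ⨾ ·-congʳ (≈-sym (S·s 0)))))) ⨾
    ·-congˡ (⊕-cong (·-congʳ (·-congˡ (·-cong (om↑ 4) (om↑ 11)))) (⊖-cong (·-congʳ (·-congʳ (·-congˡ (·-cong (om↑ 1) (om↑ 14))))))) ⨾
    solve 7 (λ x g₁ g₁₄ g₄ g₁₁ g₃ g₁₀ →
        ((g₁ :* g₁₄) :* ((:1 :- x :^ 4) :* (:1 :- x :^ 11) :* (g₄ :* g₁₁)) :- x :* ((g₄ :* g₁₁) :* ((:1 :- x :^ 1) :* (:1 :- x :^ 14) :* (g₁ :* g₁₄)))) :* (g₃ :* g₁₀)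
        := ((:1 :- x :^ 1) :* g₁) :* (g₁₄ :* g₁₀ :* ((:1 :- x :^ 4) :* (:1 :- x :^ 11) :* (g₄ :* g₁₁))
            :+ (x :^ 2 :+ x :^ 3 :+ x :^ 4) :* (g₁₄ :* (g₄ :* g₁₁)) :* ((:1 :- x :^ 10) :* g₁₀)) :* g₃) ≈-refl
        (X 1) (gm 1) (gm 14) (gm 4) (gm 11) (gm 3) (gm 10) ⨾
      ·-congˡ (·-cong (·-congˡ (≈-sym (om↑ 1)) ⨾ om·gm 0) (⊕-cong
          (·-congʳ (·-congˡ (·-cong (≈-sym (om↑ 4)) (≈-sym (om↑ 11))) ⨾ T·t 0))
          (·-cong (·-congˡ (⊕-cong (⊕-cong (≈-sym (X≈↑ 2)) (≈-sym (X≈↑ 3))) (≈-sym (X≈↑ 4)))) (·-congˡ (≈-sym (om↑ 10)) ⨾ om·gm 9)))) ⨾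
        solve 3 (λ a b g → :1 :* (a :* :1 :+ b :* :1) :* g := (a :+ b) :* g) ≈-refl _ _ (gm 3)
    where
    om↑ : ∀ k → om k ≈ 𝟙 ⊕ ⊖ (X 1 ↑ k)
    om↑ k = ⊕-congʳ (⊖-cong (X≈↑ k))
  V-NonNeg₊ : ∀ N → NonNeg₊ (V (suc N) · c)
  V-NonNeg₊ zero    = NonNeg₊-resp (≈-sym V₁) (NonNeg₊-· (NonNeg₊-⊕ (NonNeg₊-· (NonNeg₊-gm 14) (NonNeg₊-gm 10))
    (NonNeg-· (NonNeg-⊕ (NonNeg-⊕ (NonNeg-X 2) (NonNeg-X 3)) (NonNeg-X 4)) (NonNeg-· (nn (NonNeg₊-gm 14)) (nn (t-NonNeg₊ 0))))) (NonNeg₊-gm 3))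
  V-NonNeg₊ (suc N) = NonNeg₊-resp (≈-sym (V-suc (suc N))) (NonNeg₊-⊕ (NonNeg₊-· (t-NonNeg₊ (suc N)) (V-NonNeg₊ N))
    (NonNeg-· (NonNeg-· (NonNeg-X _) (NonNeg-· (nn (s-NonNeg₊ (suc N))) (nn (t-NonNeg₊ (suc N))))) (nn (NonNeg₊-∏ s-NonNeg₊ (suc N)))))
  V∞ = J 15 1 · J 15 14 ⊕ ⊖ (X 1 · (J 15 4 · J 15 11))
  V∞·c : NonNeg₊ (V∞ · c)
  V∞·c = NonNeg₊-lim λ N → V (suc N) · c , ·-cong⟨⟩ˡ (⊕-cong⟨⟩ (lim (J-conv 14 0) (J-conv 14 13) N) (⊖-cong⟨⟩ (·-cong⟨⟩ʳ (lim (J-conv 14 3) (J-conv 14 10) N)))) , V-NonNeg₊ N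
    where
    lim : ∀ {F G} → Convergent F → Convergent G → ∀ N → Lim F · Lim G ≈⟨ N ⟩ ∏ (λ n → F n · G n) (suc N)
    lim cF cG N = ≈⇒mod (Lim-· cF cG) ⨾⟨⟩ mod-mono (m≤n+m N 2) (Lim-∏ (·-conv cF cG) (suc N))
  F₀ : ℕ → PS
  F₀ r = J 15 (suc r)
  F₁ = omit 14 F₀
  F₂ = omit 0 F₁
  F₃ = omit 13 F₂
  F₄ = omit 3 F₃
  F₅ = omit 10 F₄
  F₆ = omit 2 F₅
  F₇ = omit 9 F₆
  F-NonNeg₊ : ∀ n → NonNeg₊ (F₇ n)
  F-NonNeg₊ = NonNeg₊-omit 9 (NonNeg₊-omit 2 (NonNeg₊-omit 10 (NonNeg₊-omit 3 (NonNeg₊-omit 13 (NonNeg₊-omit 0 (NonNeg₊-omit 14 λ r → NonNeg₊-J 15 (suc r)))))))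
  I-factored : I 1 ≈ J 15 15 · (J 15 1 · (J 15 14 · (J 15 4 · (J 15 11 · (J 15 3 · (J 15 10 · ∏ F₇ 15))))))
  I-factored = I1-residues 14 ⨾ ∏-omit {14} F₀ 15 (m≤m+n 15 0) ⨾ ·-congʳ (∏-omit {0} F₁ 15 (m≤m+n 1 14) ⨾ ·-congʳ (∏-omit {13} F₂ 15 (m≤m+n 14 1) ⨾ ·-congʳ (∏-omit {3} F₃ 15 (m≤m+n 4 11) ⨾ ·-congʳ (∏-omit {10} F₄ 15 (m≤m+n 11 4) ⨾ ·-congʳ (∏-omit {2} F₅ 15 (m≤m+n 3 12) ⨾ ·-congʳ (∏-omit {9} F₆ 15 (m≤m+n 10 5) ⨾ ≈-refl))))))
  factorisation : Z₅ · I 1 ≈ (V∞ · c) · ((J 15 18 · J 15 25) · ∏ F₇ 15)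
  factorisation = ·-cong (≈-trans
        (⊕-cong (≈-sym (Θ-product 14 10 3 refl)) (·-congʳ (·-congʳ (≈-sym (Θ-product 14 13 0 refl)))))
        (⊕-cong (·-congˡ (E≈O 15)) (·-congʳ (·-congʳ (·-congˡ (E≈O 15)))) ⨾ ≈-refl)) I-factored ⨾
    solve 14 (λ e x o₁₁ o₄ o₁₄ o₁ i j₁ j₁₄ j₄ j₁₁ j₃ j₁₀ r →
        (e :* (o₁₁ :* o₄) :+ con -1ℤ :* (x :* (e :* (o₁₄ :* o₁)))) :* (i :* (j₁ :* (j₁₄ :* (j₄ :* (j₁₁ :* (j₃ :* (j₁₀ :* r)))))))
        := (e :* i) :* (((o₁₁ :* j₁₁) :* (o₄ :* j₄)) :* (j₁ :* j₁₄) :- ((o₁₄ :* j₁₄) :* (o₁ :* j₁)) :* (x :* (j₄ :* j₁₁))) :* (j₃ :* j₁₀ :* r)) ≈-refl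
        (O 15 15) (X 1) (O 15 11) (O 15 4) (O 15 14) (O 15 1) (J 15 15) (J 15 1) (J 15 14) (J 15 4) (J 15 11) (J 15 3) (J 15 10) (∏ F₇ 15) ⨾
    ·-cong (·-cong (O·J 14 14) (⊕-cong (·-congˡ (·-cong (O·J 14 10) (O·J 14 3))) (⊖-cong (·-congˡ (·-cong (O·J 14 13) (O·J 14 0))))))
        (·-congˡ (·-cong (J-head 14 2) (J-head 14 9))) ⨾
      solve 7 (λ a b g h j j′ r → :1 :* (:1 :* :1 :* a :- :1 :* :1 :* b) :* ((g :* j) :* (h :* j′) :* r) := ((a :- b) :* (g :* h)) :* ((j :* j′) :* r)) ≈-refl
        (J 15 1 · J 15 14) (X 1 · (J 15 4 · J 15 11)) (gm 3) (gm 10) (J 15 18) (J 15 25) (∏ F₇ 15)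

-- Coefficients of dissected eta quotients

comb-·dil : ∀ k r fs h → comb (suc k) r fs · dil (suc k) h ≈ comb (suc k) r (map (_· h) fs)
comb-·dil k r []       h = ·-zeroˡ _
comb-·dil k r (f ∷ fs) h = ·-distribʳ _ _ _ ⨾ ⊕-cong
  (·-assoc _ _ _ ⨾ ·-congʳ (≈-sym (dil-· k f h))) (comb-·dil k (suc r) fs h)

record Dissection (k : ℕ) (f : PS) (gs : List PS) : Set where
  constructor dissection
  field ≈comb : f ≈ comb k 0 gs
open Dissection

dissect-· : ∀ k {e f g h} fs → e ≈ f · g → f ≈ comb (suc k) 0 fs → g ≈ dil (suc k) h → Dissection (suc k) e (map (_· h) fs)
dissect-· k {h = h} fs d p q = dissection (d ⨾ ·-cong p q ⨾ comb-·dil k 0 fs h)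

coefficient : ∀ k {f gs} r n → Dissection (suc k) f gs → length gs ≤ suc k → r < suc k → n % suc k ≡ r → f n ≡ nth gs r (n / suc k)
coefficient k {f} {gs} r n e le lt n%k = cong f n≡ ∙ at (≈comb e) _ ∙ comb-at k gs r _ lt le
  where
  n≡ : n ≡ r + (n / suc k) * suc k
  n≡ = m≡m%n+[m/n]*n n (suc k) ∙ cong (_+ (n / suc k) * suc k) n%k

coefficient-9 : ∀ {f gs} s i n → Dissection 3 f gs → length gs ≤ 3 → s < 3 → n % 9 ≡ s + i * 3 → f n ≡ nth gs s (i + (n / 9) * 3)
coefficient-9 {f} {gs} s i n e le lt n%9 = cong f n≡ ∙ at (≈comb e) _ ∙ comb-at 2 gs s _ lt le
  where
  arith : ∀ s i q → s + i * 3 + q * 9 ≡ s + (i + q * 3) * 3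
  arith = solve-∀
  n≡ : n ≡ s + (i + (n / 9) * 3) * 3
  n≡ = m≡m%n+[m/n]*n n 9 ∙ cong (_+ (n / 9) * 9) n%9 ∙ arith s i (n / 9)

pos-at : ∀ {x f} m → x ≡ f m → AllPos f → Pos x
pos-at m e p = subst Pos (sym e) (0< p m)

neg-at : ∀ c {x f h} m → x ≡ f m → f ≈ κ ℤ.-[1+ c ] · h → AllPos h → Neg x
neg-at c {h = h} m e e′ p = subst (ℤ._< 0ℤ) (sym (e ∙ at e′ m ∙ κ·-at ℤ.-[1+ c ] h m)) (neg-* (0< p m))
  where
  neg-* : ∀ {a} → 0ℤ ℤ.< a → ℤ.-[1+ c ] *ᶻ a ℤ.< 0ℤ
  neg-* {+ suc a} _ = ℤ.-<+
  neg-* {+ zero} (ℤ.+<+ ())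

zero-at : ∀ {x f} m → x ≡ f m → f ≈ κ 0ℤ → Zero x
zero-at m e e′ = e ∙ at e′ m ∙ κ0-at m

opaque
  unfolding _·_

  powPS-cong : ∀ {f g} → f ≈ g → ∀ n → powPS f n ≈ g P.^^ n
  powPS-cong e zero    = onePS≈𝟙
  powPS-cong e (suc n) = ·-cong (powPS-cong e n) e

  private
    ·-one : ∀ {f g} → f ≈ g → (f ⊛ onePS) ≈ g
    ·-one {f} {g} e = ·-cong e onePS≈𝟙 ⨾ ·-idʳ g

  etaQ₁ : ∀ k e k′ e′ → etaQ ((k , e) ∷ []) ((k′ , e′) ∷ []) ≈ E k P.^^ e · I k′ P.^^ e′
  etaQ₁ k e k′ e′ = ·-cong (·-one (powPS-cong (qpoch≈E k) e)) (·-one (powPS-cong (qpochInv≈I k′) e′))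

  etaQ₂ : ∀ k e k′ e′ k″ e″ → etaQ ((k , e) ∷ []) ((k′ , e′) ∷ (k″ , e″) ∷ []) ≈ E k P.^^ e · (I k′ P.^^ e′ · I k″ P.^^ e″)
  etaQ₂ k e k′ e′ k″ e″ = ·-cong (·-one (powPS-cong (qpoch≈E k) e))
    (·-cong (powPS-cong (qpochInv≈I k′) e′) (·-one (powPS-cong (qpochInv≈I k″) e″)))

dil-^^ : ∀ k f n → dil (suc k) (f P.^^ n) ≈ dil (suc k) f P.^^ n
dil-^^ k f zero    = dil-κ k 1ℤ
dil-^^ k f (suc n) = dil-· k _ _ ⨾ ·-congˡ (dil-^^ k f n)

^^-cong : ∀ {f g} n → f ≈ g → f P.^^ n ≈ g P.^^ n
^^-cong zero    e = ≈-refl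
^^-cong (suc n) e = ·-cong (^^-cong n e) e

EI-cancel : ∀ n f → (E 1 · I 1) P.^^ n · f ≈ f
EI-cancel zero    f = ·-idˡ f
EI-cancel (suc n) f = ·-assoc _ _ _ ⨾ ·-congʳ (·-congˡ (E·I 0) ⨾ ·-idˡ f) ⨾ EI-cancel n f

I^^-dil : ∀ k n → I (suc k) P.^^ n ≈ dil (suc k) (I 1 P.^^ n)
I^^-dil k n = ≈-sym (dil-^^ k (I 1) n ⨾ ^^-cong n (dil-I k 0 ⨾ ≈-cong I (ℕP.*-identityˡ (suc k))))

NonNeg₊-^^ : ∀ {f} → NonNeg₊ f → ∀ n → NonNeg₊ (f P.^^ n)
NonNeg₊-^^ p zero    = NonNeg₊-κ 0
NonNeg₊-^^ p (suc n) = NonNeg₊-· (NonNeg₊-^^ p n) p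

NonNeg₊-I1 : NonNeg₊ (I 1)
NonNeg₊-I1 = AllPos⇒NonNeg₊ AllPos-I1

NonNeg₊-I : ∀ k → NonNeg₊ (I k)
NonNeg₊-I k = NonNeg₊-Lim λ n → NonNeg₊-gm _

pw : ∀ {n} → PS-Solver.Polynomial n → ℕ → PS-Solver.Polynomial n
pw e zero    = :1
pw e (suc n) = pw e n :* e

-- Dissections modulo 3 and 4: parts (3) to (6)

P₃-quotient C₃-quotient : ∀ j → PS
P₃-quotient j = P₃ · I 1 P.^^ (2 + j)
C₃-quotient j = C₃ · I 1 P.^^ (2 + j)

private
  AllPos-quotient : ∀ {f} → AllPos (f · (I 1 · I 1)) → ∀ j → AllPos (f · I 1 P.^^ (2 + j))
  AllPos-quotient {f} p j = AllPos-resp (solve 3 (λ f i h → h :* (f :* (i :* i)) := f :* (h :* i :* i)) ≈-refl f (I 1) (I 1 P.^^ j))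
    (AllPos-· (NonNeg₊-^^ NonNeg₊-I1 j) p)

AllPos-P₃-quotient : ∀ j → AllPos (P₃-quotient j)
AllPos-P₃-quotient = AllPos-quotient AllPos-P₃

AllPos-C₃-quotient : ∀ j → AllPos (C₃-quotient j)
AllPos-C₃-quotient = AllPos-quotient AllPos-C₃

-- Needed twice: j = 0 is (3), and j = 1 dissects class 0 of (8) a second time.
cube-quotient : ∀ j {f} → f ≈ E 1 · E 1 · E 1 · I 3 P.^^ (2 + j) →
  Dissection 3 f (P₃-quotient j ∷ κ (ℤ.- (+ 3)) · C₃ · I 1 P.^^ (2 + j) ∷ [])
cube-quotient j e = dissect-· 2 (P₃ ∷ κ (ℤ.- (+ 3)) · C₃ ∷ []) e cube-mod3 (I^^-dil 2 (2 + j))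

part3 : ∀ n → let a = etaQ ((1 , 3) ∷ []) ((3 , 2) ∷ []) n in
  (n % 3 ≡ 0 → Pos a) × (n % 3 ≡ 1 → Neg a) × (n % 3 ≡ 2 → Zero a)
part3 n = (λ r → pos-at (n / 3) (coeff-at 0 (s≤s z≤n) r) (AllPos-P₃-quotient 0))
        , (λ r → neg-at 2 (n / 3) (coeff-at 1 (s≤s (s≤s z≤n)) r) (·-assoc _ _ _) (AllPos-C₃-quotient 0))
        , (λ r → zero-at (n / 3) (coeff-at 2 (s≤s (s≤s (s≤s z≤n))) r) ≈-refl)
  where
  eq = cube-quotient 0 (etaQ₁ 1 3 3 2 ⨾ ·-congˡ (solve 1 (λ e → pw e 3 := e :* e :* e) ≈-refl (E 1)))
  coeff-at = λ r → coefficient 2 r n eq (s≤s (s≤s z≤n))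

φ⁻-quotient : Θ 2 1 1 ≈ E 1 · E 1 · I 2
φ⁻-quotient = ≈-sym (·-idʳ _) ⨾ ·-congʳ (≈-sym (E·I 1)) ⨾ ≈-sym (·-assoc _ _ _) ⨾ ·-congˡ φ⁻-product

part4 : ∀ n → let a = etaQ ((1 , 2) ∷ []) ((2 , 1) ∷ (3 , 2) ∷ []) n in
  (n % 3 ≡ 0 → Pos a) × (n % 3 ≡ 1 → Neg a) × (n % 3 ≡ 2 → Zero a)
part4 n = (λ r → pos-at (n / 3) (coeff-at 0 (s≤s z≤n) r) pos₀)
        , (λ r → neg-at 1 (n / 3) (coeff-at 1 (s≤s (s≤s z≤n)) r) (·-assoc _ _ _) pos₁)
        , (λ r → zero-at (n / 3) (coeff-at 2 (s≤s (s≤s (s≤s z≤n))) r) ≈-refl)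
  where
  eq = dissect-· 2 (Θ 6 3 3 ∷ κ (ℤ.- (+ 2)) · Θ 6 5 1 ∷ [])
    (etaQ₂ 1 2 2 1 3 2 ⨾ solve 3 (λ e i j → pw e 2 :* (pw i 1 :* j) := (e :* e :* i) :* j) ≈-refl (E 1) (I 2) (I 3 P.^^ 2))
    (≈-sym φ⁻-quotient ⨾ φ⁻-mod3) (I^^-dil 2 2)
  coeff-at = λ r → coefficient 2 r n eq (s≤s (s≤s z≤n))
  -- Here a = a′, and residue 3 modulo 6 would have to be cancelled twice by one 1/(q;q)_∞. Instead
  -- the series is φ(-q^3), which supplies one `E 3` for each of the two copies of `I 1`.
  Θ633 : Θ 6 3 3 ≈ E 3 · E 3 · I 6
  Θ633 = ≈-sym (dil-th 2 -1ℤ 1ℤ 0ℤ 1 1 1) ⨾ dil-cong 2 φ⁻-quotient ⨾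
    dil-· 2 _ _ ⨾ ·-cong (dil-· 2 _ _ ⨾ ·-cong (dil-E 2 0) (dil-E 2 0)) (dil-I 2 1)
  pos₀ : AllPos (Θ 6 3 3 · I 1 P.^^ 2)
  pos₀ = AllPos-resp (≈-sym (·-congˡ Θ633 ⨾
      solve 3 (λ e j i → e :* e :* j :* pw i 2 := (j :* (e :* i)) :* (e :* i)) ≈-refl (E 3) (I 6) (I 1)))
    (AllPos-· (NonNeg₊-· (NonNeg₊-I 6) (AllPos⇒NonNeg₊ (AllPos-E/E1 1))) (AllPos-E/E1 1))
  pos₁ : AllPos (Θ 6 5 1 · I 1 P.^^ 2)
  pos₁ = AllPos-resp (solve 2 (λ f i → f :* i :* i := f :* pw i 2) ≈-refl (Θ 6 5 1) (I 1)) (AllPos-· (Θ/E1-NonNeg₊ 5 4 0 refl λ ()) AllPos-I1)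

-- `ψ²` is ψ(q^2), the sum of q^(j(j+1)), and not the square of `ψ`; `φ⁺` is φ(q), the sum of
-- q^(m^2) over all integers m.
ψ² φ⁺ : PS
ψ² = θ⁺ 2 2
φ⁺ = th 1ℤ 1ℤ 0ℤ 2 1 1

NonNeg₊-os : ∀ b a → NonNeg₊ (θ⁺ (suc b) a)
NonNeg₊-os b a = NonNeg₊-resp (≈-sym (os-head 1ℤ 1ℤ 0ℤ b a))
  (NonNeg₊-⊕ (NonNeg₊-κ 0) (NonNeg-· (NonNeg-· (NonNeg-κ 1) (NonNeg-X a)) (NonNeg-os 1 (suc b) (suc b + a))))

NonNeg₊-φ⁺ : NonNeg₊ φ⁺
NonNeg₊-φ⁺ = NonNeg₊-⊕ (NonNeg₊-os 1 1) (NonNeg-· (NonNeg-· (NonNeg-κ 1) (NonNeg-X 1)) (NonNeg-os 1 2 3))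

φ²-parts : ℤ → List PS
φ²-parts s = φ⁺ · φ⁺ ∷ κ (s *ᶻ (+ 4)) · (φ⁺ · ψ²) ∷ κ (+ 4) · (ψ² · ψ²) ∷ []

-- Classes 0, 1, 2 collect sums of two squares with none, one or two odd terms; class 3 is empty.
-- Only one odd term leaves the sign s.
φ²-mod4 : ∀ s → s *ᶻ s ≡ 1ℤ → th s 1ℤ 0ℤ 2 1 1 · th s 1ℤ 0ℤ 2 1 1 ≈ comb 4 0 (φ²-parts s)
φ²-mod4 s s² = ·-cong (φ-mod4 s s²) (φ-mod4 s s²) ⨾ ≈-trans
  (·-cong expand expand)
  (solve 4 (λ x s f g → (:1 :* f :+ (x :* ((s :* con (+ 2)) :* g) :+ :0)) :* (:1 :* f :+ (x :* ((s :* con (+ 2)) :* g) :+ :0))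
      := x :^ 0 :* (f :* f) :+ (x :^ 1 :* ((s :* con (+ 4)) :* (f :* g)) :+ (x :^ 2 :* ((s :* s) :* con (+ 4) :* (g :* g)) :+ :0))) ≈-refl
      (X 1) (κ s) (dil 4 φ⁺) (dil 4 ψ²) ⨾
    comb-∷ 0 (≈-sym (dil-· 3 _ _)) (comb-∷ 1 (dilκ (κ-* s (+ 4)) φ⁺ ψ²) (comb-∷ 2 (dilκ (≈-sym (·-congˡ ss ⨾ ·-idˡ _)) ψ² ψ²) ≈-refl)))
  where
  ss : κ s · κ s ≈ 𝟙
  ss = ≈-sym (κ-* s s) ⨾ ≈-reflexive (cong κ s²)
  expand : comb 4 0 (φ⁺ ∷ κ (s *ᶻ (+ 2)) · ψ² ∷ []) ≈ 𝟙 · dil 4 φ⁺ ⊕ (X 1 · ((κ s · κ (+ 2)) · dil 4 ψ²) ⊕ κ 0ℤ)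
  expand = ⊕-cong (·-congˡ X0) (⊕-congˡ (·-congʳ (dil-κ· 3 (s *ᶻ (+ 2)) ψ² ⨾ ·-congˡ (κ-* s (+ 2)))))
  dilκ : ∀ {c c′} → κ c ≈ c′ → ∀ f g → c′ · (dil 4 f · dil 4 g) ≈ dil 4 (κ c · (f · g))
  dilκ e f g = ·-cong (≈-sym e) (≈-sym (dil-· 3 f g)) ⨾ ≈-sym (dil-κ· 3 _ (f · g))

AllPos-φψ : ∀ {f g} → NonNeg₊ f → NonNeg₊ g → AllPos ((f · g) · I 1 P.^^ 1)
AllPos-φψ p q = AllPos-· (NonNeg₊-· p q) (AllPos-resp (≈-sym (·-idˡ _)) AllPos-I1)

AllPos-κ· : ∀ c {f} → AllPos f → AllPos (κ (+ suc c) · f)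
AllPos-κ· c p = AllPos-· (NonNeg₊-κ c) p

-- The quotient is φ(-q)^2 / (q^4;q^4)_∞; in (6) it is φ(q)^2 / (q^4;q^4)_∞.
part5 : ∀ n → let a = etaQ ((1 , 4) ∷ []) ((2 , 2) ∷ (4 , 1) ∷ []) n in
  (n % 4 ∈ (0 ∷ 2 ∷ []) → Pos a) × (n % 4 ≡ 1 → Neg a) × (n % 4 ≡ 3 → Zero a)
part5 n = (λ { (here r) → pos-at (n / 4) (coeff-at 0 (m≤m+n 1 3) r) (AllPos-φψ NonNeg₊-φ⁺ NonNeg₊-φ⁺)
             ; (there (here r)) → pos-at (n / 4) (coeff-at 2 (m≤m+n 3 1) r)
                 (AllPos-resp (≈-sym (·-assoc _ _ _)) (AllPos-κ· 3 (AllPos-φψ (NonNeg₊-os 1 2) (NonNeg₊-os 1 2)))) })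
        , (λ r → neg-at 3 (n / 4) (coeff-at 1 (m≤m+n 2 2) r) (·-assoc _ _ _) (AllPos-φψ NonNeg₊-φ⁺ (NonNeg₊-os 1 2)))
        , (λ r → zero-at (n / 4) (coeff-at 3 (m≤m+n 4 0) r) ≈-refl)
  where
  eq = dissect-· 3 (φ²-parts -1ℤ)
    (etaQ₂ 1 4 2 2 4 1 ⨾ solve 3 (λ e i j → pw e 4 :* (pw i 2 :* j) := (e :* e :* i) :* (e :* e :* i) :* j) ≈-refl (E 1) (I 2) (I 4 P.^^ 1))
    (·-cong (≈-sym φ⁻-quotient) (≈-sym φ⁻-quotient) ⨾ φ²-mod4 -1ℤ refl) (I^^-dil 3 1)
  coeff-at = λ r → coefficient 3 r n eq (m≤m+n 3 1)

part6 : ∀ n → let a = etaQ ((2 , 10) ∷ []) ((1 , 4) ∷ (4 , 5) ∷ []) n in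
  (n % 4 ∈ (0 ∷ 1 ∷ 2 ∷ []) → Pos a) × (n % 4 ≡ 3 → Zero a)
part6 n = (λ { (here r) → pos-at (n / 4) (coeff-at 0 (m≤m+n 1 3) r) (AllPos-φψ NonNeg₊-φ⁺ NonNeg₊-φ⁺)
             ; (there (here r)) → pos-at (n / 4) (coeff-at 1 (m≤m+n 2 2) r)
                 (AllPos-resp (≈-sym (·-assoc _ _ _)) (AllPos-κ· 3 (AllPos-φψ NonNeg₊-φ⁺ (NonNeg₊-os 1 2))))
             ; (there (there (here r))) → pos-at (n / 4) (coeff-at 2 (m≤m+n 3 1) r)
                 (AllPos-resp (≈-sym (·-assoc _ _ _)) (AllPos-κ· 3 (AllPos-φψ (NonNeg₊-os 1 2) (NonNeg₊-os 1 2)))) })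
        , (λ r → zero-at (n / 4) (coeff-at 3 (m≤m+n 4 0) r) ≈-refl)
  where
  φ⁺-quotient : E 2 · E 2 · E 2 · E 2 · E 2 · (I 1 · I 1) · (I 4 · I 4) ≈ φ⁺
  φ⁺-quotient = ·-congˡ (·-congˡ (≈-sym φ⁺-product)) ⨾
    solve 5 (λ f e i g j → f :* (e :* e) :* (g :* g) :* (i :* i) :* (j :* j) := f :* ((e :* i) :* (e :* i)) :* ((g :* j) :* (g :* j))) ≈-refl φ⁺ (E 1) (I 1) (E 4) (I 4) ⨾
      ·-cong (·-congʳ (·-cong (E·I 0) (E·I 0))) (·-cong (E·I 3) (E·I 3)) ⨾
        solve 1 (λ f → f :* (:1 :* :1) :* (:1 :* :1) := f) ≈-refl φ⁺
  eq = dissect-· 3 (φ²-parts 1ℤ)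
    (etaQ₂ 2 10 1 4 4 5 ⨾ solve 3 (λ e i j → pw e 10 :* (pw i 4 :* pw j 5)
      := (e :* e :* e :* e :* e :* (i :* i) :* (j :* j)) :* (e :* e :* e :* e :* e :* (i :* i) :* (j :* j)) :* pw j 1) ≈-refl (E 2) (I 1) (I 4))
    (·-cong φ⁺-quotient φ⁺-quotient ⨾ φ²-mod4 1ℤ refl) (I^^-dil 3 1)
  coeff-at = λ r → coefficient 3 r n eq (m≤m+n 3 1)

-- Quintisection of (q;q)_∞^2

-- From a w = 0 follows w = (1 - a) w, and 1 - a is divisible by q; so every round gains one degree.
·-cancel : ∀ {a w} → a 0 ≡ 1ℤ → a · w ≈ κ 0ℤ → w ≈ κ 0ℤ
·-cancel {a} {w} a₀ e = mod⇒≈ go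
  where
  a-𝟙 : 𝟙 ⊕ ⊖ a ≈⟨ 1 ⟩ κ 0ℤ
  a-𝟙 = below λ { zero _ → trans (⊕-at 𝟙 (⊖ a) 0) (cong₂ _+ᶻ_ (κ-at0 1ℤ) (⊖-at a 0 ∙ cong ℤ.-_ a₀) ∙ sym (κ-at0 0ℤ)) ; (suc _) (s≤s ()) }
  go : ∀ n → w ≈⟨ n ⟩ κ 0ℤ
  go zero    = below λ _ ()
  go (suc n) = ≈⇒mod (solve 2 (λ a w → w := (:1 :- a) :* w :+ a :* w) ≈-refl a w ⨾ ⊕-congʳ e ⨾ ⊕-idʳ _) ⨾⟨⟩
    ·-cong⟨+⟩ a-𝟙 (go n) ⨾⟨⟩ ≈⇒mod (·-zeroʳ _)

euler-mod5′ : E 1 ≈ 𝟙 · dil 5 A₅ ⊕ (X 1 ↑ 1 · (κ -1ℤ · dil 5 (E 5)) ⊕ (X 1 ↑ 2 · (κ -1ℤ · dil 5 Z₅) ⊕ κ 0ℤ))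
euler-mod5′ = euler-mod5 ⨾ ⊕-cong (·-congˡ X0) (⊕-cong (·-cong (X≈↑ 1) (dil-κ· 4 -1ℤ (E 5))) (⊕-congˡ (·-cong (X≈↑ 2) (dil-κ· 4 -1ℤ Z₅))))

-- The coefficients of q^(5n+2) in (q;q)_∞^3 vanish because no triangular number is 2 modulo 5.
A₅Z₅ : A₅ · Z₅ ≈ E 5 · E 5
A₅Z₅ = solve 2 (λ p q → p := q :- (q :- p)) ≈-refl (A₅ · Z₅) (E 5 · E 5) ⨾ ⊕-congʳ (⊖-cong vanish₂) ⨾
  solve 1 (λ q → q :- :0 := q) ≈-refl (E 5 · E 5)
  where
  a e z : PS
  a = A₅
  e = E 5
  z = Z₅
  cubes : List PS
  cubes = a · a · a ⊕ X 1 · (κ (ℤ.- (+ 3)) · (e · z · z)) ∷ κ (ℤ.- (+ 3)) · (a · a · e) ⊕ X 1 · (κ -1ℤ · (z · z · z)) ∷ κ (+ 3) · (a · (e · e ⊕ ⊖ (a · z)))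
    ∷ κ (+ 6) · (a · e · z) ⊕ κ -1ℤ · (e · e · e) ∷ κ (+ 3) · (a · z · z) ⊕ κ (ℤ.- (+ 3)) · (e · e · z) ∷ []
  D₅ = dil 5
  mul : ∀ f g {f′ g′} → D₅ f ≈ f′ → D₅ g ≈ g′ → D₅ (f · g) ≈ f′ · g′
  mul f g p q = dil-· 4 f g ⨾ ·-cong p q
  scale : ∀ c f {f′} → D₅ f ≈ f′ → D₅ (κ c · f) ≈ κ c · f′
  scale c f p = dil-κ· 4 c f ⨾ ·-congʳ p
  add : ∀ f g {f′ g′} → D₅ f ≈ f′ → D₅ g ≈ g′ → D₅ (f ⊕ g) ≈ f′ ⊕ g′
  add f g p q = dil-⊕ 4 f g ⨾ ⊕-cong p q
  neg : ∀ f {f′} → D₅ f ≈ f′ → D₅ (⊖ f) ≈ κ -1ℤ · f′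
  neg f p = dil-cong 4 (solve 1 (λ f → :- f := con -1ℤ :* f) ≈-refl f) ⨾ scale -1ℤ f p
  shift : ∀ f {f′} → D₅ f ≈ f′ → D₅ (X 1 · f) ≈ X 1 ↑ 5 · f′
  shift f p = dil-X· 4 1 f ⨾ ·-cong (X≈↑ 5) p
  mul₃ : ∀ f g h → D₅ (f · g · h) ≈ D₅ f · D₅ g · D₅ h
  mul₃ f g h = mul (f · g) h (dil-· 4 f g) ≈-refl
  cube : E 1 · E 1 · E 1 ≈ comb 5 0 cubes
  cube = ·-cong (·-cong euler-mod5′ euler-mod5′) euler-mod5′ ⨾ ≈-trans
    (solve 4 (λ x a e z → let f = :1 :* a :+ (x :^ 1 :* (con -1ℤ :* e) :+ (x :^ 2 :* (con -1ℤ :* z) :+ :0)) in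
      f :* f :* f
      := x :^ 0 :* (a :* a :* a :+ x :^ 5 :* (con (ℤ.- (+ 3)) :* (e :* z :* z)))
        :+ (x :^ 1 :* (con (ℤ.- (+ 3)) :* (a :* a :* e) :+ x :^ 5 :* (con -1ℤ :* (z :* z :* z)))
        :+ (x :^ 2 :* (con (+ 3) :* (a :* (e :* e :+ con -1ℤ :* (a :* z))))
        :+ (x :^ 3 :* (con (+ 6) :* (a :* e :* z) :+ con -1ℤ :* (e :* e :* e))
        :+ (x :^ 4 :* (con (+ 3) :* (a :* z :* z) :+ con (ℤ.- (+ 3)) :* (e :* e :* z)) :+ :0))))) ≈-refl (X 1) (D₅ a) (D₅ e) (D₅ z))
    (comb-∷ 0 (≈-sym (add _ _ (mul₃ a a a) (shift _ (scale _ _ (mul₃ e z z)))))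
    (comb-∷ 1 (≈-sym (add _ _ (scale _ _ (mul₃ a a e)) (shift _ (scale _ _ (mul₃ z z z)))))
    (comb-∷ 2 (≈-sym (scale _ _ (mul a _ ≈-refl (add _ _ (dil-· 4 e e) (neg _ (dil-· 4 a z))))))
    (comb-∷ 3 (≈-sym (add _ _ (scale _ _ (mul₃ a e z)) (scale _ _ (mul₃ e e e))))
    (comb-∷ 4 (≈-sym (add _ _ (scale _ _ (mul₃ a z z)) (scale _ _ (mul₃ e e z)))) ≈-refl)))))
  a₀ : a 0 ≡ 1ℤ
  a₀ = sym (comb-at 4 (a ∷ κ -1ℤ · E 5 ∷ κ -1ℤ · Z₅ ∷ []) 0 0 (s≤s z≤n) (m≤m+n 3 2)) ∙ sym (at euler-mod5 0) ∙ κ-at0 1ℤ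
  -- In the cube of a - q e - q^2 z the exponent 2 modulo 5 is reached only by 3 a e^2 and -3 a^2 z.
  -- The factors 3 and a, whose constant term is 1, are then cancelled.
  zero₂ : κ (+ 3) · (a · (e · e ⊕ ⊖ (a · z))) ≈ κ 0ℤ
  zero₂ = let (f₀ , f₁ , f₃ , q) = cube-mod5 in ptwise λ m → trans (sym (comb-at 4 cubes 2 m (m≤m+n 3 2) ≤-refl))
    (sym (at cube (2 + m * 5)) ∙ at q (2 + m * 5) ∙ comb-at 4 (f₀ ∷ f₁ ∷ κ 0ℤ ∷ f₃ ∷ []) 2 m (m≤m+n 3 2) (m≤m+n 4 1))
  vanish₂ : e · e ⊕ ⊖ (a · z) ≈ κ 0ℤ
  vanish₂ = ·-cancel a₀ (κ-cancel 2 (zero₂ ⨾ ≈-sym (·-zeroʳ (κ (+ 3)))))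

NonNeg₊-A₅ : NonNeg₊ (A₅ · I 1)
NonNeg₊-A₅ = NonNeg₊-resp (≈-sym (·-distribʳ (I 1) _ _)) (NonNeg₊-⊕ (Θ/E1-NonNeg₊ 14 6 7 refl λ ())
  (NonNeg-resp (≈-sym (·-assoc _ _ _)) (NonNeg-· (NonNeg-X 1) (nn (Θ/E1-NonNeg₊ 14 12 1 refl λ ())))))

-- Each class of (q;q)_∞^2 is, up to a constant, a product of two of `A₅`, `E 5`, `Z₅`. Two of the
-- three copies of 1/(q;q)_∞ make these factors nonnegative, the third gives strict positivity.
part7 : ∀ n → let a = etaQ ((1 , 2) ∷ []) ((5 , 3) ∷ []) n in
  (n % 5 ∈ (0 ∷ 3 ∷ 4 ∷ []) → Pos a) × (n % 5 ∈ (1 ∷ 2 ∷ []) → Neg a)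
part7 n = (λ { (here r) → pos-at (n / 5) (coeff-at 0 (m≤m+n 1 4) r) (both NonNeg₊-A₅ NonNeg₊-A₅)
             ; (there (here r)) → pos-at (n / 5) (coeff-at 3 (m≤m+n 4 1) r) (AllPos-resp (≈-sym (·-assoc _ _ _)) (AllPos-κ· 1 (both NonNeg₊-E₅ NonNeg₊-Z₅)))
             ; (there (there (here r))) → pos-at (n / 5) (coeff-at 4 (m≤m+n 5 0) r) (both NonNeg₊-Z₅ NonNeg₊-Z₅) })
        , (λ { (here r) → neg-at 1 (n / 5) (coeff-at 1 (m≤m+n 2 3) r) (·-assoc _ _ _) (both NonNeg₊-A₅ NonNeg₊-E₅)
             ; (there (here r)) → neg-at 0 (n / 5) (coeff-at 2 (m≤m+n 3 2) r) (·-congˡ collapse ⨾ ·-assoc _ _ _) (both NonNeg₊-E₅ NonNeg₊-E₅) })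
  where
  h = I 1 P.^^ 3
  NonNeg₊-E₅ : NonNeg₊ (E 5 · I 1)
  NonNeg₊-E₅ = AllPos⇒NonNeg₊ (AllPos-E/E1 3)
  both : ∀ {f g} → NonNeg₊ (f · I 1) → NonNeg₊ (g · I 1) → AllPos ((f · g) · h)
  both {f} {g} p q = AllPos-resp (solve 3 (λ f g i → (f :* i) :* (g :* i) :* i := (f :* g) :* pw i 3) ≈-refl f g (I 1)) (AllPos-· (NonNeg₊-· p q) AllPos-I1)
  squares : List PS
  squares = A₅ · A₅ ∷ κ (ℤ.- (+ 2)) · (A₅ · E 5) ∷ E 5 · E 5 ⊕ κ (ℤ.- (+ 2)) · (A₅ · Z₅) ∷ κ (+ 2) · (E 5 · Z₅) ∷ Z₅ · Z₅ ∷ []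
  -- Class 2 is a difference of two products; it has a sign because they agree up to the factor 2.
  collapse : E 5 · E 5 ⊕ κ (ℤ.- (+ 2)) · (A₅ · Z₅) ≈ κ -1ℤ · (E 5 · E 5)
  collapse = ⊕-congʳ (·-congʳ A₅Z₅) ⨾ solve 1 (λ f → f :+ con (ℤ.- (+ 2)) :* f := con -1ℤ :* f) ≈-refl (E 5 · E 5)
  D₅ = dil 5
  scaled : ∀ c f g → D₅ (κ c · (f · g)) ≈ κ c · (D₅ f · D₅ g)
  scaled c f g = dil-κ· 4 c _ ⨾ ·-congʳ (dil-· 4 f g)
  square : E 1 · E 1 ≈ comb 5 0 squares
  square = ·-cong euler-mod5′ euler-mod5′ ⨾ ≈-trans
    (solve 4 (λ x a e z → let f = :1 :* a :+ (x :^ 1 :* (con -1ℤ :* e) :+ (x :^ 2 :* (con -1ℤ :* z) :+ :0)) in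
      f :* f
      := x :^ 0 :* (a :* a) :+ (x :^ 1 :* (con (ℤ.- (+ 2)) :* (a :* e)) :+ (x :^ 2 :* (e :* e :+ con (ℤ.- (+ 2)) :* (a :* z))
        :+ (x :^ 3 :* (con (+ 2) :* (e :* z)) :+ (x :^ 4 :* (z :* z) :+ :0))))) ≈-refl (X 1) (D₅ A₅) (D₅ (E 5)) (D₅ Z₅))
    (comb-∷ 0 (≈-sym (dil-· 4 _ _)) (comb-∷ 1 (≈-sym (scaled _ _ _))
      (comb-∷ 2 (≈-sym (dil-⊕ 4 _ _ ⨾ ⊕-cong (dil-· 4 _ _) (scaled _ _ _)))
      (comb-∷ 3 (≈-sym (scaled _ _ _)) (comb-∷ 4 (≈-sym (dil-· 4 _ _)) ≈-refl)))))
  eq = dissect-· 4 squares (etaQ₁ 1 2 5 3 ⨾ ·-congˡ (solve 1 (λ e → pw e 2 := e :* e) ≈-refl (E 1))) square (I^^-dil 4 3)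
  coeff-at = λ r → coefficient 4 r n eq ≤-refl

-- The norm of a power series over the subring of series in q^3

-- The determinant of multiplication by f(q^3) + q g(q^3) + q^2 h(q^3) over series in q^3, with q^3
-- renamed q; equally the product of f + ω q^(1/3) g + ω^2 q^(2/3) h over the cube roots of unity ω.
-- The polynomial form avoids adjoining ω.
norm : PS → PS → PS → PS
norm f g h = f · f · f ⊕ X 1 · (g · g · g) ⊕ X 1 · X 1 · (h · h · h) ⊕ ⊖ (κ (+ 3) · X 1 · f · g · h)

comb₃ : PS → PS → PS → PS
comb₃ f g h = comb 3 0 (f ∷ g ∷ h ∷ [])

comb₃-· : ∀ a₀ a₁ a₂ b₀ b₁ b₂ → comb₃ a₀ a₁ a₂ · comb₃ b₀ b₁ b₂ ≈
  comb₃ (a₀ · b₀ ⊕ X 1 · (a₁ · b₂ ⊕ a₂ · b₁)) (a₀ · b₁ ⊕ a₁ · b₀ ⊕ X 1 · (a₂ · b₂)) (a₀ · b₂ ⊕ a₁ · b₁ ⊕ a₂ · b₀)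
comb₃-· a₀ a₁ a₂ b₀ b₁ b₂ = ·-cong (expand a₀ a₁ a₂) (expand b₀ b₁ b₂) ⨾ ≈-trans
  (solve 7 (λ x a₀ a₁ a₂ b₀ b₁ b₂ →
      (x :^ 0 :* a₀ :+ (x :^ 1 :* a₁ :+ (x :^ 2 :* a₂ :+ :0))) :* (x :^ 0 :* b₀ :+ (x :^ 1 :* b₁ :+ (x :^ 2 :* b₂ :+ :0)))
      := x :^ 0 :* (a₀ :* b₀ :+ x :^ 3 :* (a₁ :* b₂ :+ a₂ :* b₁)) :+ (x :^ 1 :* (a₀ :* b₁ :+ a₁ :* b₀ :+ x :^ 3 :* (a₂ :* b₂))
        :+ (x :^ 2 :* (a₀ :* b₂ :+ a₁ :* b₁ :+ a₂ :* b₀) :+ :0))) ≈-refl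
    (X 1) (D₃ a₀) (D₃ a₁) (D₃ a₂) (D₃ b₀) (D₃ b₁) (D₃ b₂))
  (comb-∷ 0 (≈-sym (dil-⊕ 2 _ _ ⨾ ⊕-cong (dil-· 2 _ _) (shift _ (sum _ _ (dil-· 2 _ _) (dil-· 2 _ _)))))
  (comb-∷ 1 (≈-sym (sum _ _ (sum _ _ (dil-· 2 _ _) (dil-· 2 _ _)) (shift _ (dil-· 2 _ _))))
  (comb-∷ 2 (≈-sym (sum _ _ (sum _ _ (dil-· 2 _ _) (dil-· 2 _ _)) (dil-· 2 _ _))) ≈-refl)))
  where
  D₃ = dil 3
  expand : ∀ f g h → comb₃ f g h ≈ X 1 ↑ 0 · D₃ f ⊕ (X 1 ↑ 1 · D₃ g ⊕ (X 1 ↑ 2 · D₃ h ⊕ κ 0ℤ))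
  expand f g h = ⊕-cong (·-congˡ (X≈↑ 0)) (⊕-cong (·-congˡ (X≈↑ 1)) (⊕-congˡ (·-congˡ (X≈↑ 2))))
  sum : ∀ f g {f′ g′} → D₃ f ≈ f′ → D₃ g ≈ g′ → D₃ (f ⊕ g) ≈ f′ ⊕ g′
  sum f g p q = dil-⊕ 2 f g ⨾ ⊕-cong p q
  shift : ∀ f {f′} → D₃ f ≈ f′ → D₃ (X 1 · f) ≈ X 1 ↑ 3 · f′
  shift f p = dil-X· 2 1 f ⨾ ·-cong (X≈↑ 3) p

record HasNorm (f g : PS) : Set where
  constructor hasNorm
  field
    {f₀ f₁ f₂} : PS
    parts  : f ≈ comb₃ f₀ f₁ f₂
    norm≈ : norm f₀ f₁ f₂ ≈ g

HasNorm-resp : ∀ {f f′ g g′} → f ≈ f′ → g ≈ g′ → HasNorm f g → HasNorm f′ g′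
HasNorm-resp e d (hasNorm p n) = hasNorm (≈-sym e ⨾ p) (n ⨾ d)

HasNorm-· : ∀ {f f′ g g′} → HasNorm f g → HasNorm f′ g′ → HasNorm (f · f′) (g · g′)
HasNorm-· (hasNorm {a₀} {a₁} {a₂} p n) (hasNorm {b₀} {b₁} {b₂} p′ n′) = hasNorm (·-cong p p′ ⨾ comb₃-· a₀ a₁ a₂ b₀ b₁ b₂)
  (≈-sym (solve 7 (λ x a₀ a₁ a₂ b₀ b₁ b₂ →
    let N = λ f g h → f :* f :* f :+ x :* (g :* g :* g) :+ x :* x :* (h :* h :* h) :- con (+ 3) :* x :* f :* g :* h in
    N a₀ a₁ a₂ :* N b₀ b₁ b₂ := N (a₀ :* b₀ :+ x :* (a₁ :* b₂ :+ a₂ :* b₁)) (a₀ :* b₁ :+ a₁ :* b₀ :+ x :* (a₂ :* b₂)) (a₀ :* b₂ :+ a₁ :* b₁ :+ a₂ :* b₀)) ≈-refl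
    (X 1) a₀ a₁ a₂ b₀ b₁ b₂) ⨾ ·-cong n n′)

-- Precision q^(3n) fixes the three parts modulo q^n, hence also the norm. This carries norms
-- through infinite products and shows that a series has only one norm.
HasNorm-unique⟨⟩ : ∀ {n f f′ g g′} → HasNorm f g → HasNorm f′ g′ → f ≈⟨ n * 3 ⟩ f′ → g ≈⟨ n ⟩ g′
HasNorm-unique⟨⟩ {n} {f} {f′} (hasNorm {a₀} {a₁} {a₂} p ν) (hasNorm {b₀} {b₁} {b₂} p′ ν′) e =
  mod-trans (≈⇒mod (≈-sym ν)) (norm-cong (part 0 (m≤m+n 1 2)) (part 1 (m≤m+n 2 1)) (part 2 ≤-refl) ⨾⟨⟩ ≈⇒mod ν′)
  where
  as bs : List PS
  as = a₀ ∷ a₁ ∷ a₂ ∷ []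
  bs = b₀ ∷ b₁ ∷ b₂ ∷ []
  part : ∀ r → r < 3 → nth as r ≈⟨ n ⟩ nth bs r
  part r r<3 = below λ m m<n → trans (sym (comb-at 2 as r m r<3 ≤-refl)) (sym (at p _) ∙ trans
    (coeff e (r + m * 3) (≤-trans (ℕP.+-monoˡ-< (m * 3) r<3) (ℕP.*-monoˡ-≤ 3 m<n))) (at p′ _ ∙ comb-at 2 bs r m r<3 ≤-refl))
  norm-cong : ∀ {f f′ g g′ h h′} → f ≈⟨ n ⟩ f′ → g ≈⟨ n ⟩ g′ → h ≈⟨ n ⟩ h′ → norm f g h ≈⟨ n ⟩ norm f′ g′ h′
  norm-cong {f} {f′} {g} {g′} {h} {h′} p q r = ⊕-cong⟨⟩ (⊕-cong⟨⟩ (⊕-cong⟨⟩ (cube p) (·-cong⟨⟩ʳ (cube q))) (·-cong⟨⟩ʳ (cube r)))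
    (⊖-cong⟨⟩ (·-cong⟨⟩ (·-cong⟨⟩ (·-cong⟨⟩ʳ p) q) r))
    where
    cube : ∀ {f f′} → f ≈⟨ n ⟩ f′ → f · f · f ≈⟨ n ⟩ f′ · f′ · f′
    cube p = ·-cong⟨⟩ (·-cong⟨⟩ p p) p

HasNorm-unique : ∀ {f g g′} → HasNorm f g → HasNorm f g′ → g ≈ g′
HasNorm-unique p q = mod⇒≈ λ n → HasNorm-unique⟨⟩ {n} p q mod-refl

-- For j prime to 3 the conjugates 1 - ω^k q^j multiply to 1 - q^(3j), which is 1 - q^j again after
-- q^3 ↦ q.
HasNorm-om₁ : ∀ i → HasNorm (om (1 + i * 3)) (om (1 + 3 * i))
HasNorm-om₁ i = hasNorm {f₀ = 𝟙} {f₁ = κ -1ℤ · X i} {f₂ = κ 0ℤ}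
  (⊕-congʳ (⊖-cong (X-+ 1 (i * 3))) ⨾ ≈-trans
    (solve 2 (λ x y → :1 :- x :* y := x :^ 0 :* :1 :+ (x :^ 1 :* (con -1ℤ :* y) :+ (x :^ 2 :* :0 :+ :0))) ≈-refl (X 1) (X (i * 3)))
    (comb-∷ 0 (≈-sym (dil-κ 2 1ℤ)) (comb-∷ 1 (≈-sym (dil-κ· 2 -1ℤ _ ⨾ ·-congʳ (dil-X 2 i))) (comb-∷ 2 (≈-sym (dil-κ 2 0ℤ)) ≈-refl))))
  (solve 2 (λ x y → let f = :1 ; g = con -1ℤ :* y ; h = :0 in
      f :* f :* f :+ x :* (g :* g :* g) :+ x :* x :* (h :* h :* h) :- con (+ 3) :* x :* f :* g :* h := :1 :- x :* (y :* y :* y)) ≈-refl (X 1) (X i) ⨾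
    ⊕-congʳ (⊖-cong (≈-sym (X-+ 1 (3 * i) ⨾ ·-congʳ (X-triple i)))))
  where
  X-triple : ∀ i → X (3 * i) ≈ X i · X i · X i
  X-triple i = ≈-cong X (arith i) ⨾ X-+ (i + i) i ⨾ ·-congˡ (X-+ i i)
    where
    arith : ∀ i → 3 * i ≡ i + i + i
    arith = solve-∀

HasNorm-om₂ : ∀ i → HasNorm (om (2 + i * 3)) (om (2 + 3 * i))
HasNorm-om₂ i = hasNorm {f₀ = 𝟙} {f₁ = κ 0ℤ} {f₂ = κ -1ℤ · X i}
  (⊕-congʳ (⊖-cong (X-+ 2 (i * 3) ⨾ ·-congˡ (X≈↑ 2))) ⨾ ≈-trans
    (solve 2 (λ x y → :1 :- x :^ 2 :* y := x :^ 0 :* :1 :+ (x :^ 1 :* :0 :+ (x :^ 2 :* (con -1ℤ :* y) :+ :0))) ≈-refl (X 1) (X (i * 3)))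
    (comb-∷ 0 (≈-sym (dil-κ 2 1ℤ)) (comb-∷ 1 (≈-sym (dil-κ 2 0ℤ)) (comb-∷ 2 (≈-sym (dil-κ· 2 -1ℤ _ ⨾ ·-congʳ (dil-X 2 i))) ≈-refl))))
  (solve 2 (λ x y → let f = :1 ; g = :0 ; h = con -1ℤ :* y in
      f :* f :* f :+ x :* (g :* g :* g) :+ x :* x :* (h :* h :* h) :- con (+ 3) :* x :* f :* g :* h := :1 :- (x :* x) :* (y :* y :* y)) ≈-refl (X 1) (X i) ⨾
    ⊕-congʳ (⊖-cong (≈-sym (≈-cong X (arith i) ⨾ X-+ 2 (i + i + i) ⨾ ·-cong (X-+ 1 1) (X-+ (i + i) i ⨾ ·-congˡ (X-+ i i))))))
  where
  arith : ∀ i → 2 + 3 * i ≡ 2 + (i + i + i)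
  arith = solve-∀

-- The exponent is divisible by 3, so the conjugates coincide and the norm is a cube.
HasNorm-om₃ : ∀ i → HasNorm (om (i * 3)) (om i · om i · om i)
HasNorm-om₃ i = hasNorm {f₀ = om i} {f₁ = κ 0ℤ} {f₂ = κ 0ℤ}
  (solve 2 (λ x f → f := x :^ 0 :* f :+ (x :^ 1 :* :0 :+ (x :^ 2 :* :0 :+ :0))) ≈-refl (X 1) (om (i * 3)) ⨾
    comb-∷ 0 (≈-sym (dil-om 2 i)) (comb-∷ 1 (≈-sym (dil-κ 2 0ℤ)) (comb-∷ 2 (≈-sym (dil-κ 2 0ℤ)) ≈-refl)))
  (solve 2 (λ x f → let g = :0 ; h = :0 in
      f :* f :* f :+ x :* (g :* g :* g) :+ x :* x :* (h :* h :* h) :- con (+ 3) :* x :* f :* g :* h := f :* f :* f) ≈-refl (X 1) (om i))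

HasNorm-𝟙 : HasNorm 𝟙 𝟙
HasNorm-𝟙 = hasNorm {f₀ = 𝟙} {f₁ = κ 0ℤ} {f₂ = κ 0ℤ}
  (solve 1 (λ x → :1 := x :^ 0 :* :1 :+ (x :^ 1 :* :0 :+ (x :^ 2 :* :0 :+ :0))) ≈-refl (X 1) ⨾
    comb-∷ 0 (≈-sym (dil-κ 2 1ℤ)) (comb-∷ 1 (≈-sym (dil-κ 2 0ℤ)) (comb-∷ 2 (≈-sym (dil-κ 2 0ℤ)) ≈-refl)))
  (solve 1 (λ x → let f = :1 ; g = :0 ; h = :0 in
      f :* f :* f :+ x :* (g :* g :* g) :+ x :* x :* (h :* h :* h) :- con (+ 3) :* x :* f :* g :* h := :1) ≈-refl (X 1))

-- The factors with exponent prime to 3 contribute themselves, that is `E 1` without `E 3`, and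
-- those with exponent 3n contribute the cube of `E 1`. Blocks of three factors match the loss of
-- precision from q^(3n) to q^n.
HasNorm-E1 : ∀ {ν} → HasNorm (E 1) ν → ν · E 3 ≈ E 1 · E 1 · E 1 · E 1
HasNorm-E1 {ν} p = ·-congˡ ν≈ ⨾ ·-congˡ split ⨾
  solve 4 (λ o o′ e f → o :* o′ :* (e :* e :* e) :* f := (:1 :* o :* o′ :* f) :* e :* e :* e) ≈-refl (O 3 1) (O 3 2) (E 1) (E 3) ⨾
    ·-congˡ (·-congˡ (·-congˡ (≈-sym (E1-residues 2 ⨾ ·-congʳ (≈-sym (E≈O 3))))))
  where
  o : ℕ → PS
  o n = om (1 * suc n)
  G : ℕ → PS
  G n = om (1 + 3 * n) · om (2 + 3 * n) · (o n · o n · o n)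
  conv₁ = ·-conv (O-conv 2 0) (O-conv 2 1)
  conv₂ = ·-conv (E-conv 0) (E-conv 0)
  conv₃ = ·-conv conv₂ (E-conv 0)
  split : Lim G ≈ O 3 1 · O 3 2 · (E 1 · E 1 · E 1)
  split = ≈-sym (·-cong (Lim-· (O-conv 2 0) (O-conv 2 1)) (·-congˡ (Lim-· (E-conv 0) (E-conv 0)) ⨾ Lim-· conv₂ (E-conv 0)) ⨾ Lim-· conv₁ conv₃)
  block-norm : ∀ n → HasNorm (block 3 o n) (G n)
  block-norm n = HasNorm-resp ≈-refl (·-congˡ (·-congˡ (·-idˡ _)))
    (HasNorm-· (HasNorm-· (HasNorm-· HasNorm-𝟙 (factor (HasNorm-om₁ n))) (factor (HasNorm-om₂ n)))
      (HasNorm-resp (index (3 + n * 3)) (·-cong (·-cong (index (suc n)) (index (suc n))) (index (suc n))) (HasNorm-om₃ (suc n))))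
    where
    index : ∀ j → om j ≈ om (1 * j)
    index j = ≈-cong om (sym (ℕP.*-identityˡ j))
    factor : ∀ {j g} → HasNorm (om j) g → HasNorm (om (1 * j)) g
    factor {j} = HasNorm-resp (index j) ≈-refl
  ∏-norm : ∀ N → HasNorm (∏ (block 3 o) N) (∏ G N)
  ∏-norm zero    = HasNorm-𝟙
  ∏-norm (suc N) = HasNorm-· (∏-norm N) (block-norm N)
  ν≈ : ν ≈ Lim G
  ν≈ = mod⇒≈ λ n → mod-trans
    (HasNorm-unique⟨⟩ p (∏-norm n) (mod-mono (n≤1+n (n * 3)) (Lim-∏ (E-conv 0) (n * 3)) ⨾⟨⟩ ≈⇒mod (≈-sym (∏-block 3 o n))))
    (mod-sym (mod-mono (n≤1+n n) (Lim-∏ (·-conv conv₁ conv₃) n)))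

-- Ninth powers of (q;q)_∞

c₁ : PS
c₁ = κ (ℤ.- (+ 3)) · C₃

cube-mod3′ : E 1 · E 1 · E 1 ≈ comb₃ P₃ c₁ (κ 0ℤ)
cube-mod3′ = cube-mod3 ⨾ ⊕-congʳ (⊕-congʳ (≈-sym (⊕-congˡ (·-congʳ (dil-κ 2 0ℤ) ⨾ ·-zeroʳ _) ⨾ ⊕-idˡ _)))

-- Two evaluations of the norm of (q;q)_∞^3: from its dissection, and as the cube of the norm of
-- (q;q)_∞.
cubic-identity : norm P₃ c₁ (κ 0ℤ) ≈ E 1 P.^^ 12 · I 3 P.^^ 3
cubic-identity = HasNorm-unique (hasNorm cube-mod3′ ≈-refl) (HasNorm-· (HasNorm-· E1ν E1ν) E1ν) ⨾
  solve 1 (λ v → v :* v :* v := (v :* :1) :* (v :* :1) :* (v :* :1)) ≈-refl ν ⨾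
  ·-cong (·-cong step step) step ⨾
    solve 2 (λ e i → (e :* e :* e :* e :* i) :* (e :* e :* e :* e :* i) :* (e :* e :* e :* e :* i) := pw e 12 :* pw i 3) ≈-refl (E 1) (I 3)
  where
  ν = norm (Θ 9 4 5) (κ -1ℤ · Θ 9 7 2) (κ -1ℤ · Θ 9 8 1)
  E1ν : HasNorm (E 1) ν
  E1ν = hasNorm euler-mod3 ≈-refl
  step : ν · 𝟙 ≈ E 1 · E 1 · E 1 · E 1 · I 3
  step = ·-congʳ (≈-sym (E·I 2)) ⨾ ≈-sym (·-assoc _ _ _) ⨾ ·-congˡ (HasNorm-E1 E1ν)

-- The cube of a series with classes p, c, 0 has class 0 equal to p^3 + q c^3. This is also the
-- norm, whose mixed term vanishes with the third part.
ninth-power : E 1 P.^^ 9 ≈ comb₃ (norm P₃ c₁ (κ 0ℤ)) (κ (ℤ.- (+ 9)) · (P₃ · P₃ · C₃)) (κ (+ 27) · (P₃ · C₃ · C₃))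
ninth-power = solve 1 (λ e → pw e 9 := (e :* e :* e) :* (e :* e :* e) :* (e :* e :* e)) ≈-refl (E 1) ⨾
  ·-cong (·-cong cube-mod3′ cube-mod3′ ⨾ comb₃-· P₃ c₁ (κ 0ℤ) P₃ c₁ (κ 0ℤ)) cube-mod3′ ⨾
  comb₃-· _ _ _ P₃ c₁ (κ 0ℤ) ⨾
    ⊕-cong (·-congʳ (dil-cong 2 class₀)) (⊕-cong (·-congʳ (dil-cong 2 class₁)) (⊕-congˡ (·-congʳ (dil-cong 2 class₂))))
  where
  z = κ 0ℤ
  class₀ : (P₃ · P₃ ⊕ X 1 · (c₁ · z ⊕ z · c₁)) · P₃ ⊕ X 1 · ((P₃ · c₁ ⊕ c₁ · P₃ ⊕ X 1 · (z · z)) · z ⊕ (P₃ · z ⊕ c₁ · c₁ ⊕ z · P₃) · c₁) ≈ norm P₃ c₁ z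
  class₀ = solve 3 (λ x p c → let z = :0 in
    (p :* p :+ x :* (c :* z :+ z :* c)) :* p :+ x :* ((p :* c :+ c :* p :+ x :* (z :* z)) :* z :+ (p :* z :+ c :* c :+ z :* p) :* c)
    := p :* p :* p :+ x :* (c :* c :* c) :+ x :* x :* (z :* z :* z) :- con (+ 3) :* x :* p :* c :* z) ≈-refl (X 1) P₃ c₁
  class₁ : (P₃ · P₃ ⊕ X 1 · (c₁ · z ⊕ z · c₁)) · c₁ ⊕ (P₃ · c₁ ⊕ c₁ · P₃ ⊕ X 1 · (z · z)) · P₃ ⊕ X 1 · ((P₃ · z ⊕ c₁ · c₁ ⊕ z · P₃) · z) ≈ κ (ℤ.- (+ 9)) · (P₃ · P₃ · C₃)
  class₁ = solve 3 (λ x p d → let z = :0 ; c = con (ℤ.- (+ 3)) :* d in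
    (p :* p :+ x :* (c :* z :+ z :* c)) :* c :+ (p :* c :+ c :* p :+ x :* (z :* z)) :* p :+ x :* ((p :* z :+ c :* c :+ z :* p) :* z)
    := con (ℤ.- (+ 9)) :* (p :* p :* d)) ≈-refl (X 1) P₃ C₃
  class₂ : (P₃ · P₃ ⊕ X 1 · (c₁ · z ⊕ z · c₁)) · z ⊕ (P₃ · c₁ ⊕ c₁ · P₃ ⊕ X 1 · (z · z)) · c₁ ⊕ (P₃ · z ⊕ c₁ · c₁ ⊕ z · P₃) · P₃ ≈ κ (+ 27) · (P₃ · C₃ · C₃)
  class₂ = solve 3 (λ x p d → let z = :0 ; c = con (ℤ.- (+ 3)) :* d in
    (p :* p :+ x :* (c :* z :+ z :* c)) :* z :+ (p :* c :+ c :* p :+ x :* (z :* z)) :* c :+ (p :* z :+ c :* c :+ z :* p) :* p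
    := con (+ 27) :* (p :* d :* d)) ≈-refl (X 1) P₃ C₃

module NinthPower (j : ℕ) where

  h g₀ g₁ g₂ : PS
  h  = I 1 P.^^ (9 + j)
  g₀ = norm P₃ c₁ (κ 0ℤ) · h
  g₁ = κ (ℤ.- (+ 9)) · (P₃ · P₃ · C₃) · h
  g₂ = κ (+ 27) · (P₃ · C₃ · C₃) · h

  dissected : Dissection 3 (etaQ ((1 , 9) ∷ []) ((3 , 9 + j) ∷ [])) (g₀ ∷ g₁ ∷ g₂ ∷ [])
  dissected = dissect-· 2 (norm P₃ c₁ (κ 0ℤ) ∷ κ (ℤ.- (+ 9)) · (P₃ · P₃ · C₃) ∷ κ (+ 27) · (P₃ · C₃ · C₃) ∷ [])
    (etaQ₁ 1 9 3 (9 + j)) ninth-power (I^^-dil 2 (9 + j))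

  private
    regroup : ∀ {p q r} → NonNeg₊ (p · (I 1 · I 1)) → NonNeg₊ (q · (I 1 · I 1)) → NonNeg₊ (r · (I 1 · I 1)) → AllPos ((p · q · r) · h)
    regroup {p} {q} {r} a b c = AllPos-resp
      (solve 5 (λ p q r i k → ((p :* (i :* i)) :* (q :* (i :* i)) :* (r :* (i :* i)) :* (k :* i :* i)) :* i := (p :* q :* r) :* (k :* i :* i :* i :* i :* i :* i :* i :* i :* i)) ≈-refl p q r (I 1) (I 1 P.^^ j))
      (AllPos-· (NonNeg₊-· (NonNeg₊-· (NonNeg₊-· a b) c) (NonNeg₊-· (NonNeg₊-· (NonNeg₊-^^ NonNeg₊-I1 j) NonNeg₊-I1) NonNeg₊-I1)) AllPos-I1)
    P⁺ : NonNeg₊ (P₃ · (I 1 · I 1))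
    P⁺ = AllPos⇒NonNeg₊ AllPos-P₃
    C⁺ : NonNeg₊ (C₃ · (I 1 · I 1))
    C⁺ = AllPos⇒NonNeg₊ AllPos-C₃

  neg₁ : ∀ n → n % 3 ≡ 1 → Neg (etaQ ((1 , 9) ∷ []) ((3 , 9 + j) ∷ []) n)
  neg₁ n r = neg-at 8 (n / 3) (coefficient 2 1 n dissected ≤-refl (m≤m+n 2 1) r) (·-assoc _ _ _) (regroup P⁺ P⁺ C⁺)

  pos₂ : ∀ n → n % 3 ≡ 2 → Pos (etaQ ((1 , 9) ∷ []) ((3 , 9 + j) ∷ []) n)
  pos₂ n r = pos-at (n / 3) (coefficient 2 2 n dissected ≤-refl ≤-refl r) (AllPos-resp (≈-sym (·-assoc _ _ _)) (AllPos-κ· 26 (regroup P⁺ C⁺ C⁺)))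

  class₀ : ∀ i n {gs} → n % 9 ≡ i * 3 → i < 3 → Dissection 3 g₀ gs → length gs ≤ 3 →
    etaQ ((1 , 9) ∷ []) ((3 , 9 + j) ∷ []) n ≡ nth gs i (n / 9)
  class₀ i n {gs} r i<3 e le = coefficient-9 0 i n dissected ≤-refl (m≤m+n 1 2) r ∙
    at (≈comb e) _ ∙ comb-at 2 gs i (n / 9) i<3 le

  -- Nine of the twelve factors `E 1` in `cubic-identity` cancel. The eta quotient that is left has
  -- a denominator in q^3 and can be dissected modulo 3 again, which is how residues modulo 9 arise.
  g₀≈ : g₀ ≈ E 1 P.^^ 3 · I 3 P.^^ 3 · I 1 P.^^ j
  g₀≈ = ·-congˡ cubic-identity ⨾ ≈-trans
    (solve 4 (λ e i f k → pw e 12 :* pw f 3 :* (k :* i :* i :* i :* i :* i :* i :* i :* i :* i) := pw (e :* i) 9 :* (pw e 3 :* pw f 3 :* k)) ≈-refl (E 1) (I 1) (I 3) (I 1 P.^^ j))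
    (EI-cancel 9 _)

private
  %9⇒%3 : ∀ n r → n % 9 ≡ r → n % 3 ≡ r % 3
  %9⇒%3 n r e = cong (_% 3) (m≡m%n+[m/n]*n n 9 ∙ cong (_+ (n / 9) * 9) e ∙ arith r (n / 9)) ∙ [m+kn]%n≡m%n r ((n / 9) * 3) 3
    where
    arith : ∀ r q → r + q * 9 ≡ r + q * 3 * 3
    arith = solve-∀

part8 : ∀ n → let a = etaQ ((1 , 9) ∷ []) ((3 , 9) ∷ []) n in
  (n % 9 ∈ (0 ∷ 2 ∷ 5 ∷ 8 ∷ []) → Pos a) × (n % 9 ∈ (1 ∷ 3 ∷ 4 ∷ 7 ∷ []) → Neg a) × (n % 9 ≡ 6 → Zero a)
part8 n = (λ { (here r) → pos-at (n / 9) (N.class₀ 0 n r (m≤m+n 1 2) eq le) (AllPos-P₃-quotient 1)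
             ; (there (here r)) → N.pos₂ n (%9⇒%3 n 2 r)
             ; (there (there (here r))) → N.pos₂ n (%9⇒%3 n 5 r)
             ; (there (there (there (here r)))) → N.pos₂ n (%9⇒%3 n 8 r) })
        , (λ { (here r) → N.neg₁ n (%9⇒%3 n 1 r)
             ; (there (here r)) → neg-at 2 (n / 9) (N.class₀ 1 n r (m≤m+n 2 1) eq le) (·-assoc _ _ _) (AllPos-C₃-quotient 1)
             ; (there (there (here r))) → N.neg₁ n (%9⇒%3 n 4 r)
             ; (there (there (there (here r)))) → N.neg₁ n (%9⇒%3 n 7 r) })
        , (λ r → zero-at (n / 9) (N.class₀ 2 n r (m≤m+n 3 0) eq le) ≈-refl)
  where
  module N = NinthPower 0
  le = m≤m+n 2 1
  eq = cube-quotient 1 (N.g₀≈ ⨾ solve 2 (λ e f → pw e 3 :* pw f 3 :* :1 := e :* e :* e :* pw f 3) ≈-refl (E 1) (I 3))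

part9a : ∀ n → let a = etaQ ((1 , 9) ∷ []) ((3 , 11) ∷ []) n in
  (n % 9 ∈ (0 ∷ 2 ∷ 5 ∷ 8 ∷ []) → Pos a) × (n % 9 ∈ (1 ∷ 3 ∷ 4 ∷ 6 ∷ 7 ∷ []) → Neg a)
part9a n = (λ { (here r) → pos-at (n / 9) (N.class₀ 0 n r (m≤m+n 1 2) eq ≤-refl) (pos (Θ/E1-NonNeg₊ 8 3 4 refl λ ()))
              ; (there (here r)) → N.pos₂ n (%9⇒%3 n 2 r)
              ; (there (there (here r))) → N.pos₂ n (%9⇒%3 n 5 r)
              ; (there (there (there (here r)))) → N.pos₂ n (%9⇒%3 n 8 r) })
         , (λ { (here r) → N.neg₁ n (%9⇒%3 n 1 r)
              ; (there (here r)) → neg-at 0 (n / 9) (N.class₀ 1 n r (m≤m+n 2 1) eq ≤-refl) (·-assoc _ _ _) (pos (Θ/E1-NonNeg₊ 8 6 1 refl λ ()))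
              ; (there (there (here r))) → N.neg₁ n (%9⇒%3 n 4 r)
              ; (there (there (there (here r)))) → neg-at 0 (n / 9) (N.class₀ 2 n r (m≤m+n 3 0) eq ≤-refl) (·-assoc _ _ _) (pos (Θ/E1-NonNeg₊ 8 7 0 refl λ ()))
              ; (there (there (there (there (here r))))) → N.neg₁ n (%9⇒%3 n 7 r) })
  where
  module N = NinthPower 2
  pos : ∀ {f} → NonNeg₊ (f · I 1) → AllPos (f · I 1 P.^^ 3)
  pos {f} p = AllPos-resp (solve 2 (λ f i → i :* (f :* i) :* i := f :* pw i 3) ≈-refl f (I 1)) (AllPos-· (NonNeg₊-· NonNeg₊-I1 p) AllPos-I1)
  eq = dissect-· 2 (Θ 9 4 5 ∷ κ -1ℤ · Θ 9 7 2 ∷ κ -1ℤ · Θ 9 8 1 ∷ [])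
    (N.g₀≈ ⨾ solve 3 (λ e f i → pw e 3 :* f :* pw i 2 := pw (e :* i) 2 :* (e :* f)) ≈-refl (E 1) (I 3 P.^^ 3) (I 1) ⨾ EI-cancel 2 _)
    euler-mod3 (I^^-dil 2 3)

part9b : ∀ n → let a = etaQ ((1 , 9) ∷ []) ((3 , 12) ∷ []) n in
  (n % 9 ∈ (0 ∷ 2 ∷ 5 ∷ 8 ∷ []) → Pos a) × (n % 9 ∈ (1 ∷ 4 ∷ 7 ∷ []) → Neg a) × (n % 9 ∈ (3 ∷ 6 ∷ []) → Zero a)
part9b n = (λ { (here r) → pos-at (n / 9) (N.class₀ 0 n r (m≤m+n 1 2) eq le) pos
              ; (there (here r)) → N.pos₂ n (%9⇒%3 n 2 r)
              ; (there (there (here r))) → N.pos₂ n (%9⇒%3 n 5 r)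
              ; (there (there (there (here r)))) → N.pos₂ n (%9⇒%3 n 8 r) })
         , (λ { (here r) → N.neg₁ n (%9⇒%3 n 1 r)
              ; (there (here r)) → N.neg₁ n (%9⇒%3 n 4 r)
              ; (there (there (here r))) → N.neg₁ n (%9⇒%3 n 7 r) })
         , (λ { (here r) → zero-at (n / 9) (N.class₀ 1 n r (m≤m+n 2 1) eq le) ≈-refl
              ; (there (here r)) → zero-at (n / 9) (N.class₀ 2 n r (m≤m+n 3 0) eq le) ≈-refl })
  where
  module N = NinthPower 3
  le = m≤m+n 1 2
  pos : AllPos (𝟙 · I 1 P.^^ 3)
  pos = AllPos-· (NonNeg₊-κ 0) (AllPos-· (NonNeg₊-^^ NonNeg₊-I1 2) AllPos-I1)
  eq = dissect-· 2 (𝟙 ∷ [])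
    (N.g₀≈ ⨾ solve 3 (λ e f i → pw e 3 :* f :* pw i 3 := pw (e :* i) 3 :* f) ≈-refl (E 1) (I 3 P.^^ 3) (I 1) ⨾
      EI-cancel 3 _ ⨾ ≈-sym (·-idˡ _))
    (≈-sym (⊕-congˡ (·-cong X0 (dil-κ 2 1ℤ)) ⨾ solve 0 (:1 :* :1 :+ :0 := :1) ≈-refl))
    (I^^-dil 2 3)

part9c : ∀ i → 12 < i → ∀ n → let a = etaQ ((1 , 9) ∷ []) ((3 , i) ∷ []) n in
  (n % 3 ∈ (0 ∷ 2 ∷ []) → Pos a) × (n % 3 ≡ 1 → Neg a)
part9c i 12<i = subst (λ i → ∀ n → let a = etaQ ((1 , 9) ∷ []) ((3 , i) ∷ []) n in
    (n % 3 ∈ (0 ∷ 2 ∷ []) → Pos a) × (n % 3 ≡ 1 → Neg a)) (ℕP.m+[n∸m]≡n 12<i) λ n →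
    (λ { (here r) → pos-at (n / 3) (coefficient 2 0 n N.dissected ≤-refl (m≤m+n 1 2) r) pos
       ; (there (here r)) → N.pos₂ n r })
  , N.neg₁ n
  where
  j = i ∸ 13
  module N = NinthPower (4 + j)
  pos : AllPos N.g₀
  pos = AllPos-resp (≈-sym (N.g₀≈ ⨾ ≈-trans
      (solve 4 (λ e f i k → pw e 3 :* f :* (k :* i :* i :* i :* i) := pw (e :* i) 3 :* (f :* k :* i)) ≈-refl (E 1) (I 3 P.^^ 3) (I 1) (I 1 P.^^ j))
      (EI-cancel 3 _)))
    (AllPos-· (NonNeg₊-· (NonNeg₊-^^ (NonNeg₊-I 3) 3) (NonNeg₊-^^ NonNeg₊-I1 j)) AllPos-I1)

-- Congruences and minimal representatives

private
  ∣-∣-cancelˡ : ∀ r a b → ∣ r + a - r + b ∣ ≡ ∣ a - b ∣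
  ∣-∣-cancelˡ zero    a b = refl
  ∣-∣-cancelˡ (suc r) a b = ∣-∣-cancelˡ r a b

  ∣-∣-high : ∀ a k → ∣ a - a + k ∣ ≡ k
  ∣-∣-high zero    k = refl
  ∣-∣-high (suc a) k = ∣-∣-high a k

  %-+* : ∀ a q m → (a + q * suc m) % suc m ≡ a % suc m
  %-+* a q m = [m+kn]%n≡m%n a q (suc m)

mod⇒% : ∀ {m a b} → a ≡ b [mod suc m ] → a % suc m ≡ b % suc m
mod⇒% {m} {a} {b} d with ℕP.≤-total a b
... | inj₁ a≤b = sym (go a b a≤b d)
  where
  go : ∀ a b → a ≤ b → suc m ∣ ∣ a - b ∣ → b % suc m ≡ a % suc m
  go a b a≤b (divides q e) = cong (_% suc m) (sym (ℕP.m+[n∸m]≡n a≤b) ∙ cong (_+_ a) (sym (ℕP.m≤n⇒∣m-n∣≡n∸m a≤b) ∙ e)) ∙ %-+* a q m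
... | inj₂ b≤a with d
...   | divides q e = cong (_% suc m) (sym (ℕP.m+[n∸m]≡n b≤a) ∙ cong (_+_ b) (sym (ℕP.m≤n⇒∣n-m∣≡n∸m b≤a) ∙ e)) ∙ %-+* b q m

%⇒mod : ∀ {m a b} → a % suc m ≡ b % suc m → a ≡ b [mod suc m ]
%⇒mod {m} {a} {b} e = divides ∣ a / suc m - b / suc m ∣ (cong₂ ∣_-_∣ (m≡m%n+[m/n]*n a (suc m))
    (m≡m%n+[m/n]*n b (suc m) ∙ cong (_+ b / suc m * suc m) (sym e)) ∙
  ∣-∣-cancelˡ (a % suc m) _ _ ∙ sym (ℕP.*-distribʳ-∣-∣ (suc m) (a / suc m) (b / suc m)))

∣∸⇒% : ∀ {m n i} → i ≤ n → suc m ∣ n ∸ i → n % suc m ≡ i % suc m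
∣∸⇒% {m} {n} {i} i≤n (divides q e) = cong (_% suc m) (sym (ℕP.m+[n∸m]≡n i≤n) ∙ cong (_+_ i) e) ∙ %-+* i q m

%⇒∣∸ : ∀ {m n i} → i ≤ n → n % suc m ≡ i % suc m → suc m ∣ n ∸ i
%⇒∣∸ {m} {n} {i} i≤n e = subst (suc m ∣_) (ℕP.m≤n⇒∣n-m∣≡n∸m i≤n) (%⇒mod {m} {n} {i} e)

minMaybe-just : ∀ {x xs} → x ∈ xs → ∃[ v ] (minMaybe xs ≡ just v × v ∈ xs)
minMaybe-just {xs = y ∷ ys} _ with foldr-selective ℕP.⊓-sel y ys
... | inj₁ e = _ , refl , here e
... | inj₂ p = _ , refl , there p

mapMaybe-∈ : ∀ {g : ℕ → Maybe ℕ} {x v} {xs : List ℕ} → x ∈ xs → g x ≡ just v → v ∈ mapMaybe g xs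
mapMaybe-∈ {g} {xs = y ∷ ys} (here refl) e with g y | e
... | just _ | refl = here refl
mapMaybe-∈ {g} {xs = y ∷ ys} (there p) e with g y
... | just _  = there (mapMaybe-∈ p e)
... | nothing = mapMaybe-∈ p e

≤-foldr-⊔ : ∀ {v xs} → v ∈ xs → v ≤ foldr _⊔_ 0 xs
≤-foldr-⊔ {xs = x ∷ xs} (here refl) = ℕP.m≤m⊔n x _
≤-foldr-⊔ {xs = x ∷ xs} (there p)   = ≤-trans (≤-foldr-⊔ p) (ℕP.m≤n⊔m x _)

-- The minimal representative v of the class of n is at most the maximum over all classes, so v < n
-- + m + 1 by the bound. As v ≡ n modulo m + 1, this forces v ≤ n.
small-representative : ∀ f m R {n x} → x < R → n ≡ f x [mod suc m ] → + maxMinRep f (suc m) R ℤ.- + suc m ℤ.< + n →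
  ∃[ r ] (f r ≤ n × suc m ∣ n ∸ f r)
small-representative f m R {n} {x} x<R d N<n =
  let (v , min≡ , v∈) = minMaybe-just (∈-filter⁺ P? (∈-map⁺ f (∈-upTo⁺ x<R)) fx≡s)
      (v∈′ , v≡s)     = ∈-filter⁻ P? {xs = map f (upTo R)} v∈
      (r , _ , v≡fr)  = ∈-map⁻ f v∈′
      v≤max           = ≤-foldr-⊔ (mapMaybe-∈ {minRep f (suc m) R} (∈-upTo⁺ (m%n<n n (suc m))) min≡)
      v%              = mod⇒% {m} {v} {s} v≡s ∙ s%
      v≤n             = below-n v (≤-<-trans v≤max max<n+m) v%
  in r , subst (_≤ n) v≡fr v≤n , subst (λ t → suc m ∣ n ∸ t) v≡fr (%⇒∣∸ v≤n (sym v%))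
  where
  s = n % suc m
  P? = λ v → suc m ∣? ∣ v - s ∣
  s% : s % suc m ≡ n % suc m
  s% = m<n⇒m%n≡m (m%n<n n (suc m))
  fx≡s : f x ≡ s [mod suc m ]
  fx≡s = %⇒mod {m} {f x} {s} (sym (mod⇒% {m} {n} {f x} d) ∙ sym s%)
  max<n+m : maxMinRep f (suc m) R < n + suc m
  max<n+m = ℤP.drop‿+<+ (subst (ℤ._< + (n + suc m)) (ℤP.+-assoc (+ M) (ℤ.- + suc m) (+ suc m) ∙
      cong (+ M +ᶻ_) (ℤP.+-inverseˡ (+ suc m)) ∙ ℤP.+-identityʳ (+ M)) (ℤP.+-monoˡ-< (+ suc m) N<n))
    where
    M = maxMinRep f (suc m) R
  below-n : ∀ v → v < n + suc m → v % suc m ≡ n % suc m → v ≤ n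
  below-n v v< e with v ℕ.≤? n
  ... | yes p = p
  ... | no ¬p = ⊥-elim (ℕP.<⇒≱ (ℕP.+-cancelˡ-< n _ _ (subst (_< n + suc m) (sym n+d) v<)) (big (%⇒∣∸ n≤v e)))
    where
    n<v = ℕP.≰⇒> ¬p
    n≤v = ℕP.<⇒≤ n<v
    n+d : n + (v ∸ n) ≡ v
    n+d = ℕP.m+[n∸m]≡n n≤v
    big : suc m ∣ v ∸ n → suc m ≤ v ∸ n
    big q = ∣⇒≤ {{ℕ.>-nonZero (ℕP.m<n⇒0<n∸m n<v)}} q

-- Termwise signs of convolutions

opaque
  unfolding _·_

  ·-termwise-0 : ∀ f g n → (∀ i → i ≤ n → f i ≡ 0ℤ ⊎ g (n ∸ i) ≡ 0ℤ) → (f · g) n ≡ 0ℤ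
  ·-termwise-0 f g n z = sum-0 n λ i p → vanishes i (z i p)
    where
    vanishes : ∀ i → f i ≡ 0ℤ ⊎ g (n ∸ i) ≡ 0ℤ → f i *ᶻ g (n ∸ i) ≡ 0ℤ
    vanishes i (inj₁ e) = cong (_*ᶻ g (n ∸ i)) e
    vanishes i (inj₂ e) = cong (f i *ᶻ_) e ∙ ℤP.*-zeroʳ (f i)

  -- Signs of f matter only where g does not vanish: φ(-q) has coefficients of both signs, but only
  -- one sign within a residue class modulo 4.
  ·-termwise-pos : ∀ f {g} n j → NonNeg g → (∀ i → i ≤ n → 0ℤ ℤ.≤ f i ⊎ g (n ∸ i) ≡ 0ℤ) →
    j ≤ n → 0ℤ ℤ.< f j → 0ℤ ℤ.< g (n ∸ j) → 0ℤ ℤ.< (f · g) n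
  ·-termwise-pos f {g} n j q t j≤n fj gj = sum-pos n (λ i p → term≥0 i (t i p)) j j≤n (*-pos fj gj)
    where
    term≥0 : ∀ i → 0ℤ ℤ.≤ f i ⊎ g (n ∸ i) ≡ 0ℤ → 0ℤ ℤ.≤ f i *ᶻ g (n ∸ i)
    term≥0 i (inj₁ p) = *-nonneg p (0≤ q (n ∸ i))
    term≥0 i (inj₂ e) = ℤP.≤-reflexive (sym (cong (f i *ᶻ_) e ∙ ℤP.*-zeroʳ (f i)))

I≈dil : ∀ k → I (suc k) ≈ dil (suc k) (I 1)
I≈dil k = ≈-sym (dil-I k 0 ⨾ ≈-cong I (ℕP.*-identityˡ (suc k)))

I-off : ∀ k {n} → ¬ suc k ∣ n → I (suc k) n ≡ 0ℤ
I-off k {n} ¬d = at (I≈dil k) n ∙ dil-no (suc k) _ ¬d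

I-on : ∀ k {n} → suc k ∣ n → 0ℤ ℤ.< I (suc k) n
I-on k (divides q refl) = subst Pos (sym (at (I≈dil k) _ ∙ dil-at k (I 1) q)) (0< AllPos-I1 q)

-- Supports of theta series

T-square : ∀ j → T j + T j + j ≡ j * j
T-square zero    = refl
T-square (suc j) = arith (T j) j ∙ cong (_+ (j + j + 1)) (T-square j) ∙ arith′ j
  where
  arith : ∀ t j → t + j + (t + j) + suc j ≡ t + t + j + (j + j + 1)
  arith = solve-∀
  arith′ : ∀ j → j * j + (j + j + 1) ≡ suc j * suc j
  arith′ = solve-∀

module _ (b a : ℕ) where

  private
    exponent : ℕ → ℕ
    exponent j = suc b * T j + a * j

    coefficient-1 : ∀ j n → term 1ℤ 1ℤ 0ℤ (suc b) a j n ≡ X (exponent j) n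
    coefficient-1 j n = κ·-at _ _ n ∙ cong (_*ᶻ X (exponent j) n) (cong₂ _*ᶻ_ (ℤP.^-zeroˡ j) (ℤP.+-identityʳ 1ℤ) ∙ ℤP.*-identityˡ 1ℤ) ∙ ℤP.*-identityˡ _

    ∑-zero : ∀ {h : ℕ → PS} {n} N → (∀ j → h j n ≡ 0ℤ) → ∑ h N n ≡ 0ℤ
    ∑-zero {n = n} zero    z = κ0-at n
    ∑-zero {h} {n} (suc N) z = ⊕-at (∑ h N) (h N) n ∙ cong₂ _+ᶻ_ (∑-zero N z) (z N)

    ∑-positive : ∀ {h : ℕ → PS} {n} → (∀ j → NonNeg (h j)) → ∀ N j → j < N → 0ℤ ℤ.< h j n → 0ℤ ℤ.< ∑ h N n
    ∑-positive {h} {n} p (suc N) j (s≤s j≤N) q with ℕP.m≤n⇒m<n∨m≡n j≤N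
    ... | inj₁ j<N  = subst Pos (sym (⊕-at (∑ h N) (h N) n)) (ℤP.+-mono-<-≤ (∑-positive p N j j<N q) (0≤ (p N) n))
    ... | inj₂ refl = subst Pos (sym (⊕-at (∑ h N) (h N) n)) (ℤP.+-mono-≤-< (0≤ (NonNeg-∑ p N) n) q)

  os-off : ∀ {n} → (∀ j → n ≢ suc b * T j + a * j) → θ⁺ (suc b) a n ≡ 0ℤ
  os-off {n} ne = ∑-zero (suc (suc n)) λ j → trans (coefficient-1 j n) (X-off λ e → ne j (sym e))

  os-on : ∀ j → 0ℤ ℤ.< θ⁺ (suc b) a (suc b * T j + a * j)
  os-on j = ∑-positive (λ i → nonNeg λ n → subst (0ℤ ℤ.≤_) (sym (coefficient-1 i n)) (0≤ (NonNeg-X _) n)) _ j (bound j)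
    (subst Pos (sym (coefficient-1 j (exponent j) ∙ X-diag _)) (ℤ.+<+ (s≤s z≤n)))
    where
    bound : ∀ j → j < suc (suc (exponent j))
    bound zero    = s≤s z≤n
    bound (suc j) = s≤s (s≤s (≤-trans (m≤n+m j (T j)) (≤-trans (m≤m+n _ (b * T (suc j))) (m≤m+n _ (a * suc j)))))

tri≡T : ∀ r → tri r ≡ T r + r
tri≡T r = cong (_/ 2) (arith r ∙ cong (_+ r) (sym (T-square r)) ∙ arith′ (T r) r) ∙ m*n/n≡m (T r + r) 2
  where
  arith : ∀ r → r * (r + 1) ≡ r * r + r
  arith = solve-∀
  arith′ : ∀ t r → t + t + r + r ≡ (t + r) * 2
  arith′ = solve-∀

private
  triangular-exponent : ∀ j → 1 * T j + 1 * j ≡ tri j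
  triangular-exponent j = cong₂ _+_ (ℕP.*-identityˡ (T j)) (ℕP.*-identityˡ j) ∙ sym (tri≡T j)

  square-exponent : ∀ j → 2 * T j + 1 * j ≡ j * j
  square-exponent j = arith (T j) j ∙ T-square j
    where
    arith : ∀ t j → 2 * t + 1 * j ≡ t + t + j
    arith = solve-∀

  pronic-exponent : ∀ j → 2 * T j + 2 * j ≡ j * j + j
  pronic-exponent j = arith (T j) j ∙ cong (_+ j) (T-square j)
    where
    arith : ∀ t j → 2 * t + 2 * j ≡ t + t + j + j
    arith = solve-∀

ψ-on : ∀ r → 0ℤ ℤ.< ψ (tri r)
ψ-on r = subst (λ t → 0ℤ ℤ.< ψ t) (triangular-exponent r) (os-on 0 1 r)

ψ-off : ∀ {n} → (∀ r → n ≢ tri r) → ψ n ≡ 0ℤ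
ψ-off ne = os-off 0 1 λ j e → ne j (e ∙ triangular-exponent j)

φ⁺-on : ∀ t → 0ℤ ℤ.< φ⁺ (t * t)
φ⁺-on t = subst Pos (sym (⊕-at (θ⁺ 2 1) _ (t * t))) (ℤP.+-mono-<-≤
  (subst (λ n → 0ℤ ℤ.< θ⁺ 2 1 n) (square-exponent t) (os-on 1 1 t))
  (0≤ (NonNeg-· (NonNeg-· (NonNeg-κ 1) (NonNeg-X 1)) (NonNeg-os 1 2 3)) (t * t)))

-- In positive degree the half m < 0 has the same coefficients as the half m ≥ 0, as `os-head`
-- shows, so both vanish together.
φ⁺-off : ∀ {n} → (∀ t → n ≢ t * t) → φ⁺ n ≡ 0ℤ
φ⁺-off {zero}  ne = ⊥-elim (ne 0 refl)
φ⁺-off {suc n} ne = ⊕-at θ₀ R (suc n) ∙ cong₂ _+ᶻ_ z (sym (at (os-head 1ℤ 1ℤ 0ℤ 1 1) (suc n) ∙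
    ⊕-at 𝟙 R (suc n) ∙ cong (_+ᶻ R (suc n)) (κ-atsuc 1ℤ n) ∙ ℤP.+-identityˡ _) ∙ z)
  where
  θ₀ = θ⁺ 2 1
  R = κ 1ℤ · X 1 · θ⁺ 2 3
  z : θ₀ (suc n) ≡ 0ℤ
  z = os-off 1 1 λ j e → ne j (e ∙ square-exponent j)

ψ²-on : ∀ t → 0ℤ ℤ.< ψ² (t * t + t)
ψ²-on t = subst (λ n → 0ℤ ℤ.< ψ² n) (pronic-exponent t) (os-on 1 2 t)

ψ²-off : ∀ {n} → (∀ t → n ≢ t * t + t) → ψ² n ≡ 0ℤ
ψ²-off ne = os-off 1 2 λ j e → ne j (e ∙ pronic-exponent j)

-- Periodicity of triangular numbers and squares

odd-T : ∀ k → T (1 + k * 2) ≡ k * (1 + k * 2)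
odd-T k = T-+ 1 (k * 2) ∙ cong (λ t → t + 1 * (k * 2)) (T-* k 2) ∙
  arith (T k) k ∙ cong (λ s → 2 * s + k) (T-square k) ∙ arith′ k
  where
  arith : ∀ t k → 2 * 2 * t + 1 * k + 1 * (k * 2) ≡ 2 * (t + t + k) + k
  arith = solve-∀
  arith′ : ∀ k → 2 * (k * k) + k ≡ k * (1 + k * 2)
  arith′ = solve-∀

-- For odd p = 1 + 2k the number `T p` = k p is divisible by p, so triangular numbers have period p
-- modulo p. Modulo 2 the period would be 4.
tri-period : ∀ k s q → let p = 1 + k * 2 in ∃[ c ] (tri (s + q * p) ≡ tri s + c * p)
tri-period k s q = p * T q + k * q + s * q + q , trans (tri≡T (s + q * p)) (cong (_+ (s + q * p)) (T-+ s (q * p) ∙ cong (λ t → T s + t + s * (q * p)) (T-* q p ∙ cong (λ u → p * p * T q + u * q) (odd-T k))) ∙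
  arith (T s) s q p (T q) k ∙ cong (_+ (p * T q + k * q + s * q + q) * p) (sym (tri≡T s)))
  where
  p = 1 + k * 2
  arith : ∀ t s q p u k → t + (p * p * u + k * p * q) + s * (q * p) + (s + q * p) ≡ t + s + (p * u + k * q + s * q + q) * p
  arith = solve-∀

-- Sparse numerators: parts (1) and (2)

prime⇒odd : ∀ {p} → Prime p → 3 ≤ p → ∃[ k ] (p ≡ 1 + k * 2)
prime⇒odd {p} pp 3≤p with p % 2 in e | m%n<n p 2
... | 0 | _ = ⊥-elim (even (prime⇒irreducible pp (divides (p / 2) (m≡m%n+[m/n]*n p 2 ∙ cong (_+ p / 2 * 2) e))))
  where
  even : 2 ≡ 1 ⊎ 2 ≡ p → ⊥
  even (inj₂ refl) = ℕP.<-irrefl refl 3≤p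
... | 1 | _ = p / 2 , trans (m≡m%n+[m/n]*n p 2) (cong (_+ p / 2 * 2) e)
... | suc (suc _) | s≤s (s≤s ())

-- The quotient is ψ(q) / (q^p;q^p)_∞. No summand of the convolution is negative, so one triangular
-- number ≤ n congruent to n suffices for positivity; if none is congruent, every summand is 0.
part1 : (p : ℕ) → Prime p → 3 ≤ p → (n : ℕ) → + maxMinRep tri p p ℤ.- + p ℤ.< + n →
  ((∃[ r ] (r < p × n ≡ tri r [mod p ])) → Pos (etaQ ((2 , 2) ∷ []) ((1 , 1) ∷ (p , 1) ∷ []) n))
  × (¬ (∃[ r ] (r < p × n ≡ tri r [mod p ])) → Zero (etaQ ((2 , 2) ∷ []) ((1 , 1) ∷ (p , 1) ∷ []) n))
part1 p pp 3≤p n N<n with prime⇒odd pp 3≤p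
... | k , refl = (λ { (r , r<p , n≡) → pos (small-representative tri (k * 2) p r<p n≡ N<n) })
               , λ ¬∃ → trans (at eq n) (·-termwise-0 ψ (I p) n λ i i≤n → term-off ¬∃ i i≤n (p ∣? (n ∸ i)))
  where
  eq : etaQ ((2 , 2) ∷ []) ((1 , 1) ∷ (p , 1) ∷ []) ≈ ψ · I p
  eq = etaQ₂ 2 2 1 1 p 1 ⨾ solve 3 (λ e i j → pw e 2 :* (pw i 1 :* pw j 1) := (e :* e) :* i :* j) ≈-refl (E 2) (I 1) (I p) ⨾
    ·-congˡ (·-congˡ (≈-sym ψ-product) ⨾ ·-assoc _ _ _ ⨾ ·-congʳ (E·I 0) ⨾ ·-idʳ ψ)
  pos : ∃[ r ] (tri r ≤ n × p ∣ n ∸ tri r) → Pos (etaQ ((2 , 2) ∷ []) ((1 , 1) ∷ (p , 1) ∷ []) n)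
  pos (r , r≤n , d) = subst Pos (sym (at eq n)) (·-termwise-pos ψ n (tri r) (nn (NonNeg₊-I p)) (λ i _ → inj₁ (0≤ (NonNeg-os 1 1 1) i)) r≤n (ψ-on r) (I-on (k * 2) d))
  term-off : ¬ (∃[ r ] (r < p × n ≡ tri r [mod p ])) → ∀ i → i ≤ n → Dec (p ∣ n ∸ i) → ψ i ≡ 0ℤ ⊎ I p (n ∸ i) ≡ 0ℤ
  term-off ¬∃ i i≤n (no ¬d) = inj₂ (I-off (k * 2) ¬d)
  term-off ¬∃ i i≤n (yes d) = inj₁ (ψ-off λ { r refl → ¬∃ (r % p , m%n<n r p , %⇒mod {k * 2} {n} (∣∸⇒% i≤n d ∙ reduce r)) })
    where
    reduce : ∀ r → tri r % p ≡ tri (r % p) % p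
    reduce r = let (c , e) = tri-period k (r % p) (r / p) in trans (cong (λ t → tri t % p) (m≡m%n+[m/n]*n r p)) (cong (_% p) e ∙ %-+* (tri (r % p)) c (k * 2))

-- The quotient is φ(-q) / (q^(4p);q^(4p))_∞. A summand survives only for i ≡ n modulo 4p, hence
-- modulo 4; squares 0 modulo 4 carry the sign +, squares 1 modulo 4 the sign -, so nothing cancels.
module Part2 (p′ : ℕ) (n : ℕ) (N<n : + maxMinRep (λ r → r * r) (4 * suc p′) (4 * suc p′) ℤ.- + (4 * suc p′) ℤ.< + n) where

  private
    p m m′ : ℕ
    p  = suc p′
    m′ = p′ + 3 * p
    m  = 4 * p
    a : PS
    a = etaQ ((1 , 2) ∷ []) ((2 , 1) ∷ (m , 1) ∷ [])
    f : PS
    f = Θ 2 1 1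

    eq : a ≈ f · I m
    eq = etaQ₂ 1 2 2 1 m 1 ⨾ solve 3 (λ e i j → pw e 2 :* (pw i 1 :* pw j 1) := (e :* e :* i) :* j) ≈-refl (E 1) (I 2) (I m) ⨾
      ·-congˡ (≈-sym φ⁻-quotient)

    fs : List PS
    fs = φ⁺ ∷ κ (ℤ.- (+ 2)) · ψ² ∷ []

    f-at : ∀ s i → s < 4 → f (s + i * 4) ≡ nth fs s i
    f-at s i s<4 = at (φ-mod4 -1ℤ refl) _ ∙ comb-at 3 fs s i s<4 (m≤m+n 2 2)

    split4 : ∀ i {s} → i % 4 ≡ s → i ≡ s + i / 4 * 4
    split4 i e = m≡m%n+[m/n]*n i 4 ∙ cong (_+ i / 4 * 4) e

    m∣⇒4∣ : ∀ {k} → m ∣ k → 4 ∣ k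
    m∣⇒4∣ = ∣-trans (m∣m*n p)

    mod4 : ∀ {x y} → x ≡ y [mod m ] → x % 4 ≡ y % 4
    mod4 {x} {y} d = mod⇒% {3} {x} {y} (m∣⇒4∣ d)

    mod4-∸ : ∀ {i} → i ≤ n → m ∣ n ∸ i → n % 4 ≡ i % 4
    mod4-∸ i≤n d = ∣∸⇒% {3} i≤n (m∣⇒4∣ d)

    even-square odd-square : ∀ u → ℕ
    even-square u = (u * u) * 4
    odd-square u = 1 + (u * u + u) * 4

    data Square (r : ℕ) : Set where
      even : ∀ u → r * r ≡ even-square u → Square r
      odd  : ∀ u → r * r ≡ odd-square u → Square r

    square : ∀ r → Square r
    square r with r % 2 in e | m%n<n r 2
    ... | 0 | _ = even (r / 2) (cong (λ t → t * t) (m≡m%n+[m/n]*n r 2 ∙ cong (_+ r / 2 * 2) e) ∙ arith (r / 2))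
      where
      arith : ∀ u → u * 2 * (u * 2) ≡ u * u * 4
      arith = solve-∀
    ... | 1 | _ = odd (r / 2) (cong (λ t → t * t) (m≡m%n+[m/n]*n r 2 ∙ cong (_+ r / 2 * 2) e) ∙ arith (r / 2))
      where
      arith : ∀ u → (1 + u * 2) * (1 + u * 2) ≡ 1 + (u * u + u) * 4
      arith = solve-∀
    ... | suc (suc _) | s≤s (s≤s ())

    even%4 : ∀ u → even-square u % 4 ≡ 0
    even%4 u = m*n%n≡0 (u * u) 4

    odd%4 : ∀ u → odd-square u % 4 ≡ 1
    odd%4 u = [m+kn]%n≡m%n 1 (u * u + u) 4

  positive : ∃[ t ] (t < p × n ≡ 4 * t * t [mod m ]) → Pos (a n)
  positive (t , t<p , n≡) = let (r , r≤n , d) = small-representative (λ r → r * r) m′ m {n} {2 * t}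
                                  (ℕP.*-mono-< {2} {4} (s≤s (s≤s (s≤s z≤n))) t<p) (subst (λ x → n ≡ x [mod m ]) (arith t) n≡) N<n
                            in go r r≤n d (square r)
    where
    arith : ∀ t → 4 * t * t ≡ 2 * t * (2 * t)
    arith = solve-∀
    n%4 : n % 4 ≡ 0
    n%4 = mod4 {n} {4 * t * t} n≡ ∙ cong (_% 4) (arith′ t) ∙ even%4 t
      where
      arith′ : ∀ t → 4 * t * t ≡ t * t * 4
      arith′ = solve-∀
    nonneg : ∀ i → i ≤ n → Dec (m ∣ n ∸ i) → 0ℤ ℤ.≤ f i ⊎ I m (n ∸ i) ≡ 0ℤ
    nonneg i i≤n (no ¬d) = inj₂ (I-off m′ ¬d)
    nonneg i i≤n (yes d) = inj₁ (subst (0ℤ ℤ.≤_) (sym (cong f (split4 i (sym (mod4-∸ i≤n d) ∙ n%4)) ∙ f-at 0 (i / 4) (s≤s z≤n))) (0≤ (nn NonNeg₊-φ⁺) (i / 4)))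
    go : ∀ r → r * r ≤ n → m ∣ n ∸ r * r → Square r → Pos (a n)
    go r r≤n d (even u e) = subst Pos (sym (at eq n)) (·-termwise-pos f n (r * r) (nn (NonNeg₊-I m)) (λ i q → nonneg i q (m ∣? (n ∸ i))) r≤n
      (subst Pos (sym (cong f e ∙ f-at 0 (u * u) (s≤s z≤n))) (φ⁺-on u)) (I-on m′ d))
    -- The representative found need not come from 2t, but an odd r would make n congruent to 1
    -- modulo 4.
    go r r≤n d (odd u e) with trans (sym n%4) (mod4-∸ r≤n d ∙ cong (_% 4) e ∙ odd%4 u)
    ... | ()

  negative : ∃[ t ] (t < p × n ≡ 4 * t * t + 4 * t + 1 [mod m ]) → Neg (a n)
  negative (t , t<p , n≡) = let (r , r≤n , d) = small-representative (λ r → r * r) m′ m {n} {2 * t + 1}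
                                  (bound t<p) (subst (λ x → n ≡ x [mod m ]) (arith t) n≡) N<n
                            in go r r≤n d (square r)
    where
    bound : t < p → 2 * t + 1 < m
    bound q = ≤-trans (≤-reflexive (arith″ t)) (≤-trans (ℕP.*-monoʳ-≤ 2 q) (ℕP.*-monoˡ-≤ p (s≤s (s≤s (z≤n {2})))))
      where
      arith″ : ∀ t → suc (2 * t + 1) ≡ 2 * suc t
      arith″ = solve-∀
    arith : ∀ t → 4 * t * t + 4 * t + 1 ≡ (2 * t + 1) * (2 * t + 1)
    arith = solve-∀
    n%4 : n % 4 ≡ 1
    n%4 = mod4 {n} {4 * t * t + 4 * t + 1} n≡ ∙ cong (_% 4) (arith′ t) ∙ odd%4 t
      where
      arith′ : ∀ t → 4 * t * t + 4 * t + 1 ≡ 1 + (t * t + t) * 4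
      arith′ = solve-∀
    f-neg : ∀ i → (⊖ f) (1 + i * 4) ≡ + 2 *ᶻ ψ² i
    f-neg i = ⊖-at f _ ∙ cong ℤ.-_ (f-at 1 i (s≤s (s≤s z≤n)) ∙ κ·-at (ℤ.- (+ 2)) ψ² i) ∙ ℤP.neg-distribˡ-* (ℤ.- (+ 2)) (ψ² i)
    nonneg : ∀ i → i ≤ n → Dec (m ∣ n ∸ i) → 0ℤ ℤ.≤ (⊖ f) i ⊎ I m (n ∸ i) ≡ 0ℤ
    nonneg i i≤n (no ¬d) = inj₂ (I-off m′ ¬d)
    nonneg i i≤n (yes d) = inj₁ (subst (0ℤ ℤ.≤_) (sym (cong (⊖ f) (split4 i (sym (mod4-∸ i≤n d) ∙ n%4)) ∙ f-neg (i / 4)))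
      (*-nonneg {+ 2} (ℤ.+≤+ z≤n) (0≤ (nn (NonNeg₊-os 1 2)) (i / 4))))
    flip-sign : ∀ {x} → 0ℤ ℤ.< ℤ.- x → x ℤ.< 0ℤ
    flip-sign {ℤ.-[1+ _ ]} _ = ℤ.-<+
    flip-sign {+ zero} (ℤ.+<+ ())
    go : ∀ r → r * r ≤ n → m ∣ n ∸ r * r → Square r → Neg (a n)
    go r r≤n d (odd u e) = flip-sign (subst Pos (at (solve 2 (λ f i → (:- f) :* i := :- (f :* i)) ≈-refl f (I m)) n ∙
        ⊖-at (f · I m) n ∙ cong ℤ.-_ (sym (at eq n)))
      (·-termwise-pos (⊖ f) n (r * r) (nn (NonNeg₊-I m)) (λ i q → nonneg i q (m ∣? (n ∸ i))) r≤n
        (subst Pos (sym (cong (⊖ f) e ∙ f-neg (u * u + u))) (*-pos {+ 2} (ℤ.+<+ (s≤s z≤n)) (ψ²-on u))) (I-on m′ d)))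
    go r r≤n d (even u e) with trans (sym n%4) (mod4-∸ r≤n d ∙ cong (_% 4) e ∙ even%4 u)
    ... | ()

  vanishing : ¬ (∃[ t ] (t < p × n ≡ 4 * t * t + 4 * t + 1 [mod m ])) → ¬ (∃[ t ] (t < p × n ≡ 4 * t * t [mod m ])) → Zero (a n)
  vanishing ¬odd ¬even = at eq n ∙ ·-termwise-0 f (I m) n λ i i≤n → term-off i i≤n (m ∣? (n ∸ i))
    where
    reduce-even : ∀ s q → (s + q * p) * (s + q * p) * 4 ≡ 4 * s * s + (2 * s * q + q * q * p) * m
    reduce-even s q = arith s q p
      where
      arith : ∀ s q p → (s + q * p) * (s + q * p) * 4 ≡ 4 * s * s + (2 * s * q + q * q * p) * (4 * p)
      arith = solve-∀
    reduce-odd : ∀ s q → 1 + ((s + q * p) * (s + q * p) + (s + q * p)) * 4 ≡ 4 * s * s + 4 * s + 1 + (2 * s * q + q * q * p + q) * m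
    reduce-odd s q = arith s q p
      where
      arith : ∀ s q p → 1 + ((s + q * p) * (s + q * p) + (s + q * p)) * 4 ≡ 4 * s * s + 4 * s + 1 + (2 * s * q + q * q * p + q) * (4 * p)
      arith = solve-∀
    f-off : ∀ i → i ≤ n → m ∣ n ∸ i → ∀ s → s < 4 → i % 4 ≡ s → f i ≡ 0ℤ
    f-off i i≤n d 0 lt e = cong f (split4 i e) ∙ f-at 0 (i / 4) lt ∙ φ⁺-off λ t e′ → ¬even (t % p , m%n<n t p ,
      %⇒mod {m′} {n} {4 * (t % p) * (t % p)} (∣∸⇒% i≤n d ∙ cong (_% m) (split4 i e ∙ cong (_* 4) (e′ ∙ cong (λ t → t * t) (m≡m%n+[m/n]*n t p)) ∙ reduce-even (t % p) (t / p)) ∙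
        %-+* (4 * (t % p) * (t % p)) (2 * (t % p) * (t / p) + t / p * (t / p) * p) m′))
    f-off i i≤n d 1 lt e = cong f (split4 i e) ∙ f-at 1 (i / 4) lt ∙ κ·-at _ ψ² _ ∙ cong (ℤ.- (+ 2) *ᶻ_) (ψ²-off λ t e′ → ¬odd (t % p , m%n<n t p ,
      %⇒mod {m′} {n} {4 * (t % p) * (t % p) + 4 * (t % p) + 1} (∣∸⇒% i≤n d ∙ cong (_% m) (split4 i e ∙ cong (λ x → 1 + x * 4) (e′ ∙ cong (λ t → t * t + t) (m≡m%n+[m/n]*n t p)) ∙ reduce-odd (t % p) (t / p)) ∙
        %-+* (4 * (t % p) * (t % p) + 4 * (t % p) + 1) (2 * (t % p) * (t / p) + t / p * (t / p) * p + t / p) m′))) ∙ refl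
    f-off i i≤n d 2 lt e = cong f (split4 i e) ∙ f-at 2 (i / 4) lt ∙ κ0-at (i / 4)
    f-off i i≤n d 3 lt e = cong f (split4 i e) ∙ f-at 3 (i / 4) lt ∙ κ0-at (i / 4)
    f-off i i≤n d (suc (suc (suc (suc _)))) (s≤s (s≤s (s≤s (s≤s ())))) e
    term-off : ∀ i → i ≤ n → Dec (m ∣ n ∸ i) → f i ≡ 0ℤ ⊎ I m (n ∸ i) ≡ 0ℤ
    term-off i i≤n (no ¬d) = inj₂ (I-off m′ ¬d)
    term-off i i≤n (yes d) = inj₁ (f-off i i≤n d (i % 4) (m%n<n i 4) refl)

theorem1p3 : ((p : ℕ) → Prime p → 3 ≤ p → (n : ℕ) →
    (+ maxMinRep tri p p) ℤ.- (+ p) ℤ.< (+ n) →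
    ((∃[ r ] (r < p × n ≡ tri r [mod p ])) → Pos (etaQ ((2 , 2) ∷ []) ((1 , 1) ∷ (p , 1) ∷ []) n))
    × (¬ (∃[ r ] (r < p × n ≡ tri r [mod p ])) → Zero (etaQ ((2 , 2) ∷ []) ((1 , 1) ∷ (p , 1) ∷ []) n)))
    ×
    ((p : ℕ) → (p ≡ 1 ⊎ (Prime p × 3 ≤ p)) → (n : ℕ) →
    (+ maxMinRep (λ r → r * r) (4 * p) (4 * p)) ℤ.- (+ (4 * p)) ℤ.< (+ n) →
    ((∃[ t ] (t < p × n ≡ 4 * t * t + 4 * t + 1 [mod 4 * p ])) → Neg (etaQ ((1 , 2) ∷ []) ((2 , 1) ∷ (4 * p , 1) ∷ []) n))
    × ((∃[ t ] (t < p × n ≡ 4 * t * t [mod 4 * p ])) → Pos (etaQ ((1 , 2) ∷ []) ((2 , 1) ∷ (4 * p , 1) ∷ []) n))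
    × (¬ (∃[ t ] (t < p × n ≡ 4 * t * t + 4 * t + 1 [mod 4 * p ]))
    → ¬ (∃[ t ] (t < p × n ≡ 4 * t * t [mod 4 * p ]))
    → Zero (etaQ ((1 , 2) ∷ []) ((2 , 1) ∷ (4 * p , 1) ∷ []) n)))
    ×
    ((n : ℕ) →
    (n % 3 ≡ 0 → Pos (etaQ ((1 , 3) ∷ []) ((3 , 2) ∷ []) n))
    × (n % 3 ≡ 1 → Neg (etaQ ((1 , 3) ∷ []) ((3 , 2) ∷ []) n))
    × (n % 3 ≡ 2 → Zero (etaQ ((1 , 3) ∷ []) ((3 , 2) ∷ []) n)))
    ×
    ((n : ℕ) →
    (n % 3 ≡ 0 → Pos (etaQ ((1 , 2) ∷ []) ((2 , 1) ∷ (3 , 2) ∷ []) n))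
    × (n % 3 ≡ 1 → Neg (etaQ ((1 , 2) ∷ []) ((2 , 1) ∷ (3 , 2) ∷ []) n))
    × (n % 3 ≡ 2 → Zero (etaQ ((1 , 2) ∷ []) ((2 , 1) ∷ (3 , 2) ∷ []) n)))
    ×
    ((n : ℕ) →
    (n % 4 ∈ (0 ∷ 2 ∷ []) → Pos (etaQ ((1 , 4) ∷ []) ((2 , 2) ∷ (4 , 1) ∷ []) n))
    × (n % 4 ≡ 1 → Neg (etaQ ((1 , 4) ∷ []) ((2 , 2) ∷ (4 , 1) ∷ []) n))
    × (n % 4 ≡ 3 → Zero (etaQ ((1 , 4) ∷ []) ((2 , 2) ∷ (4 , 1) ∷ []) n)))
    ×
    ((n : ℕ) →
    (n % 4 ∈ (0 ∷ 1 ∷ 2 ∷ []) → Pos (etaQ ((2 , 10) ∷ []) ((1 , 4) ∷ (4 , 5) ∷ []) n))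
    × (n % 4 ≡ 3 → Zero (etaQ ((2 , 10) ∷ []) ((1 , 4) ∷ (4 , 5) ∷ []) n)))
    ×
    ((n : ℕ) →
    (n % 5 ∈ (0 ∷ 3 ∷ 4 ∷ []) → Pos (etaQ ((1 , 2) ∷ []) ((5 , 3) ∷ []) n))
    × (n % 5 ∈ (1 ∷ 2 ∷ []) → Neg (etaQ ((1 , 2) ∷ []) ((5 , 3) ∷ []) n)))
    ×
    ((n : ℕ) →
    (n % 9 ∈ (0 ∷ 2 ∷ 5 ∷ 8 ∷ []) → Pos (etaQ ((1 , 9) ∷ []) ((3 , 9) ∷ []) n))
    × (n % 9 ∈ (1 ∷ 3 ∷ 4 ∷ 7 ∷ []) → Neg (etaQ ((1 , 9) ∷ []) ((3 , 9) ∷ []) n))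
    × (n % 9 ≡ 6 → Zero (etaQ ((1 , 9) ∷ []) ((3 , 9) ∷ []) n)))
    ×
    ((n : ℕ) →
    (n % 9 ∈ (0 ∷ 2 ∷ 5 ∷ 8 ∷ []) → Pos (etaQ ((1 , 9) ∷ []) ((3 , 11) ∷ []) n))
    × (n % 9 ∈ (1 ∷ 3 ∷ 4 ∷ 6 ∷ 7 ∷ []) → Neg (etaQ ((1 , 9) ∷ []) ((3 , 11) ∷ []) n)))
    ×
    ((n : ℕ) →
    (n % 9 ∈ (0 ∷ 2 ∷ 5 ∷ 8 ∷ []) → Pos (etaQ ((1 , 9) ∷ []) ((3 , 12) ∷ []) n))
    × (n % 9 ∈ (1 ∷ 4 ∷ 7 ∷ []) → Neg (etaQ ((1 , 9) ∷ []) ((3 , 12) ∷ []) n))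
    × (n % 9 ∈ (3 ∷ 6 ∷ []) → Zero (etaQ ((1 , 9) ∷ []) ((3 , 12) ∷ []) n)))
    ×
    ((i : ℕ) → 12 < i → (n : ℕ) →
    (n % 3 ∈ (0 ∷ 2 ∷ []) → Pos (etaQ ((1 , 9) ∷ []) ((3 , i) ∷ []) n))
    × (n % 3 ≡ 1 → Neg (etaQ ((1 , 9) ∷ []) ((3 , i) ∷ []) n)))
theorem1p3 = part1
  , (λ { (suc p′) _ n N<n → Part2.negative p′ n N<n , Part2.positive p′ n N<n , Part2.vanishing p′ n N<n
       ; zero (inj₂ (_ , ())) })
  , part3 , part4 , part5 , part6 , part7 , part8 , part9a , part9b , part9c
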